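{- Let $n\ge 1$ be an integer, $p$ a prime, and let $M=(a_{i,j})\in M^{n\times n}(\mathbb{F}_p)$ be an arbitrary nonsingular matrix with row vectors $a_1,\dots,a_n$; let $e_1,\dots,e_n$ be the standard basis vectors of $\mathbb{F}_p^n$. (i) Let $k$ be an integer with $p>k\ge 1$ and $N_k(p)\cdot S_k(p)<p-1$. Then $$\prod_{1\le i\le n}(1-g^{e_i})^k\cdot\prod_{1\le i\le n}(1-g^{a_i})^k\neq 0\in\mathbb{F}_p[\mathbb{F}_p^n].$$ (ii) Let $p$ be a prime with $61<p\neq 79$ and let $c_i,d_i\in\mathbb{F}_p$ ($1\le i\le n$) be arbitrary residues. Then there exists a vector $x\in\mathbb{F}_p^n$ such that $x_i\neq c_i$ for each $1\le i\le n$ and $(Mx)_i\neq d_i$ for each $1\le i\le n$. (iii) There is an absolute constant $K$ (independent of $k,p,n,M$) such that the following holds. Assume $k\ge 2$ is an integer and $p>k^{Kk}$. For each $1\le i\le n$ let $c_{i,\ell}\in\mathbb{F}_p$ ($\ell\in[k]$) be $k$ different residues and let $d_{i,\ell}\in\mathbb{F}_p$ ($\ell\in[k]$) be $k$ different residues. Then there exists a vector $x\in\mathbb{F}_p^n$ such that $x_i\neq c_{i,\ell}$ and $(Mx)_i\neq d_{i,\ell}$ for all $1\le i\le n$, $1\le \ell\le k$.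
   Context: $[n]=\{1,\dots,n\}$. For a group ring $R[\mathbb{F}_p^n]$ the multiplicative notation $g^v$ ($v\in\mathbb{F}_p^n$) denotes the group element $v$, so $g^vg^w=g^{v+w}$. For an integer $k\ge1$ and a prime $p\ge 2k+1$: a subset $A\subseteq\mathbb{F}_p$ is $S_k$-type if for every $a\in A$ there is $d\in\mathbb{F}_p^*=\mathbb{F}_p\setminus\{0\}$ with $a+id\in A$ for all $-k\le i\le k$; $S_k(p)$ is the minimum size of an $S_k$-type subset of $\mathbb{F}_p$. A subset $A\subseteq\mathbb{F}_p$ is $N_k$-type if it is $S_k$-type and additionally for every $a\notin A$ there is $d\in\mathbb{F}_p^*$ with $a+id\in A$ for all $1\le i\le k$; $N_k(p)$ is the minimum size of an $N_k$-type subset of $\mathbb{F}_p$. (The hypothesis in (i) presupposes these quantities are defined.)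
   Formalization: S_k-type sets are required to be nonempty; otherwise the empty set gives S_k(p)=0 and (i) fails, e.g. for p=3, k=1, n=2 and M with rows (1,1), (1,-1). -}

module Defs where

open import Data.Nat using (ℕ; zero; suc; _+_; _*_; _∸_; _≤_; _<_; NonZero)
open import Data.Nat.DivMod using (_mod_)
open import Data.Nat.Primality using (Prime; prime⇒nonZero)
open import Data.Fin using (Fin; toℕ) renaming (zero to fzero; suc to fsuc)
open import Data.Fin.Properties using (_≟_)
open import Data.Fin.Subset using (Subset; _∈_; _∉_; ∣_∣; Nonempty)
open import Data.Bool using (Bool; true; false; if_then_else_; _∧_)
open import Data.List using (List; []; _∷_; map; concatMap; foldr; allFin)
open import Data.Product using (Σ; _×_; ∃)
open import Relation.Nullary using (¬_; does)
open import Relation.Binary.PropositionalEquality using (_≡_; _≢_)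

module Fp (p : ℕ) (pr : Prime p) where
  instance
    p≢0 : NonZero p
    p≢0 = prime⇒nonZero pr

  F : Set
  F = Fin p

  0F 1F : F
  0F = 0 mod p
  1F = 1 mod p

  infixl 6 _+F_ _-F_
  infixl 7 _*F_ _·F_

  _+F_ : F → F → F
  a +F b = (toℕ a + toℕ b) mod p

  -F_ : F → F
  -F a = (p ∸ toℕ a) mod p

  _-F_ : F → F → F
  a -F b = a +F (-F b)

  _*F_ : F → F → F
  a *F b = (toℕ a * toℕ b) mod p

  _·F_ : ℕ → F → F
  i ·F d = (i * toℕ d) mod p

  sumL : List F → F
  sumL = foldr _+F_ 0F

  Vecp : ℕ → Set
  Vecp n = Fin n → F

  Mat : ℕ → Set
  Mat n = Fin n → Fin n → F

  mulMV : ∀ {n} → Mat n → Vecp n → Vecp n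
  mulMV {n} M x i = sumL (map (λ j → M i j *F x j) (allFin n))

  mulMM : ∀ {n} → Mat n → Mat n → Mat n
  mulMM {n} M N i j = sumL (map (λ l → M i l *F N l j) (allFin n))

  idMat : ∀ {n} → Mat n
  idMat i j = if does (i ≟ j) then 1F else 0F

  Nonsingular : ∀ {n} → Mat n → Set
  Nonsingular {n} M = Σ (Mat n) λ N →
    (∀ i j → mulMM M N i j ≡ idMat i j) × (∀ i j → mulMM N M i j ≡ idMat i j)

  e : ∀ {n} → Fin n → Vecp n
  e i j = idMat i j

  cons : ∀ {n} → F → Vecp n → Vecp (suc n)
  cons a v fzero = a
  cons a v (fsuc j) = v j

  allVecs : (n : ℕ) → List (Vecp n)
  allVecs zero = (λ ()) ∷ []
  allVecs (suc n) = concatMap (λ a → map (cons a) (allVecs n)) (allFin p)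

  _-V_ : ∀ {n} → Vecp n → Vecp n → Vecp n
  (u -V v) i = u i -F v i

  eqV : ∀ {n} → Vecp n → Vecp n → Bool
  eqV {n} u v = foldr _∧_ true (map (λ i → does (u i ≟ v i)) (allFin n))

  -- The group ring F_p[F_p^n]: an element is its coefficient function
  -- F_p^n → F_p (all functions are finitely supported since F_p^n is finite).
  GR : ℕ → Set
  GR n = Vecp n → F

  g^ : ∀ {n} → Vecp n → GR n
  g^ a v = if eqV v a then 1F else 0F

  oneGR : ∀ {n} → GR n
  oneGR = g^ (λ _ → 0F)

  zeroGR : ∀ {n} → GR n
  zeroGR _ = 0F

  _-GR_ : ∀ {n} → GR n → GR n → GR n
  (f -GR h) v = f v -F h v

  _⋆_ : ∀ {n} → GR n → GR n → GR n
  _⋆_ {n} f h v = sumL (map (λ w → f w *F h (v -V w)) (allVecs n))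

  powGR : ∀ {n} → GR n → ℕ → GR n
  powGR f zero = oneGR
  powGR f (suc k) = f ⋆ powGR f k

  prodGR : ∀ {n} → (Fin n → GR n) → GR n
  prodGR {n} f = foldr _⋆_ oneGR (map f (allFin n))

  SkType : ℕ → Subset p → Set
  SkType k A = Nonempty A × (∀ a → a ∈ A →
    ∃ λ (d : F) → d ≢ 0F × (∀ i → i ≤ k → (a +F (i ·F d)) ∈ A × (a -F (i ·F d)) ∈ A))

  NkType : ℕ → Subset p → Set
  NkType k A = SkType k A × (∀ a → a ∉ A →
    ∃ λ (d : F) → d ≢ 0F × (∀ i → 1 ≤ i → i ≤ k → (a +F (i ·F d)) ∈ A))

  IsMinSize : (Subset p → Set) → ℕ → Set
  IsMinSize P m = (∃ λ A → P A × ∣ A ∣ ≡ m) × (∀ A → P A → m ≤ ∣ A ∣)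

{-# OPTIONS --safe #-}

-- Write the product as an operator applied to the unit: (1 - g^b) f has coefficients f(u) - f(u - b).
-- Suppose the product of the factors (1 - g^h)^k, h running over two independent families, vanishes while all proper
-- subproducts do not.  Each factor 1 - g^h may be replaced by 1 - g^(dh), d ≠ 0, without changing which subproducts
-- vanish.  Now start from a linear relation Σ w_h h = 0.  Taking a point of the support of a proper subproduct,
-- the vanishing of the full product forces another one, and comparing the two gives a new relation in which the
-- coefficients of the subproduct have moved by differences of subset sums of the d's, and the others by subset sums,
-- at least one of them nonempty.  Choosing the d's according to sets A and B that are stable under such moves, all
-- coefficients of the larger family are driven into prescribed translates of A while those of the smaller family stay
-- in B.  Independence makes the relation determine the translates, so p^r ≤ |A|^r |B|^s with s ≤ r, contradicting
-- |A||B| < p.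
--
-- If no vector x avoids the given hyperplanes, the product ∏ (1 - ζ^(-c) g^h) vanishes at every character, hence it is
-- zero over Z[ζ], and reducing modulo 1 - ζ gives the vanishing of the product over F_p.  Here Z[ζ] is replaced by
-- functions on an additional coordinate in F_p modulo constants, and the characters by a discrete Radon transform.
--
-- For the existence statements A = B is the k-fold sumset of a set in which every element is the midpoint of two others:
-- {0, ±⌊p/2^i⌋} in general, and a tabulated set when k = 1 and p < 290.
module Submission where

open import Defs
open import Algebra using (AbelianGroup)
open import Level using (0ℓ)
open import Data.Nat using (ℕ; _*_; _∸_; _^_; _≤_; _<_)
open import Data.Nat.Primality using (Prime)
open import Data.Fin using (Fin)
open import Data.Product using (_×_; ∃; _,_)
open import Function using (Injective)
open import Relation.Nullary using (¬_)
open import Relation.Binary.PropositionalEquality using (_≡_; _≢_)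

-- All coefficients start at 0, and this makes the two families asymmetric. A prescribed translate
-- of `A` need not contain 0, so `A` has to attract from outside; the smaller family gets a fixed
-- translate of `B` that contains 0, and stability keeps it there. Proper subproducts are nonzero by
-- induction on the number of vectors, since subfamilies of independent families are independent;
-- the one used is that of the vectors already on target. Progress is measured by the vectors off
-- target together with a potential, which is constant if `A` attracts in one move and the residue
-- itself if steps of -1 walk down to `A`. There are p^r choices of translates, and each yields a
-- relation, recorded only by positions within `A` and `B`. Equal records mean equal combinations of
-- the smaller family, hence of the larger one, hence equal coefficients and equal translates.
-- Avoiding hyperplanes calls for integer coefficients because inverting the Radon transform divides
-- by p. Reduction modulo 1 - ζ comes after that, and constants disappear in it, as their sum over
-- the additional coordinate is a multiple of p.

-- Inequalities between powers of two and squares of logarithms.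

module Numeric where

  open import Data.Nat
  open import Data.Nat.Properties
  open import Data.Nat.DivMod using (m≡m%n+[m/n]*n; m%n<n)
  open import Data.Nat.Tactic.RingSolver using (solve-∀)
  open import Relation.Nullary using (yes; no; contradiction)
  open import Relation.Binary.PropositionalEquality using (sym; cong)
  open ≤-Reasoning

  log₂-bracket : ∀ n → ∃ λ f → 2 ^ f ≤ suc n × suc n < 2 ^ suc f
  log₂-bracket zero    = 0 , s≤s z≤n , s≤s (s≤s z≤n)
  log₂-bracket (suc n) with f , lo , hi ← log₂-bracket n with suc (suc n) <? 2 ^ suc f
  ... | yes lt = f , m≤n⇒m≤1+n lo , lt
  ... | no ≮   = suc f , ≮⇒≥ ≮ , (begin-strict
    suc (suc n)          ≤⟨ hi ⟩
    2 ^ suc f            <⟨ ^-monoʳ-< 2 (s≤s (s≤s z≤n)) (n<1+n (suc f)) ⟩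
    2 ^ suc (suc f)      ∎)

  n<2^n : ∀ n → n < 2 ^ n
  n<2^n zero    = s≤s z≤n
  n<2^n (suc n) = begin
    suc (suc n)          ≤⟨ +-mono-≤ (m^n>0 2 n) (n<2^n n) ⟩
    2 ^ n + 2 ^ n        ≡⟨ cong (2 ^ n +_) (+-identityʳ (2 ^ n)) ⟨
    2 ^ suc n            ∎

  square≤4*2^ : ∀ h → h * h ≤ 4 * 2 ^ h
  square≤4*2^ zero    = z≤n
  square≤4*2^ (suc h) = begin
    suc h * suc h                      ≡⟨ expand h ⟩
    h * h + (h + suc h)                ≤⟨ +-mono-≤ (square≤4*2^ h) (+-mono-≤ (<⇒≤ (n<2^n h)) (n<2^n h)) ⟩
    4 * 2 ^ h + (2 ^ h + 2 ^ h)        ≤⟨ m≤m+n _ (2 * 2 ^ h) ⟩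
    4 * 2 ^ h + (2 ^ h + 2 ^ h) + 2 * 2 ^ h   ≡⟨ collect (2 ^ h) ⟩
    4 * 2 ^ suc h                      ∎
    where
    expand : ∀ h → suc h * suc h ≡ h * h + (h + suc h)
    expand = solve-∀
    collect : ∀ x → 4 * x + (x + x) + 2 * x ≡ 4 * (2 * x)
    collect = solve-∀

  square-cancel-< : ∀ {a b} → a * a < b * b → a < b
  square-cancel-< {a} {b} lt with a <? b
  ... | yes a<b = a<b
  ... | no a≮b  = contradiction lt (≤⇒≯ (*-mono-≤ (≮⇒≥ a≮b) (≮⇒≥ a≮b)))

  ^-cancelˡ-< : ∀ r {a b} → a ^ r < b ^ r → a < b
  ^-cancelˡ-< r {a} {b} lt with a <? b
  ... | yes a<b = a<b
  ... | no a≮b  = contradiction lt (≤⇒≯ (^-monoˡ-≤ r (≮⇒≥ a≮b)))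

  -- Comparing squares leaves h * h to be bounded by 4 * 2^h. The exponent 10 is 2 + 8: two factors
  -- k come from (8k)^2, and k^8 ≥ 2^8 absorbs the constant 64 * 4.
  8kh<2^h : ∀ k h → 2 ≤ k → k ^ 10 < 2 ^ h → 8 * k * h < 2 ^ h
  8kh<2^h k h 2≤k k^10< = square-cancel-< (begin-strict
    (8 * k * h) * (8 * k * h)          ≡⟨ regroup k h ⟩
    64 * (k * k) * (h * h)             ≤⟨ *-monoʳ-≤ (64 * (k * k)) (square≤4*2^ h) ⟩
    64 * (k * k) * (4 * 2 ^ h)         ≡⟨ regroup′ (k * k) (2 ^ h) ⟩
    k * k * 2 ^ 8 * 2 ^ h              ≤⟨ *-monoˡ-≤ (2 ^ h) (*-monoʳ-≤ (k * k) (^-monoˡ-≤ 8 2≤k)) ⟩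
    k * k * k ^ 8 * 2 ^ h              ≡⟨ cong (_* 2 ^ h) (*-assoc k k (k ^ 8)) ⟩
    k ^ 10 * 2 ^ h                     <⟨ *-monoˡ-< (2 ^ h) {{m^n≢0 2 h}} k^10< ⟩
    2 ^ h * 2 ^ h                      ∎)
    where
    regroup : ∀ k h → (8 * k * h) * (8 * k * h) ≡ 64 * (k * k) * (h * h)
    regroup = solve-∀
    regroup′ : ∀ x y → 64 * x * (4 * y) ≡ x * 256 * y
    regroup′ = solve-∀

  -- Write f = 2k g + r with r < 2k; then k^10 < 2^(g+1), which gives 2f + 1 < 2^g.
  sumset-small : ∀ k f p → 2 ≤ k → k ^ (20 * k) < p → 2 ^ f ≤ p → p < 2 ^ suc f →
                 suc (2 * f) ^ k * suc (2 * f) ^ k < p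
  sumset-small zero       f p () _ _ _
  sumset-small k@(suc _)  f p 2≤k k^20k<p 2^f≤p p<2^1+f = begin-strict
    b ^ k * b ^ k            ≡⟨ ^-distribˡ-+-* b k k ⟨
    b ^ (k + k)              ≡⟨ cong (λ m → b ^ (k + m)) (+-identityʳ k) ⟨
    b ^ r                    <⟨ ^-monoˡ-< r b<2^g ⟩
    (2 ^ g) ^ r              ≡⟨ ^-*-assoc 2 g r ⟩
    2 ^ (g * r)              ≤⟨ ^-monoʳ-≤ 2 (≤-trans (m≤n+m (g * r) (f % r)) (≤-reflexive (sym f≡))) ⟩
    2 ^ f                    ≤⟨ 2^f≤p ⟩
    p                        ∎
    where
    b r g : ℕ
    b = suc (2 * f)
    r = 2 * k
    g = f / r
    f≡ : f ≡ f % r + g * r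
    f≡ = m≡m%n+[m/n]*n f r
    f<r[1+g] : f < r * suc g
    f<r[1+g] = begin-strict
      f                 ≡⟨ f≡ ⟩
      f % r + g * r     <⟨ +-monoˡ-< (g * r) (m%n<n f r) ⟩
      suc g * r         ≡⟨ *-comm (suc g) r ⟩
      r * suc g         ∎
    k^10<2^1+g : k ^ 10 < 2 ^ suc g
    k^10<2^1+g = ^-cancelˡ-< r (begin-strict
      (k ^ 10) ^ r           ≡⟨ ^-*-assoc k 10 r ⟩
      k ^ (10 * r)           ≡⟨ cong (k ^_) (*-assoc 10 2 k) ⟨
      k ^ (20 * k)           <⟨ k^20k<p ⟩
      p                      <⟨ p<2^1+f ⟩
      2 ^ suc f              ≤⟨ ^-monoʳ-≤ 2 f<r[1+g] ⟩
      2 ^ (r * suc g)        ≡⟨ cong (2 ^_) (*-comm r (suc g)) ⟩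
      2 ^ (suc g * r)        ≡⟨ ^-*-assoc 2 (suc g) r ⟨
      (2 ^ suc g) ^ r        ∎)
    b<2^g : b < 2 ^ g
    -- Doubling turns 2f + 1 into at most 4(f + 1) ≤ 8k(g + 1), the left side of `8kh<2^h` for h = g
    -- + 1.
    b<2^g = *-cancelˡ-< 2 b (2 ^ g) (begin-strict
      2 * b                    ≤⟨ *-monoʳ-≤ 2 (s≤s (m≤n+m (2 * f) 1)) ⟩
      2 * (2 + 2 * f)          ≡⟨ regroup f ⟩
      4 * suc f                ≤⟨ *-monoʳ-≤ 4 f<r[1+g] ⟩
      4 * (r * suc g)          ≡⟨ regroup′ k (suc g) ⟩
      8 * k * suc g            <⟨ 8kh<2^h k (suc g) 2≤k k^10<2^1+g ⟩
      2 ^ suc g                ∎)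
      where
      regroup : ∀ f → 2 * (2 + 2 * f) ≡ 4 * suc f
      regroup = solve-∀
      regroup′ : ∀ k h → 4 * (2 * k * h) ≡ 8 * k * h
      regroup′ = solve-∀

  -- 361 < 512 at g = 0, and from g to g + 1 the square less than doubles: 281 + 68g + 4g^2 is 2(19
  -- + 2g)^2 - (21 + 2g)^2.
  [19+2g]²<2^[9+g] : ∀ g → (19 + 2 * g) * (19 + 2 * g) < 2 ^ (9 + g)
  [19+2g]²<2^[9+g] zero    = m≤m+n 362 150
  [19+2g]²<2^[9+g] (suc g) = begin-strict
    (19 + 2 * suc g) * (19 + 2 * suc g)                                    ≤⟨ m≤m+n _ (281 + 68 * g + 4 * (g * g)) ⟩
    (19 + 2 * suc g) * (19 + 2 * suc g) + (281 + 68 * g + 4 * (g * g))     ≡⟨ double g ⟩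
    2 * ((19 + 2 * g) * (19 + 2 * g))                                      <⟨ *-monoʳ-< 2 ([19+2g]²<2^[9+g] g) ⟩
    2 * 2 ^ (9 + g)                                                        ≡⟨ cong (2 ^_) (+-suc 9 g) ⟨
    2 ^ (9 + suc g)                                                        ∎
    where
    double : ∀ g → (19 + 2 * suc g) * (19 + 2 * suc g) + (281 + 68 * g + 4 * (g * g)) ≡ 2 * ((19 + 2 * g) * (19 + 2 * g))
    double = solve-∀

  -- For f ≥ 9 this is the preceding bound with g = f - 9. For f ≤ 8 the left side is at most 17 *
  -- 17 = 289, which is why the general construction starts at 290.
  halves-small : ∀ f p → 290 ≤ p → 2 ^ f ≤ p → p < 2 ^ suc f → suc (2 * f) * suc (2 * f) < p
  halves-small f p 290≤p 2^f≤p p<2^1+f with 9 ≤? f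
  ... | yes 9≤f = begin-strict
    suc (2 * f) * suc (2 * f)                    ≡⟨ cong (λ x → suc (2 * x) * suc (2 * x)) (m+[n∸m]≡n 9≤f) ⟨
    suc (2 * (9 + g)) * suc (2 * (9 + g))        ≡⟨ regroup g ⟩
    (19 + 2 * g) * (19 + 2 * g)                  <⟨ [19+2g]²<2^[9+g] g ⟩
    2 ^ (9 + g)                                  ≡⟨ cong (2 ^_) (m+[n∸m]≡n 9≤f) ⟩
    2 ^ f                                        ≤⟨ 2^f≤p ⟩
    p                                            ∎
    where
    g : ℕ
    g = f ∸ 9
    regroup : ∀ g → suc (2 * (9 + g)) * suc (2 * (9 + g)) ≡ (19 + 2 * g) * (19 + 2 * g)
    regroup = solve-∀
  ... | no 9≰f = begin-strict
    suc (2 * f) * suc (2 * f)    ≤⟨ *-mono-≤ bound bound ⟩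
    289                          <⟨ ≤-refl ⟩
    290                          ≤⟨ 290≤p ⟩
    p                            ∎
    where
    bound : suc (2 * f) ≤ 17
    bound = s≤s (*-monoʳ-≤ 2 (≤-pred (≰⇒> 9≰f)))

-- Tabulated balanced sets for the primes between 61 and 290.

module SmallPrimes where

  open import Data.Nat using (_+_; NonZero; >-nonZero)
  import Data.Nat as ℕ
  import Data.Nat.Properties as ℕ
  open import Data.Nat.DivMod using (_%_)
  open import Data.Nat.Divisibility using (_∣_; _∣?_)
  open import Data.Nat.Primality using (prime⇒irreducible)
  open import Data.List using (List; []; _∷_; map; length; applyUpTo)
  open import Data.List.Relation.Unary.All using (All; all?)
  import Data.List.Relation.Unary.All as All
  open import Data.List.Relation.Unary.Any using (Any; any?)
  open import Data.List.Membership.Propositional using (_∈_; find)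
  open import Data.List.Membership.Propositional.Properties using (∈-applyUpTo⁺; ∈-map⁻)
  open import Data.List.Membership.DecPropositional ℕ._≟_ using (_∈?_)
  open import Data.Product using (proj₁)
  open import Data.Sum using (_⊎_; inj₁; inj₂)
  open import Relation.Nullary using (Dec; yes; no; contradiction; ¬?; _×-dec_; _⊎-dec_)
  open import Relation.Nullary.Decidable using (from-yes)
  open import Relation.Binary.PropositionalEquality using (refl; sym; subst)

  -- A pair (a , d) certifies that a - d, a, a + d all belong to the set of first components modulo p.
  Certificate : Set
  Certificate = List (ℕ × ℕ)

  support : Certificate → List ℕ
  support = map proj₁

  -- 0 and 1 generate the initial residues at which the attraction argument ends; the last condition
  -- is |A||B| < p for A = B.
  Valid : (p : ℕ) .{{_ : NonZero p}} → Certificate → Set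
  Valid p cs = All (λ (a , d) → 0 < d × d < p × (a + d) % p ∈ support cs × (a + (p ∸ d)) % p ∈ support cs) cs ×
               0 ∈ support cs × 1 ∈ support cs × length cs * length cs < p

  valid? : (p : ℕ) .{{_ : NonZero p}} (cs : Certificate) → Dec (Valid p cs)
  valid? p cs = all? (λ (a , d) → (0 ℕ.<? d) ×-dec (d ℕ.<? p) ×-dec ((a + d) % p ∈? support cs) ×-dec
                                  ((a + (p ∸ d)) % p ∈? support cs)) cs
                ×-dec (0 ∈? support cs) ×-dec (1 ∈? support cs) ×-dec (length cs * length cs ℕ.<? p)

  table : List (ℕ × Certificate)
  table =
    (67 , (0 , 1) ∷ (1 , 4) ∷ (5 , 5) ∷ (10 , 26) ∷ (36 , 31) ∷ (51 , 15) ∷ (64 , 13) ∷ (66 , 2) ∷ []) ∷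
    (71 , (0 , 1) ∷ (1 , 2) ∷ (3 , 29) ∷ (19 , 18) ∷ (32 , 13) ∷ (37 , 34) ∷ (45 , 26) ∷ (70 , 33) ∷ []) ∷
    (73 , (0 , 1) ∷ (1 , 7) ∷ (8 , 28) ∷ (36 , 36) ∷ (53 , 17) ∷ (67 , 14) ∷ (70 , 3) ∷ (72 , 2) ∷ []) ∷
    (83 , (0 , 1) ∷ (1 , 2) ∷ (3 , 3) ∷ (6 , 16) ∷ (22 , 19) ∷ (41 , 41) ∷ (73 , 32) ∷ (78 , 5) ∷ (82 , 4) ∷
      []) ∷
    (89 , (0 , 1) ∷ (1 , 6) ∷ (7 , 7) ∷ (14 , 17) ∷ (31 , 17) ∷ (48 , 41) ∷ (84 , 36) ∷ (86 , 2) ∷ (88 , 2) ∷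
      []) ∷
    (97 , (0 , 1) ∷ (1 , 2) ∷ (3 , 9) ∷ (12 , 36) ∷ (48 , 48) ∷ (73 , 25) ∷ (91 , 18) ∷ (94 , 3) ∷ (96 , 2) ∷
      []) ∷
    (101 , (0 , 1) ∷ (1 , 2) ∷ (3 , 2) ∷ (5 , 23) ∷ (28 , 37) ∷ (65 , 37) ∷ (83 , 18) ∷ (92 , 9) ∷ (98 , 6) ∷
      (100 , 2) ∷ []) ∷
    (103 , (0 , 1) ∷ (1 , 1) ∷ (2 , 6) ∷ (8 , 8) ∷ (16 , 40) ∷ (56 , 48) ∷ (79 , 23) ∷ (99 , 20) ∷ (101 , 2) ∷
      (102 , 1) ∷ []) ∷
    (107 , (0 , 1) ∷ (1 , 1) ∷ (2 , 2) ∷ (4 , 20) ∷ (24 , 30) ∷ (54 , 52) ∷ (81 , 27) ∷ (91 , 10) ∷ (101 , 10) ∷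
      (106 , 5) ∷ []) ∷
    (109 , (0 , 1) ∷ (1 , 4) ∷ (5 , 4) ∷ (9 , 12) ∷ (21 , 20) ∷ (41 , 41) ∷ (54 , 54) ∷ (82 , 28) ∷ (106 , 24) ∷
      (108 , 2) ∷ []) ∷
    (113 , (0 , 1) ∷ (1 , 2) ∷ (3 , 2) ∷ (5 , 12) ∷ (17 , 17) ∷ (34 , 31) ∷ (65 , 48) ∷ (106 , 41) ∷ (110 , 4) ∷
      (112 , 2) ∷ []) ∷
    (127 , (0 , 1) ∷ (1 , 2) ∷ (3 , 4) ∷ (7 , 8) ∷ (15 , 47) ∷ (62 , 59) ∷ (95 , 33) ∷ (108 , 13) ∷ (121 , 13) ∷
      (124 , 3) ∷ (126 , 2) ∷ []) ∷
    (131 , (0 , 1) ∷ (1 , 8) ∷ (9 , 8) ∷ (17 , 48) ∷ (65 , 65) ∷ (68 , 59) ∷ (100 , 32) ∷ (124 , 24) ∷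
      (127 , 3) ∷ (128 , 4) ∷ (130 , 2) ∷ []) ∷
    (137 , (0 , 1) ∷ (1 , 1) ∷ (2 , 2) ∷ (4 , 2) ∷ (6 , 6) ∷ (12 , 50) ∷ (62 , 58) ∷ (99 , 37) ∷ (120 , 21) ∷
      (129 , 9) ∷ (136 , 7) ∷ []) ∷
    (139 , (0 , 1) ∷ (1 , 2) ∷ (3 , 4) ∷ (7 , 26) ∷ (33 , 35) ∷ (68 , 65) ∷ (120 , 52) ∷ (133 , 13) ∷
      (136 , 3) ∷ (137 , 1) ∷ (138 , 1) ∷ []) ∷
    (149 , (0 , 1) ∷ (1 , 2) ∷ (3 , 4) ∷ (7 , 52) ∷ (59 , 67) ∷ (104 , 45) ∷ (126 , 22) ∷ (141 , 15) ∷
      (144 , 3) ∷ (146 , 2) ∷ (147 , 1) ∷ (148 , 1) ∷ []) ∷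
    (151 , (0 , 1) ∷ (1 , 1) ∷ (2 , 3) ∷ (5 , 3) ∷ (8 , 8) ∷ (16 , 27) ∷ (43 , 54) ∷ (97 , 54) ∷ (124 , 27) ∷
      (140 , 16) ∷ (148 , 8) ∷ (150 , 2) ∷ []) ∷
    (157 , (0 , 1) ∷ (1 , 2) ∷ (3 , 5) ∷ (8 , 8) ∷ (16 , 60) ∷ (76 , 76) ∷ (87 , 71) ∷ (113 , 26) ∷ (139 , 26) ∷
      (152 , 13) ∷ (155 , 3) ∷ (156 , 1) ∷ []) ∷
    (163 , (0 , 1) ∷ (1 , 2) ∷ (3 , 6) ∷ (9 , 9) ∷ (18 , 19) ∷ (37 , 19) ∷ (56 , 53) ∷ (109 , 53) ∷ (136 , 27) ∷
      (148 , 12) ∷ (160 , 12) ∷ (162 , 2) ∷ []) ∷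
    (167 , (0 , 1) ∷ (1 , 2) ∷ (3 , 8) ∷ (11 , 11) ∷ (22 , 21) ∷ (43 , 40) ∷ (65 , 62) ∷ (83 , 83) ∷
      (127 , 62) ∷ (158 , 31) ∷ (162 , 4) ∷ (166 , 4) ∷ []) ∷
    (173 , (0 , 1) ∷ (1 , 6) ∷ (7 , 16) ∷ (23 , 23) ∷ (46 , 63) ∷ (78 , 78) ∷ (109 , 31) ∷ (140 , 31) ∷
      (156 , 16) ∷ (164 , 8) ∷ (168 , 4) ∷ (171 , 3) ∷ (172 , 1) ∷ []) ∷
    (179 , (0 , 1) ∷ (1 , 1) ∷ (2 , 1) ∷ (3 , 3) ∷ (6 , 4) ∷ (10 , 8) ∷ (18 , 37) ∷ (55 , 63) ∷ (118 , 63) ∷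
      (149 , 31) ∷ (160 , 11) ∷ (171 , 11) ∷ (178 , 7) ∷ []) ∷
    (181 , (0 , 1) ∷ (1 , 1) ∷ (2 , 10) ∷ (12 , 15) ∷ (27 , 30) ∷ (57 , 65) ∷ (62 , 60) ∷ (96 , 84) ∷
      (122 , 60) ∷ (138 , 42) ∷ (173 , 35) ∷ (178 , 5) ∷ (180 , 2) ∷ []) ∷
    (191 , (0 , 1) ∷ (1 , 1) ∷ (2 , 2) ∷ (4 , 6) ∷ (10 , 69) ∷ (79 , 82) ∷ (132 , 53) ∷ (161 , 29) ∷
      (181 , 20) ∷ (185 , 4) ∷ (188 , 3) ∷ (189 , 1) ∷ (190 , 1) ∷ []) ∷
    (193 , (0 , 1) ∷ (1 , 1) ∷ (2 , 1) ∷ (3 , 13) ∷ (16 , 13) ∷ (29 , 35) ∷ (64 , 64) ∷ (128 , 64) ∷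
      (175 , 47) ∷ (183 , 8) ∷ (187 , 4) ∷ (191 , 4) ∷ (192 , 1) ∷ []) ∷
    (197 , (0 , 1) ∷ (1 , 2) ∷ (3 , 12) ∷ (15 , 24) ∷ (39 , 24) ∷ (60 , 69) ∷ (63 , 66) ∷ (129 , 69) ∷
      (160 , 97) ∷ (176 , 16) ∷ (188 , 12) ∷ (192 , 4) ∷ (194 , 2) ∷ (196 , 2) ∷ []) ∷
    (199 , (0 , 1) ∷ (1 , 2) ∷ (3 , 4) ∷ (7 , 7) ∷ (14 , 7) ∷ (21 , 23) ∷ (44 , 23) ∷ (60 , 71) ∷ (67 , 64) ∷
      (131 , 71) ∷ (163 , 96) ∷ (188 , 25) ∷ (197 , 9) ∷ (198 , 1) ∷ []) ∷
    (211 , (0 , 1) ∷ (1 , 1) ∷ (2 , 3) ∷ (5 , 8) ∷ (13 , 8) ∷ (17 , 4) ∷ (21 , 16) ∷ (26 , 24) ∷ (37 , 37) ∷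
      (50 , 24) ∷ (74 , 57) ∷ (131 , 81) ∷ (208 , 77) ∷ (210 , 2) ∷ []) ∷
    (223 , (0 , 1) ∷ (1 , 2) ∷ (3 , 4) ∷ (7 , 8) ∷ (15 , 16) ∷ (31 , 32) ∷ (63 , 64) ∷ (88 , 25) ∷ (113 , 106) ∷
      (127 , 96) ∷ (219 , 92) ∷ (220 , 1) ∷ (221 , 1) ∷ (222 , 1) ∷ []) ∷
    (227 , (0 , 1) ∷ (1 , 1) ∷ (2 , 1) ∷ (3 , 3) ∷ (6 , 4) ∷ (10 , 7) ∷ (17 , 18) ∷ (35 , 39) ∷ (74 , 78) ∷
      (152 , 78) ∷ (189 , 37) ∷ (211 , 22) ∷ (217 , 6) ∷ (223 , 6) ∷ (226 , 3) ∷ []) ∷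
    (229 , (0 , 1) ∷ (1 , 1) ∷ (2 , 3) ∷ (5 , 18) ∷ (23 , 18) ∷ (41 , 45) ∷ (86 , 85) ∷ (126 , 103) ∷
      (171 , 45) ∷ (201 , 30) ∷ (216 , 15) ∷ (225 , 9) ∷ (228 , 3) ∷ []) ∷
    (233 , (0 , 1) ∷ (1 , 2) ∷ (3 , 6) ∷ (9 , 9) ∷ (18 , 27) ∷ (45 , 111) ∷ (100 , 100) ∷ (156 , 56) ∷
      (167 , 67) ∷ (200 , 33) ∷ (212 , 12) ∷ (218 , 6) ∷ (224 , 6) ∷ (230 , 6) ∷ (232 , 2) ∷ []) ∷
    (239 , (0 , 1) ∷ (1 , 3) ∷ (4 , 4) ∷ (8 , 8) ∷ (16 , 20) ∷ (36 , 35) ∷ (49 , 97) ∷ (71 , 75) ∷ (127 , 111) ∷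
      (146 , 97) ∷ (191 , 64) ∷ (223 , 32) ∷ (235 , 12) ∷ (237 , 2) ∷ (238 , 1) ∷ []) ∷
    (241 , (0 , 1) ∷ (1 , 1) ∷ (2 , 10) ∷ (12 , 37) ∷ (49 , 47) ∷ (64 , 89) ∷ (96 , 97) ∷ (153 , 89) ∷
      (193 , 40) ∷ (195 , 42) ∷ (216 , 21) ∷ (229 , 13) ∷ (233 , 4) ∷ (237 , 4) ∷ (240 , 3) ∷ []) ∷
    (251 , (0 , 1) ∷ (1 , 1) ∷ (2 , 2) ∷ (4 , 3) ∷ (7 , 13) ∷ (20 , 26) ∷ (46 , 44) ∷ (90 , 93) ∷ (116 , 116) ∷
      (183 , 67) ∷ (219 , 36) ∷ (232 , 13) ∷ (245 , 13) ∷ (248 , 3) ∷ (250 , 2) ∷ []) ∷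
    (257 , (0 , 1) ∷ (1 , 2) ∷ (3 , 2) ∷ (5 , 12) ∷ (17 , 31) ∷ (48 , 31) ∷ (79 , 31) ∷ (110 , 119) ∷
      (111 , 118) ∷ (208 , 97) ∷ (229 , 21) ∷ (239 , 128) ∷ (243 , 14) ∷ (248 , 9) ∷ (250 , 7) ∷ (256 , 6) ∷
      []) ∷
    (263 , (0 , 1) ∷ (1 , 2) ∷ (3 , 41) ∷ (14 , 14) ∷ (28 , 47) ∷ (44 , 119) ∷ (75 , 113) ∷ (101 , 87) ∷
      (163 , 62) ∷ (188 , 25) ∷ (213 , 50) ∷ (225 , 37) ∷ (244 , 19) ∷ (254 , 10) ∷ (260 , 6) ∷ (262 , 2) ∷
      []) ∷
    (269 , (0 , 1) ∷ (1 , 1) ∷ (2 , 2) ∷ (4 , 7) ∷ (11 , 27) ∷ (31 , 27) ∷ (38 , 74) ∷ (58 , 54) ∷ (112 , 81) ∷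
      (153 , 115) ∷ (193 , 40) ∷ (233 , 40) ∷ (253 , 20) ∷ (263 , 10) ∷ (266 , 3) ∷ (268 , 2) ∷ []) ∷
    (271 , (0 , 1) ∷ (1 , 1) ∷ (2 , 3) ∷ (5 , 10) ∷ (15 , 10) ∷ (25 , 33) ∷ (38 , 40) ∷ (58 , 20) ∷ (78 , 86) ∷
      (164 , 106) ∷ (230 , 66) ∷ (253 , 23) ∷ (263 , 10) ∷ (266 , 3) ∷ (269 , 3) ∷ (270 , 1) ∷ []) ∷
    (277 , (0 , 1) ∷ (1 , 1) ∷ (2 , 2) ∷ (4 , 16) ∷ (20 , 44) ∷ (30 , 104) ∷ (64 , 70) ∷ (134 , 137) ∷
      (153 , 123) ∷ (203 , 50) ∷ (228 , 25) ∷ (253 , 25) ∷ (265 , 12) ∷ (271 , 6) ∷ (274 , 3) ∷ (276 , 2) ∷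
      []) ∷
    (281 , (0 , 1) ∷ (1 , 1) ∷ (2 , 3) ∷ (5 , 8) ∷ (13 , 16) ∷ (29 , 16) ∷ (45 , 48) ∷ (93 , 64) ∷ (136 , 139) ∷
      (157 , 112) ∷ (255 , 119) ∷ (269 , 14) ∷ (275 , 6) ∷ (278 , 3) ∷ (280 , 2) ∷ []) ∷
    (283 , (0 , 1) ∷ (1 , 2) ∷ (3 , 2) ∷ (5 , 6) ∷ (11 , 8) ∷ (19 , 21) ∷ (40 , 40) ∷ (80 , 61) ∷ (92 , 52) ∷
      (141 , 140) ∷ (144 , 139) ∷ (176 , 84) ∷ (232 , 56) ∷ (260 , 28) ∷ (281 , 21) ∷ (282 , 1) ∷ []) ∷
    []

  -- Reduction modulo p needs p > 0. The proof is packed together with validity, so that a single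
  -- decision checks the whole table.
  NonZeroValid : ℕ × Certificate → Set
  NonZeroValid (p , cs) = ∃ λ (p>0 : 0 < p) → Valid p {{>-nonZero p>0}} cs

  table-valid : All NonZeroValid table
  table-valid = from-yes (all? nonZeroValid? table)
    where
    nonZeroValid? : ∀ q → Dec (NonZeroValid q)
    nonZeroValid? (ℕ.zero , cs)      = no λ { (() , _) }
    nonZeroValid? (p@(ℕ.suc _) , cs) with valid? p cs
    ... | yes v = yes (ℕ.s≤s ℕ.z≤n , v)
    ... | no ¬v = no λ (_ , v) → ¬v v

  small-divisors : List ℕ
  small-divisors = 2 ∷ 3 ∷ 5 ∷ 7 ∷ 11 ∷ 13 ∷ 17 ∷ []

  Covered : ℕ → Set
  Covered p = p ∈ map proj₁ table ⊎ p ≡ 79 ⊎ Any (_∣ p) small-divisors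

  -- The numbers 62, ..., 289 are sorted by evaluation. A composite number below 19 * 19 has a prime
  -- factor at most 17, so the primes among them are the tabulated ones and 79.
  range-covered : All Covered (applyUpTo (62 +_) 228)
  range-covered = from-yes (all? (λ p → (p ∈? map proj₁ table) ⊎-dec (p ℕ.≟ 79) ⊎-dec any? (_∣? p) small-divisors)
                                 (applyUpTo (62 +_) 228))

  small-divisors-proper : ∀ {d} → d ∈ small-divisors → d ≢ 1 × d ≤ 17
  small-divisors-proper = All.lookup (from-yes (all? (λ d → ¬? (d ℕ.≟ 1) ×-dec (d ℕ.≤? 17)) small-divisors))

  small-prime-certificate : ∀ p → Prime p → 61 < p → p < 290 → p ≢ 79 → ∃ λ cs → NonZeroValid (p , cs)
  small-prime-certificate p pr 61<p p<290 p≢79 = cases (All.lookup range-covered p∈range)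
    where
    p≡ : 62 + (p ∸ 62) ≡ p
    p≡ = ℕ.m+[n∸m]≡n 61<p
    p∈range : p ∈ applyUpTo (62 +_) 228
    p∈range = subst (_∈ applyUpTo (62 +_) 228) p≡
      (∈-applyUpTo⁺ (62 +_) (ℕ.+-cancelˡ-< 62 (p ∸ 62) 228 (subst (_< 290) (sym p≡) p<290)))
    improper : ∀ {d} → d ≢ 1 × d ≤ 17 → d ≡ 1 ⊎ d ≡ p → ∃ λ cs → NonZeroValid (p , cs)
    improper (d≢1 , _)    (inj₁ d≡1)  = contradiction d≡1 d≢1
    improper (_   , d≤17) (inj₂ refl) = contradiction 61<p (ℕ.≤⇒≯ (ℕ.≤-trans d≤17 (ℕ.m≤m+n 17 44)))
    cases : Covered p → ∃ λ cs → NonZeroValid (p , cs)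
    cases (inj₁ q)         = let (_ , cs) , q∈ , eq = ∈-map⁻ proj₁ q
                             in cs , subst (λ m → NonZeroValid (m , cs)) (sym eq) (All.lookup table-valid q∈)
    cases (inj₂ (inj₁ eq)) = contradiction eq p≢79
    cases (inj₂ (inj₂ q))  = let d , d∈ , d∣p = find q
                             in improper (small-divisors-proper d∈) (prime⇒irreducible pr d∣p)

-- The prime field as a commutative ring, with a ring solver.

module Field (p : ℕ) (pr : Prime p) where

  open Fp p pr
  open import Algebra using (CommutativeRing)
  open import Algebra.Structures using (IsCommutativeRing)
  open import Data.Nat using (zero; suc; _+_; ≢-nonZero; s≤s; z≤n)
  import Data.Nat.Properties as ℕ
  open import Data.Nat.DivMod using (_mod_; _%_; %-distribˡ-+; %-distribˡ-*; n%n≡0; m<n⇒m%n≡m; m%n<n)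
  open import Data.Nat.Coprimality using (coprime-Bézout; prime⇒coprime)
  open import Data.Nat.GCD using (module Bézout)
  open import Data.Nat.Primality using (prime⇒nonTrivial)
  open import Data.Nat.Base using (nonTrivial⇒n>1)
  open import Data.Fin using (toℕ)
  open import Data.Fin.Properties using (toℕ-injective; toℕ-fromℕ<; toℕ<n; toℕ≤n)
  open import Data.Maybe using (Maybe; just; nothing)
  import Algebra.Properties.AbelianGroup as AG
  import Algebra.Properties.Ring as RP
  open import Relation.Nullary using (yes; no)
  open import Relation.Binary.PropositionalEquality
  open import Algebra.Solver.Ring.AlmostCommutativeRing using (AlmostCommutativeRing; fromCommutativeRing; _-Raw-AlmostCommutative⟶_)
  open import Data.Integer using (ℤ; +_; -[1+_]; _⊖_)
  import Data.Integer as ℤ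
  import Data.Integer.Properties as ℤ
  open ≡-Reasoning

  ⟦_⟧ : ℕ → F
  ⟦ n ⟧ = n mod p

  toℕ-⟦⟧ : ∀ n → toℕ ⟦ n ⟧ ≡ n % p
  toℕ-⟦⟧ n = toℕ-fromℕ< (m%n<n n p)

  ⟦⟧-cong : ∀ m n → m % p ≡ n % p → ⟦ m ⟧ ≡ ⟦ n ⟧
  ⟦⟧-cong m n eq = toℕ-injective (trans (toℕ-⟦⟧ m) (trans eq (sym (toℕ-⟦⟧ n))))

  ⟦toℕ⟧ : ∀ a → ⟦ toℕ a ⟧ ≡ a
  ⟦toℕ⟧ a = toℕ-injective (trans (toℕ-⟦⟧ (toℕ a)) (m<n⇒m%n≡m (toℕ<n a)))

  ⟦⟧-+ : ∀ m n → ⟦ m ⟧ +F ⟦ n ⟧ ≡ ⟦ m + n ⟧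
  ⟦⟧-+ m n = ⟦⟧-cong (toℕ ⟦ m ⟧ + toℕ ⟦ n ⟧) (m + n)
    (trans (cong₂ (λ x y → (x + y) % p) (toℕ-⟦⟧ m) (toℕ-⟦⟧ n)) (sym (%-distribˡ-+ m n p)))

  ⟦⟧-* : ∀ m n → ⟦ m ⟧ *F ⟦ n ⟧ ≡ ⟦ m * n ⟧
  ⟦⟧-* m n = ⟦⟧-cong (toℕ ⟦ m ⟧ * toℕ ⟦ n ⟧) (m * n)
    (trans (cong₂ (λ x y → (x * y) % p) (toℕ-⟦⟧ m) (toℕ-⟦⟧ n)) (sym (%-distribˡ-* m n p)))

  ⟦p⟧ : ⟦ p ⟧ ≡ 0F
  ⟦p⟧ = ⟦⟧-cong p 0 (trans (n%n≡0 p) (sym (m<n⇒m%n≡m (ℕ.<-trans (s≤s z≤n) (nonTrivial⇒n>1 p {{prime⇒nonTrivial pr}})))))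

  +F-comm : ∀ a b → a +F b ≡ b +F a
  +F-comm a b = cong ⟦_⟧ (ℕ.+-comm (toℕ a) (toℕ b))

  *F-comm : ∀ a b → a *F b ≡ b *F a
  *F-comm a b = cong ⟦_⟧ (ℕ.*-comm (toℕ a) (toℕ b))

  +F-assoc : ∀ a b c → (a +F b) +F c ≡ a +F (b +F c)
  +F-assoc a b c = begin
    ⟦ toℕ a + toℕ b ⟧ +F c          ≡⟨ cong (⟦ toℕ a + toℕ b ⟧ +F_) (⟦toℕ⟧ c) ⟨
    ⟦ toℕ a + toℕ b ⟧ +F ⟦ toℕ c ⟧  ≡⟨ ⟦⟧-+ (toℕ a + toℕ b) (toℕ c) ⟩
    ⟦ toℕ a + toℕ b + toℕ c ⟧       ≡⟨ cong ⟦_⟧ (ℕ.+-assoc (toℕ a) (toℕ b) (toℕ c)) ⟩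
    ⟦ toℕ a + (toℕ b + toℕ c) ⟧     ≡⟨ ⟦⟧-+ (toℕ a) (toℕ b + toℕ c) ⟨
    ⟦ toℕ a ⟧ +F ⟦ toℕ b + toℕ c ⟧  ≡⟨ cong (_+F ⟦ toℕ b + toℕ c ⟧) (⟦toℕ⟧ a) ⟩
    a +F (b +F c)                   ∎

  *F-assoc : ∀ a b c → (a *F b) *F c ≡ a *F (b *F c)
  *F-assoc a b c = begin
    ⟦ toℕ a * toℕ b ⟧ *F c          ≡⟨ cong (⟦ toℕ a * toℕ b ⟧ *F_) (⟦toℕ⟧ c) ⟨
    ⟦ toℕ a * toℕ b ⟧ *F ⟦ toℕ c ⟧  ≡⟨ ⟦⟧-* (toℕ a * toℕ b) (toℕ c) ⟩
    ⟦ toℕ a * toℕ b * toℕ c ⟧       ≡⟨ cong ⟦_⟧ (ℕ.*-assoc (toℕ a) (toℕ b) (toℕ c)) ⟩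
    ⟦ toℕ a * (toℕ b * toℕ c) ⟧     ≡⟨ ⟦⟧-* (toℕ a) (toℕ b * toℕ c) ⟨
    ⟦ toℕ a ⟧ *F ⟦ toℕ b * toℕ c ⟧  ≡⟨ cong (_*F ⟦ toℕ b * toℕ c ⟧) (⟦toℕ⟧ a) ⟩
    a *F (b *F c)                   ∎

  +F-identityˡ : ∀ a → 0F +F a ≡ a
  +F-identityˡ a = begin
    ⟦ 0 ⟧ +F a          ≡⟨ cong (⟦ 0 ⟧ +F_) (⟦toℕ⟧ a) ⟨
    ⟦ 0 ⟧ +F ⟦ toℕ a ⟧  ≡⟨ ⟦⟧-+ 0 (toℕ a) ⟩
    ⟦ toℕ a ⟧           ≡⟨ ⟦toℕ⟧ a ⟩
    a                   ∎

  *F-identityˡ : ∀ a → 1F *F a ≡ a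
  *F-identityˡ a = begin
    ⟦ 1 ⟧ *F a          ≡⟨ cong (⟦ 1 ⟧ *F_) (⟦toℕ⟧ a) ⟨
    ⟦ 1 ⟧ *F ⟦ toℕ a ⟧  ≡⟨ ⟦⟧-* 1 (toℕ a) ⟩
    ⟦ 1 * toℕ a ⟧       ≡⟨ cong ⟦_⟧ (ℕ.*-identityˡ (toℕ a)) ⟩
    ⟦ toℕ a ⟧           ≡⟨ ⟦toℕ⟧ a ⟩
    a                   ∎

  -F-inverseʳ : ∀ a → a +F (-F a) ≡ 0F
  -F-inverseʳ a = begin
    a +F ⟦ p ∸ toℕ a ⟧          ≡⟨ cong (_+F ⟦ p ∸ toℕ a ⟧) (⟦toℕ⟧ a) ⟨
    ⟦ toℕ a ⟧ +F ⟦ p ∸ toℕ a ⟧  ≡⟨ ⟦⟧-+ (toℕ a) (p ∸ toℕ a) ⟩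
    ⟦ toℕ a + (p ∸ toℕ a) ⟧     ≡⟨ cong ⟦_⟧ (ℕ.m+[n∸m]≡n (toℕ≤n a)) ⟩
    ⟦ p ⟧                       ≡⟨ ⟦p⟧ ⟩
    0F                          ∎

  *F-distribˡ-+F : ∀ a b c → a *F (b +F c) ≡ a *F b +F a *F c
  *F-distribˡ-+F a b c = begin
    a *F ⟦ toℕ b + toℕ c ⟧                  ≡⟨ cong (_*F ⟦ toℕ b + toℕ c ⟧) (⟦toℕ⟧ a) ⟨
    ⟦ toℕ a ⟧ *F ⟦ toℕ b + toℕ c ⟧          ≡⟨ ⟦⟧-* (toℕ a) (toℕ b + toℕ c) ⟩
    ⟦ toℕ a * (toℕ b + toℕ c) ⟧             ≡⟨ cong ⟦_⟧ (ℕ.*-distribˡ-+ (toℕ a) (toℕ b) (toℕ c)) ⟩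
    ⟦ toℕ a * toℕ b + toℕ a * toℕ c ⟧       ≡⟨ ⟦⟧-+ (toℕ a * toℕ b) (toℕ a * toℕ c) ⟨
    a *F b +F a *F c                        ∎

  F-isCommutativeRing : IsCommutativeRing _≡_ _+F_ _*F_ (λ a → -F a) 0F 1F
  F-isCommutativeRing = record
    { isRing = record
      { +-isAbelianGroup = record
        { isGroup = record
          { isMonoid = record
            { isSemigroup = record
              { isMagma = record { isEquivalence = isEquivalence ; ∙-cong = cong₂ _+F_ }
              ; assoc = +F-assoc }
            ; identity = +F-identityˡ , λ a → trans (+F-comm a 0F) (+F-identityˡ a) }
          ; inverse = (λ a → trans (+F-comm (-F a) a) (-F-inverseʳ a)) , -F-inverseʳ
          ; ⁻¹-cong = cong (λ a → -F a) }
        ; comm = +F-comm }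
      ; *-cong = cong₂ _*F_
      ; *-assoc = *F-assoc
      ; *-identity = *F-identityˡ , λ a → trans (*F-comm a 1F) (*F-identityˡ a)
      ; distrib = *F-distribˡ-+F , λ a b c → trans (*F-comm (b +F c) a)
                    (trans (*F-distribˡ-+F a b c) (cong₂ _+F_ (*F-comm a b) (*F-comm a c))) }
    ; *-comm = *F-comm }

  F-ring : CommutativeRing _ _
  F-ring = record { isCommutativeRing = F-isCommutativeRing }


  open CommutativeRing F-ring using (+-abelianGroup; ring) public
    renaming (+-identityʳ to +F-identityʳ; zeroˡ to *F-zeroˡ; zeroʳ to *F-zeroʳ)

  private
    module G = AG +-abelianGroup
    module R = RP ring

  -- The solver takes its coefficients from ℤ, where they are compared by evaluation; residues
  -- modulo a variable p do not evaluate.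
  red : ℤ → F
  red (+ n)    = ⟦ n ⟧
  red -[1+ n ] = -F ⟦ suc n ⟧

  red-neg : ∀ z → red (ℤ.- z) ≡ -F (red z)
  red-neg (+ zero)  = sym G.ε⁻¹≈ε
  red-neg (+ suc n) = refl
  red-neg -[1+ n ]  = sym (G.⁻¹-involutive ⟦ suc n ⟧)

  private
    ⟦suc⟧-cancel : ∀ m n → ⟦ suc m ⟧ -F ⟦ suc n ⟧ ≡ ⟦ m ⟧ -F ⟦ n ⟧
    ⟦suc⟧-cancel m n = begin
      ⟦ suc m ⟧ -F ⟦ suc n ⟧                     ≡⟨ cong₂ _-F_ (sym (⟦⟧-+ 1 m)) (sym (⟦⟧-+ 1 n)) ⟩
      (1F +F ⟦ m ⟧) -F (1F +F ⟦ n ⟧)             ≡⟨ cong ((1F +F ⟦ m ⟧) +F_) (G.⁻¹-∙-comm 1F ⟦ n ⟧) ⟨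
      (1F +F ⟦ m ⟧) +F ((-F 1F) +F (-F ⟦ n ⟧))   ≡⟨ +F-assoc (1F +F ⟦ m ⟧) (-F 1F) (-F ⟦ n ⟧) ⟨
      ((1F +F ⟦ m ⟧) +F (-F 1F)) +F (-F ⟦ n ⟧)   ≡⟨ cong (_-F ⟦ n ⟧) (G.xyx⁻¹≈y 1F ⟦ m ⟧) ⟩
      ⟦ m ⟧ -F ⟦ n ⟧                             ∎

  red-⊖ : ∀ m n → red (m ⊖ n) ≡ ⟦ m ⟧ -F ⟦ n ⟧
  red-⊖ zero    zero    = sym (-F-inverseʳ 0F)
  red-⊖ zero    (suc n) = sym (+F-identityˡ (-F ⟦ suc n ⟧))
  red-⊖ (suc m) zero    = sym (trans (cong (⟦ suc m ⟧ +F_) G.ε⁻¹≈ε) (+F-identityʳ ⟦ suc m ⟧))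
  red-⊖ (suc m) (suc n) = trans (cong red (ℤ.[1+m]⊖[1+n]≡m⊖n m n)) (trans (red-⊖ m n) (sym (⟦suc⟧-cancel m n)))

  red-+ : ∀ x y → red (x ℤ.+ y) ≡ red x +F red y
  red-+ (+ m)    (+ n)    = sym (⟦⟧-+ m n)
  red-+ (+ m)    -[1+ n ] = red-⊖ m (suc n)
  red-+ -[1+ m ] (+ n)    = trans (red-⊖ n (suc m)) (+F-comm ⟦ n ⟧ (-F ⟦ suc m ⟧))
  red-+ -[1+ m ] -[1+ n ] = begin
    -F ⟦ suc (suc (m + n)) ⟧              ≡⟨ cong (λ x → -F ⟦ suc x ⟧) (ℕ.+-suc m n) ⟨
    -F ⟦ suc m + suc n ⟧                  ≡⟨ cong (λ x → -F x) (⟦⟧-+ (suc m) (suc n)) ⟨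
    -F (⟦ suc m ⟧ +F ⟦ suc n ⟧)           ≡⟨ G.⁻¹-∙-comm ⟦ suc m ⟧ ⟦ suc n ⟧ ⟨
    (-F ⟦ suc m ⟧) +F (-F ⟦ suc n ⟧)      ∎

  private
    red-+* : ∀ m y → red (+ m ℤ.* y) ≡ ⟦ m ⟧ *F red y
    red-+* m (+ n)    = trans (cong red (sym (ℤ.pos-* m n))) (sym (⟦⟧-* m n))
    red-+* m -[1+ n ] = begin
      red (+ m ℤ.* -[1+ n ])          ≡⟨ cong red (ℤ.neg-distribʳ-* (+ m) (+ suc n)) ⟨
      red (ℤ.- (+ m ℤ.* + suc n))     ≡⟨ red-neg (+ m ℤ.* + suc n) ⟩
      -F (red (+ m ℤ.* + suc n))      ≡⟨ cong (λ x → -F x) (red-+* m (+ suc n)) ⟩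
      -F (⟦ m ⟧ *F ⟦ suc n ⟧)         ≡⟨ R.-‿distribʳ-* ⟦ m ⟧ ⟦ suc n ⟧ ⟩
      ⟦ m ⟧ *F (-F ⟦ suc n ⟧)         ∎

  red-* : ∀ x y → red (x ℤ.* y) ≡ red x *F red y
  red-* (+ m)    y = red-+* m y
  red-* -[1+ m ] y = begin
    red (-[1+ m ] ℤ.* y)          ≡⟨ cong red (ℤ.neg-distribˡ-* (+ suc m) y) ⟨
    red (ℤ.- (+ suc m ℤ.* y))     ≡⟨ red-neg (+ suc m ℤ.* y) ⟩
    -F (red (+ suc m ℤ.* y))      ≡⟨ cong (λ x → -F x) (red-+* (suc m) y) ⟩
    -F (⟦ suc m ⟧ *F red y)       ≡⟨ R.-‿distribˡ-* ⟦ suc m ⟧ (red y) ⟩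
    (-F ⟦ suc m ⟧) *F red y       ∎

  F-acr : AlmostCommutativeRing _ _
  F-acr = fromCommutativeRing F-ring

  red-morphism : ℤ.+-*-rawRing -Raw-AlmostCommutative⟶ F-acr
  red-morphism = record
    { ⟦_⟧ = red ; +-homo = red-+ ; *-homo = red-* ; -‿homo = red-neg ; 0-homo = refl ; 1-homo = refl }

  red-≟ : ∀ x y → Maybe (red x ≡ red y)
  red-≟ x y with x ℤ.≟ y
  ... | yes eq = just (cong red eq)
  ... | no _   = nothing

  open import Algebra.Solver.Ring ℤ.+-*-rawRing F-acr red-morphism red-≟ public
    using (solve; _:=_; _:+_; _:*_; _:-_; :-_; con)

  1<p : 1 < p
  1<p = nonTrivial⇒n>1 p {{prime⇒nonTrivial pr}}

  ⟦⟧≢0 : ∀ m → 0 < m → m < p → ⟦ m ⟧ ≢ 0F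
  ⟦⟧≢0 m 0<m m<p eq = ℕ.<⇒≢ 0<m (sym (trans (sym (m<n⇒m%n≡m m<p)) (trans (sym (toℕ-⟦⟧ m))
    (trans (cong toℕ eq) (trans (toℕ-⟦⟧ 0) (m<n⇒m%n≡m (ℕ.<-trans (s≤s z≤n) 1<p)))))))

  1F≢0F : 1F ≢ 0F
  1F≢0F = ⟦⟧≢0 1 (s≤s z≤n) 1<p

  -F≢0F : ∀ {a} → a ≢ 0F → -F a ≢ 0F
  -F≢0F {a} a≢0 eq = a≢0 (trans (sym (G.⁻¹-involutive a)) (trans (cong (λ x → -F x) eq) G.ε⁻¹≈ε))

  x-y≡0⇒x≡y : ∀ {a b} → a -F b ≡ 0F → a ≡ b
  x-y≡0⇒x≡y {a} {b} = G.x∙y⁻¹≈ε⇒x≈y a b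

  ⟦*p⟧ : ∀ x → ⟦ x * p ⟧ ≡ 0F
  ⟦*p⟧ x = trans (sym (⟦⟧-* x p)) (trans (cong (⟦ x ⟧ *F_) ⟦p⟧) (*F-zeroʳ ⟦ x ⟧))

  -- Bézout for the coprime numbers p and a: either 1 + ya = xp, and the inverse is -y, or 1 + xp =
  -- ya, and it is y.
  *F-inverse : ∀ a → a ≢ 0F → ∃ λ b → b *F a ≡ 1F
  *F-inverse a a≢0 with coprime-Bézout (prime⇒coprime pr {{≢-nonZero a≢0′}} (toℕ<n a))
    where
    a≢0′ : toℕ a ≢ 0
    a≢0′ eq = a≢0 (trans (sym (⟦toℕ⟧ a)) (cong ⟦_⟧ eq))
  ... | Bézout.+- x y eq = -F ⟦ y ⟧ , (begin
    (-F ⟦ y ⟧) *F a                        ≡⟨ solve 2 (λ y a → (:- y) :* a := con (+ 1) :- (con (+ 1) :+ y :* a)) refl ⟦ y ⟧ a ⟩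
    1F -F (1F +F ⟦ y ⟧ *F a)               ≡⟨ cong (λ z → 1F -F (1F +F ⟦ y ⟧ *F z)) (⟦toℕ⟧ a) ⟨
    1F -F (1F +F ⟦ y ⟧ *F ⟦ toℕ a ⟧)       ≡⟨ cong (λ z → 1F -F (1F +F z)) (⟦⟧-* y (toℕ a)) ⟩
    1F -F (1F +F ⟦ y * toℕ a ⟧)            ≡⟨ cong (λ z → 1F -F z) (⟦⟧-+ 1 (y * toℕ a)) ⟩
    1F -F ⟦ 1 + y * toℕ a ⟧                ≡⟨ cong (λ z → 1F -F z) (trans (cong ⟦_⟧ eq) (⟦*p⟧ x)) ⟩
    1F -F 0F                               ≡⟨ solve 0 (con (+ 1) :- con (+ 0) := con (+ 1)) refl ⟩
    1F                                     ∎)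
  ... | Bézout.-+ x y eq = ⟦ y ⟧ , (begin
    ⟦ y ⟧ *F a               ≡⟨ cong (⟦ y ⟧ *F_) (⟦toℕ⟧ a) ⟨
    ⟦ y ⟧ *F ⟦ toℕ a ⟧       ≡⟨ ⟦⟧-* y (toℕ a) ⟩
    ⟦ y * toℕ a ⟧            ≡⟨ cong ⟦_⟧ eq ⟨
    ⟦ 1 + x * p ⟧            ≡⟨ ⟦⟧-+ 1 (x * p) ⟨
    1F +F ⟦ x * p ⟧          ≡⟨ cong (1F +F_) (⟦*p⟧ x) ⟩
    1F +F 0F                 ≡⟨ +F-identityʳ 1F ⟩
    1F                       ∎)

-- Multiplication by 1 - g^b as a difference operator.

module Differences (p : ℕ) (pr : Prime p) where

  open Fp p pr hiding (_-V_; e; cons)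
  open Field p pr
  open import Data.Nat using (zero; suc)
  open import Data.Fin using (toℕ)
  open import Data.Fin.Properties using (_≟_)
  open import Data.Vec using (Vec; []; _∷_; zipWith; replicate)
  import Data.Vec as Vec
  open import Data.List using (List; []; _∷_; _++_; map)
  open import Data.List.Relation.Binary.Permutation.Propositional using (_↭_; refl; prep; swap; trans)
  open import Data.List.Relation.Binary.Pointwise using (Pointwise; []; _∷_)
  open import Data.Sum using (_⊎_; inj₁; inj₂)
  open import Data.Integer using (+_)
  open import Relation.Nullary using (yes; no; contradiction)
  open import Relation.Binary.PropositionalEquality hiding (trans)
  import Relation.Binary.PropositionalEquality as ≡

  -- `Vec` in place of the function type `Vecp`: vectors with equal entries are then propositionally
  -- equal, and equality is decidable.
  V : ℕ → Set
  V = Vec F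

  infixl 6 _⊞_ _⊟_
  infixr 7 _•_

  _⊞_ _⊟_ : ∀ {n} → V n → V n → V n
  _⊞_ = zipWith _+F_
  _⊟_ = zipWith _-F_

  _•_ : ∀ {n} → F → V n → V n
  c • v = Vec.map (c *F_) v

  0V : ∀ {n} → V n
  0V = replicate _ 0F

  ⊟-comm : ∀ {n} (u a b : V n) → u ⊟ a ⊟ b ≡ u ⊟ b ⊟ a
  ⊟-comm []      []      []      = refl
  ⊟-comm (x ∷ u) (y ∷ a) (z ∷ b) =
    cong₂ _∷_ (solve 3 (λ x y z → x :- y :- z := x :- z :- y) refl x y z) (⊟-comm u a b)

  ⊟-⊞ : ∀ {n} (u a b : V n) → u ⊟ (a ⊞ b) ≡ u ⊟ a ⊟ b
  ⊟-⊞ []      []      []      = refl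
  ⊟-⊞ (x ∷ u) (y ∷ a) (z ∷ b) =
    cong₂ _∷_ (solve 3 (λ x y z → x :- (y :+ z) := x :- y :- z) refl x y z) (⊟-⊞ u a b)

  ⊟-identityʳ : ∀ {n} (u : V n) → u ⊟ 0V ≡ u
  ⊟-identityʳ []      = refl
  ⊟-identityʳ (x ∷ u) = cong₂ _∷_ (solve 1 (λ x → x :- con (+ 0) := x) refl x) (⊟-identityʳ u)

  ⊟≡0⇒≡ : ∀ {n} (u v : V n) → u ⊟ v ≡ 0V → u ≡ v
  ⊟≡0⇒≡ []      []      _  = refl
  ⊟≡0⇒≡ (x ∷ u) (y ∷ v) eq = cong₂ _∷_ (x-y≡0⇒x≡y (cong Vec.head eq)) (⊟≡0⇒≡ u v (cong Vec.tail eq))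

  ⊟-inverse : ∀ {n} (u : V n) → u ⊟ u ≡ 0V
  ⊟-inverse []      = refl
  ⊟-inverse (x ∷ u) = cong₂ _∷_ (-F-inverseʳ x) (⊟-inverse u)

  ⊞-⊟ : ∀ {n} (u a : V n) → (u ⊞ a) ⊟ a ≡ u
  ⊞-⊟ []      []      = refl
  ⊞-⊟ (x ∷ u) (y ∷ a) = cong₂ _∷_ (solve 2 (λ x y → (x :+ y) :- y := x) refl x y) (⊞-⊟ u a)

  ⊞-identityˡ : ∀ {n} (u : V n) → 0V ⊞ u ≡ u
  ⊞-identityˡ []      = refl
  ⊞-identityˡ (x ∷ u) = cong₂ _∷_ (+F-identityˡ x) (⊞-identityˡ u)

  ⊞-comm : ∀ {n} (u v : V n) → u ⊞ v ≡ v ⊞ u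
  ⊞-comm []      []      = refl
  ⊞-comm (x ∷ u) (y ∷ v) = cong₂ _∷_ (+F-comm x y) (⊞-comm u v)

  ⊞-assoc : ∀ {n} (u v w : V n) → (u ⊞ v) ⊞ w ≡ u ⊞ (v ⊞ w)
  ⊞-assoc []      []      []      = refl
  ⊞-assoc (x ∷ u) (y ∷ v) (z ∷ w) = cong₂ _∷_ (+F-assoc x y z) (⊞-assoc u v w)

  ⊞-swap : ∀ {n} (a b c : V n) → a ⊞ (b ⊞ c) ≡ b ⊞ (a ⊞ c)
  ⊞-swap a b c = ≡.trans (sym (⊞-assoc a b c)) (≡.trans (cong (_⊞ c) (⊞-comm a b)) (⊞-assoc b a c))

  ⊞-interchange : ∀ {n} (a b c d : V n) → (a ⊞ b) ⊞ (c ⊞ d) ≡ (a ⊞ c) ⊞ (b ⊞ d)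
  ⊞-interchange []      []      []      []      = refl
  ⊞-interchange (a ∷ u) (b ∷ v) (c ∷ w) (d ∷ z) = cong₂ _∷_
    (solve 4 (λ a b c d → (a :+ b) :+ (c :+ d) := (a :+ c) :+ (b :+ d)) refl a b c d) (⊞-interchange u v w z)

  •-zeroˡ : ∀ {n} (v : V n) → 0F • v ≡ 0V
  •-zeroˡ []      = refl
  •-zeroˡ (x ∷ v) = cong₂ _∷_ (*F-zeroˡ x) (•-zeroˡ v)

  •-identityˡ : ∀ {n} (v : V n) → 1F • v ≡ v
  •-identityˡ []      = refl
  •-identityˡ (x ∷ v) = cong₂ _∷_ (*F-identityˡ x) (•-identityˡ v)

  •-assoc : ∀ {n} a b (v : V n) → (a *F b) • v ≡ a • b • v
  •-assoc a b []      = refl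
  •-assoc a b (x ∷ v) = cong₂ _∷_ (*F-assoc a b x) (•-assoc a b v)

  •-distribʳ-+F : ∀ {n} a b (v : V n) → (a +F b) • v ≡ a • v ⊞ b • v
  •-distribʳ-+F a b []      = refl
  •-distribʳ-+F a b (x ∷ v) =
    cong₂ _∷_ (solve 3 (λ a b x → (a :+ b) :* x := a :* x :+ b :* x) refl a b x) (•-distribʳ-+F a b v)

  -- The element (1 - g^b)·f of the group algebra, f being given by its coefficients.
  Δ : ∀ {n} → V n → (V n → F) → V n → F
  Δ b f u = f u -F f (u ⊟ b)

  Δ* : ∀ {n} → List (V n) → (V n → F) → V n → F
  Δ* []       f = f
  Δ* (b ∷ bs) f = Δ* bs (Δ b f)

  Null : ∀ {n} → List (V n) → (V n → F) → Set
  Null bs f = ∀ u → Δ* bs f u ≡ 0F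

  Δ*-cong : ∀ {n} (bs : List (V n)) {f g} → f ≗ g → Δ* bs f ≗ Δ* bs g
  Δ*-cong []       f≗g = f≗g
  Δ*-cong (b ∷ bs) f≗g = Δ*-cong bs (λ u → cong₂ _-F_ (f≗g u) (f≗g (u ⊟ b)))

  Δ*-0 : ∀ {n} (bs : List (V n)) → Null bs (λ _ → 0F)
  Δ*-0 []       u = refl
  Δ*-0 (b ∷ bs) u = ≡.trans (Δ*-cong bs (λ _ → -F-inverseʳ 0F) u) (Δ*-0 bs u)

  Δ*-+ : ∀ {n} (bs : List (V n)) f g u → Δ* bs (λ v → f v +F g v) u ≡ Δ* bs f u +F Δ* bs g u
  Δ*-+ []       f g u = refl
  Δ*-+ (b ∷ bs) f g u = ≡.trans
    (Δ*-cong bs (λ v → solve 4 (λ x y z w → (x :+ y) :- (z :+ w) := (x :- z) :+ (y :- w)) refl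
                               (f v) (g v) (f (v ⊟ b)) (g (v ⊟ b))) u)
    (Δ*-+ bs (Δ b f) (Δ b g) u)

  Δ*-shift : ∀ {n} (bs : List (V n)) f a u → Δ* bs (λ v → f (v ⊟ a)) u ≡ Δ* bs f (u ⊟ a)
  Δ*-shift []       f a u = refl
  Δ*-shift (b ∷ bs) f a u = ≡.trans
    (Δ*-cong bs (λ v → cong (λ w → f (v ⊟ a) -F f w) (⊟-comm v b a)) u)
    (Δ*-shift bs (Δ b f) a u)

  Δ*-++ : ∀ {n} (bs cs : List (V n)) f → Δ* (bs ++ cs) f ≡ Δ* cs (Δ* bs f)
  Δ*-++ []       cs f = refl
  Δ*-++ (b ∷ bs) cs f = Δ*-++ bs cs (Δ b f)

  Δ-comm : ∀ {n} (b c : V n) f v → Δ b (Δ c f) v ≡ Δ c (Δ b f) v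
  Δ-comm b c f v = ≡.trans
    (solve 4 (λ x y z w → (x :- y) :- (z :- w) := (x :- z) :- (y :- w)) refl
      (f v) (f (v ⊟ c)) (f (v ⊟ b)) (f (v ⊟ b ⊟ c)))
    (cong (λ z → (f v -F f (v ⊟ b)) -F (f (v ⊟ c) -F f z)) (⊟-comm v b c))

  Δ*-Δ : ∀ {n} (bs : List (V n)) b f u → Δ* bs (Δ b f) u ≡ Δ b (Δ* bs f) u
  Δ*-Δ []       b f u = refl
  Δ*-Δ (c ∷ bs) b f u = ≡.trans (Δ*-cong bs (Δ-comm c b f) u) (Δ*-Δ bs b (Δ c f) u)

  Null-↭ : ∀ {n} {bs cs : List (V n)} → bs ↭ cs → ∀ {f} → Null bs f → Null cs f
  Null-↭ refl                   null = null
  Null-↭ (prep b ρ)             null = Null-↭ ρ null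
  Null-↭ (swap {xs = bs} b c ρ) {f} null = Null-↭ ρ (λ u → ≡.trans (Δ*-cong bs (Δ-comm b c f) u) (null u))
  Null-↭ (trans ρ σ)            null = Null-↭ σ (Null-↭ ρ null)

  -- 1 - g^(mb) is a multiple of 1 - g^b.
  Null-Δ-multiple : ∀ {n} (bs : List (V n)) f b m → Null bs (Δ b f) → Null bs (Δ (⟦ m ⟧ • b) f)
  Null-Δ-multiple bs f b zero null u = ≡.trans (Δ*-cong bs Δ0≗0 u) (Δ*-0 bs u)
    where
    Δ0≗0 : ∀ v → Δ (0F • b) f v ≡ 0F
    Δ0≗0 v = ≡.trans (cong (λ z → f v -F f z) (≡.trans (cong (v ⊟_) (•-zeroˡ b)) (⊟-identityʳ v)))
      (-F-inverseʳ (f v))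
  Null-Δ-multiple bs f b (suc m) null u = ≡.trans (Δ*-cong bs eq u)
    (≡.trans (Δ*-+ bs (Δ b f) (λ v → Δ (⟦ m ⟧ • b) f (v ⊟ b)) u)
      (≡.trans (cong₂ _+F_ (null u)
          (≡.trans (Δ*-shift bs (Δ (⟦ m ⟧ • b) f) b u) (Null-Δ-multiple bs f b m null (u ⊟ b))))
        (+F-identityˡ 0F)))
    where
    step : ∀ v → v ⊟ ⟦ suc m ⟧ • b ≡ v ⊟ b ⊟ ⟦ m ⟧ • b
    step v = ≡.trans (cong (v ⊟_) (≡.trans (cong (_• b) (sym (⟦⟧-+ 1 m)))
      (≡.trans (•-distribʳ-+F 1F ⟦ m ⟧ b) (cong (_⊞ ⟦ m ⟧ • b) (•-identityˡ b))))) (⊟-⊞ v b (⟦ m ⟧ • b))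
    eq : ∀ v → Δ (⟦ suc m ⟧ • b) f v ≡ Δ b f v +F Δ (⟦ m ⟧ • b) f (v ⊟ b)
    eq v = ≡.trans (cong (λ z → f v -F f z) (step v))
      (solve 3 (λ x y z → x :- z := (x :- y) :+ (y :- z)) refl (f v) (f (v ⊟ b)) (f (v ⊟ b ⊟ ⟦ m ⟧ • b)))

  IsMultiple : ∀ {n} → V n → V n → Set
  IsMultiple b b′ = ∃ λ c → b′ ≡ c • b

  -- One factor is replaced at a time. A residue c is the class of the natural number `toℕ c`, so
  -- natural multiples suffice.
  Null-multiples : ∀ {n} {bs cs : List (V n)} → Pointwise IsMultiple bs cs → ∀ f → Null bs f → Null cs f
  Null-multiples []                            f null = null
  Null-multiples {bs = b ∷ _} {cs = _ ∷ cs} ((c , refl) ∷ ms) f null =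
    subst (λ c → Null cs (Δ (c • b) f)) (⟦toℕ⟧ c)
      (Null-Δ-multiple cs f b (toℕ c) (Null-multiples ms (Δ b f) null))

  -- The exponents in the expanded product of the 1 - g^(dh), d in the list: every factor
  -- contributes 1 or g^(dh).
  data Sub : List F → F → Set where
    []   : Sub [] 0F
    skip : ∀ {d ds σ} → Sub ds σ → Sub (d ∷ ds) σ
    take : ∀ {d ds σ} → Sub ds σ → Sub (d ∷ ds) (d +F σ)

  -- Nonempty refers to the choice of terms, not to their sum, which may be 0.
  data Sub⁺ : List F → F → Set where
    skip : ∀ {d ds σ} → Sub⁺ ds σ → Sub⁺ (d ∷ ds) σ
    take : ∀ {d ds σ} → Sub ds σ → Sub⁺ (d ∷ ds) (d +F σ)

  Sub-∅ : ∀ ds → Sub ds 0F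
  Sub-∅ []       = []
  Sub-∅ (d ∷ ds) = skip (Sub-∅ ds)

  Sub⁺⇒Sub : ∀ {ds σ} → Sub⁺ ds σ → Sub ds σ
  Sub⁺⇒Sub (skip s) = skip (Sub⁺⇒Sub s)
  Sub⁺⇒Sub (take s) = take s

  multiples : ∀ {n} → V n → List F → List (V n)
  multiples h = map (_• h)

  ⊟-+• : ∀ {n} (u h : V n) a b → u ⊟ b • h ⊟ a • h ≡ u ⊟ (a +F b) • h
  ⊟-+• u h a b = ≡.trans (⊟-comm u (b • h) (a • h))
    (≡.trans (sym (⊟-⊞ u (a • h) (b • h))) (cong (u ⊟_) (sym (•-distribʳ-+F a b h))))

  Δ-support : ∀ {n} (b : V n) f u → Δ b f u ≢ 0F → f u ≢ 0F ⊎ f (u ⊟ b) ≢ 0F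
  Δ-support b f u ne with f u ≟ 0F | f (u ⊟ b) ≟ 0F
  ... | no  x≢0 | _       = inj₁ x≢0
  ... | yes _   | no y≢0  = inj₂ y≢0
  ... | yes x≡0 | yes y≡0 = contradiction (≡.trans (cong₂ _-F_ x≡0 y≡0) (-F-inverseʳ 0F)) ne

  -- Expanding the product writes its coefficient at u as a signed sum of values of f at the points
  -- u - σh, so one of these values is nonzero.
  Δ*-support : ∀ {n} (h : V n) ds f u → Δ* (multiples h ds) f u ≢ 0F →
               ∃ λ σ → Sub ds σ × f (u ⊟ σ • h) ≢ 0F
  Δ*-support h []       f u ne =
    0F , [] , λ eq → ne (≡.trans (cong f (sym (≡.trans (cong (u ⊟_) (•-zeroˡ h)) (⊟-identityʳ u)))) eq)
  Δ*-support h (d ∷ ds) f u ne with Δ*-support h ds (Δ (d • h) f) u ne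
  ... | σ , s , ne′ with Δ-support (d • h) f (u ⊟ σ • h) ne′
  ... | inj₁ x = σ , skip s , x
  ... | inj₂ y = d +F σ , take s , subst (λ z → f z ≢ 0F) (⊟-+• u h d σ) y

  -- In this expansion the empty choice contributes f u, which is nonzero; as the total is 0, some
  -- nonempty choice has to contribute too.
  Δ*-cancel : ∀ {n} (h : V n) ds f u → f u ≢ 0F → Δ* (multiples h ds) f u ≡ 0F →
              ∃ λ σ → Sub⁺ ds σ × f (u ⊟ σ • h) ≢ 0F
  Δ*-cancel h []       f u ne eq = contradiction eq ne
  Δ*-cancel h (d ∷ ds) f u ne eq with Δ (d • h) f u ≟ 0F
  -- The first factor that brings the value at u down to 0 equates this value with the one at u -
  -- dh.
  ... | yes eq′ = d +F 0F , take (Sub-∅ ds) ,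
    λ eq″ → ne (≡.trans (x-y≡0⇒x≡y eq′) (≡.trans (cong (λ z → f (u ⊟ z • h)) (sym (+F-identityʳ d))) eq″))
  ... | no ne′ with Δ*-cancel h ds (Δ (d • h) f) u ne′ eq
  ... | σ , s , ne″ with Δ-support (d • h) f (u ⊟ σ • h) ne″
  ... | inj₁ x = σ , skip s , x
  ... | inj₂ y = d +F σ , take (Sub⁺⇒Sub s) , subst (λ z → f z ≢ 0F) (⊟-+• u h d σ) y

-- Driving the coefficients of a linear relation to their targets.

module Targets (p : ℕ) (pr : Prime p) where

  open Fp p pr hiding (_-V_; e; cons)
  open Field p pr
  open Differences p pr
  open import Data.Nat using (zero; suc; _+_; s≤s; z≤n)
  import Data.Nat.Properties as ℕ
  open import Induction.WellFounded using (Acc; acc)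
  open import Data.Bool using (Bool; true; false; if_then_else_)
  open import Data.Fin.Properties using (_≟_; any?)
  open import Data.Vec using ([]; _∷_)
  import Data.Vec as Vec
  open import Data.List using (List; []; _∷_; _++_; map; length; replicate; concatMap)
  open import Data.List.Properties using (map-++; ++-assoc; concatMap-++; ++-identityʳ)
  open import Data.List.Relation.Unary.All using (All; []; _∷_)
  import Data.List.Relation.Unary.All.Properties as All
  open import Data.List.Membership.Propositional using (_∈_; _∉_)
  open import Data.List.Membership.DecPropositional (_≟_ {p}) using (_∈?_)
  open import Data.List.Relation.Binary.Permutation.Propositional using (_↭_; ↭-refl; ↭-sym; ↭-trans; ↭-reflexive; prep; swap; module PermutationReasoning)
  import Data.List.Relation.Binary.Permutation.Propositional as ↭
  open import Data.List.Relation.Binary.Permutation.Propositional.Properties using (++⁺; ++⁺ˡ; shift; map⁺; shifts)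
  open import Data.List.Relation.Binary.Pointwise using (Pointwise; []; _∷_)
  import Data.List.Relation.Binary.Pointwise as PW
  open import Data.Product using (Σ; ∃₂; proj₁; proj₂)
  open import Data.Sum using (_⊎_; inj₁; inj₂)
  open import Data.Integer using (+_)
  open import Function using (_∘_)
  open import Relation.Nullary using (Dec; yes; no; contradiction; ¬?)
  open import Relation.Nullary.Decidable using (map′; decidable-stable)
  open import Relation.Binary.PropositionalEquality

  private variable
    n : ℕ

  -- F^n is finite, so a search decides. This yields points of the support constructively from the
  -- mere failure of vanishing.
  ∃?-V : (P : V n → Set) → (∀ u → Dec (P u)) → Dec (∃ P)
  ∃?-V {zero}  P P? = map′ ([] ,_) (λ { ([] , q) → q }) (P? [])
  ∃?-V {suc n} P P? = map′ (λ { (a , u , q) → a ∷ u , q }) (λ { (a ∷ u , q) → a , u , q })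
    (any? (λ a → ∃?-V (λ u → P (a ∷ u)) (λ u → P? (a ∷ u))))

  ¬Null⇒∃ : ∀ (bs : List (V n)) f → ¬ Null bs f → ∃ λ u → Δ* bs f u ≢ 0F
  ¬Null⇒∃ bs f ¬null with ∃?-V (λ u → Δ* bs f u ≢ 0F) (λ u → ¬? (Δ* bs f u ≟ 0F))
  ... | yes ex = ex
  ... | no ∄   = contradiction (λ u → decidable-stable (Δ* bs f u ≟ 0F) (λ ne → ∄ (u , ne))) ¬null

  blocks : List (V n × List F) → List (V n)
  blocks = concatMap (λ (h , ds) → multiples h ds)

  -- The exponents in the expanded product over several blocks, with one subset sum for each vector.
  data Comb {n} : List (V n × List F) → V n → Set where
    []  : Comb [] 0V
    _∷_ : ∀ {h ds c σ v} → Sub ds σ → Comb c v → Comb ((h , ds) ∷ c) (σ • h ⊞ v)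

  data Comb⁺ {n} : List (V n × List F) → V n → Set where
    here  : ∀ {h ds c σ v} → Sub⁺ ds σ → Comb c v → Comb⁺ ((h , ds) ∷ c) (σ • h ⊞ v)
    there : ∀ {h ds c σ v} → Sub ds σ → Comb⁺ c v → Comb⁺ ((h , ds) ∷ c) (σ • h ⊞ v)

  Comb-∅ : (c : List (V n × List F)) → Comb c 0V
  Comb-∅ []             = []
  Comb-∅ ((h , ds) ∷ c) =
    subst (Comb ((h , ds) ∷ c)) (trans (⊞-identityʳ (0F • h)) (•-zeroˡ h)) (Sub-∅ ds ∷ Comb-∅ c)
    where
    ⊞-identityʳ : ∀ {n} (u : V n) → u ⊞ 0V ≡ u
    ⊞-identityʳ u = trans (⊞-comm u 0V) (⊞-identityˡ u)

  blocks-support : ∀ (c : List (V n × List F)) f u → Δ* (blocks c) f u ≢ 0F →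
                   ∃ λ v → Comb c v × f (u ⊟ v) ≢ 0F
  blocks-support []             f u ne = 0V , [] , subst (λ z → f z ≢ 0F) (sym (⊟-identityʳ u)) ne
  blocks-support ((h , ds) ∷ c) f u ne
    with v , s , ne′ ← blocks-support c (Δ* (multiples h ds) f) u
                         (subst (λ z → z u ≢ 0F) (Δ*-++ (multiples h ds) (blocks c) f) ne)
    with σ , t , ne″ ← Δ*-support h ds f (u ⊟ v) ne′ =
    σ • h ⊞ v , t ∷ s ,
    subst (λ z → f z ≢ 0F) (trans (⊟-comm u v (σ • h)) (sym (⊟-⊞ u (σ • h) v))) ne″

  -- Some block is the first to bring the value at u down to 0, and it makes a nonempty choice. The
  -- blocks before it only have to reach the support of f, and those after it choose nothing.
  blocks-cancel : ∀ (c : List (V n × List F)) f u → f u ≢ 0F → Δ* (blocks c) f u ≡ 0F →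
                  ∃ λ v → Comb⁺ c v × f (u ⊟ v) ≢ 0F
  blocks-cancel []             f u ne eq = contradiction eq ne
  blocks-cancel ((h , ds) ∷ c) f u ne eq with Δ* (multiples h ds) f u ≟ 0F
  ... | yes eq′ with σ , t , ne′ ← Δ*-cancel h ds f u ne eq′ =
    σ • h ⊞ 0V , here t (Comb-∅ c) ,
    subst (λ z → f z ≢ 0F) (sym (trans (⊟-⊞ u (σ • h) 0V) (⊟-identityʳ (u ⊟ σ • h)))) ne′
  ... | no ne′
    with v , s , ne″ ← blocks-cancel c (Δ* (multiples h ds) f) u ne′
                         (subst (λ z → z u ≡ 0F) (Δ*-++ (multiples h ds) (blocks c) f) eq)
    with σ , t , ne‴ ← Δ*-support h ds f (u ⊟ v) ne″ =
    σ • h ⊞ v , there t s ,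
    subst (λ z → f z ≢ 0F) (trans (⊟-comm u v (σ • h)) (sym (⊟-⊞ u (σ • h) v))) ne‴

  -- Separates the vectors whose coefficient stays, at unchanged measure, from those to which the
  -- attraction applies.
  Sub-split : ∀ {ds σ} → Sub ds σ → σ ≡ 0F ⊎ Sub⁺ ds σ
  Sub-split []       = inj₁ refl
  Sub-split (take s) = inj₂ (take s)
  Sub-split (skip s) with Sub-split s
  ... | inj₁ eq = inj₁ eq
  ... | inj₂ s′ = inj₂ (skip s′)

  Steps : ℕ → Set
  Steps k = Σ (List F) λ ds → length ds ≡ k × All (_≢ 0F) ds

  -- For k equal steps d the differences of subset sums are the i·d with |i| ≤ k: this is the S_k condition.
  Stable : ℕ → List F → Set
  Stable k C = ∀ a → a ∈ C → Σ (Steps k) λ (ds , _) →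
    ∀ σ σ′ → Sub ds σ → Sub ds σ′ → a +F (σ′ -F σ) ∈ C

  -- For k equal steps and constant φ this is the condition that N_k adds to S_k.
  Attracting : ℕ → List F → (F → ℕ) → Set
  Attracting k C φ = ∀ a → a ∉ C → Σ (Steps k) λ (ds , _) →
    ∀ σ → Sub⁺ ds σ → a +F σ ∈ C ⊎ φ (a +F σ) < φ a

  -- `big` marks the larger family. A coefficient w is tested through w - `off`, so `off` translates
  -- the target.
  record Entry (n : ℕ) : Set where
    constructor entry
    field
      vec : V n
      big : Bool
      off : F
  open Entry

  Placed : ℕ → Set
  Placed n = Entry n × F

  relation : List (Placed n) → V n
  relation []            = 0V
  relation ((x , w) ∷ l) = w • vec x ⊞ relation l

  powersOf : ℕ → List (V n) → List (V n)
  powersOf k = concatMap (replicate k)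

  powersOf-↭ : ∀ k {hs hs′ : List (V n)} → hs ↭ hs′ → powersOf k hs ↭ powersOf k hs′
  powersOf-↭ k ↭.refl        = ↭-refl
  powersOf-↭ k (prep h ρ)    = ++⁺ˡ (replicate k h) (powersOf-↭ k ρ)
  powersOf-↭ k (swap h h′ ρ) = ↭-trans (shifts (replicate k h) (replicate k h′))
    (++⁺ˡ (replicate k h′) (++⁺ˡ (replicate k h) (powersOf-↭ k ρ)))
  powersOf-↭ k (↭.trans ρ σ) = ↭-trans (powersOf-↭ k ρ) (powersOf-↭ k σ)

  powers : ℕ → List (Entry n) → List (V n)
  powers k xs = powersOf k (map vec xs)

  target : (A B : List F) → Entry n → List F
  target A B x = if big x then A else B

  OnTarget : (A B : List F) → Placed n → Set
  OnTarget A B (x , w) = w -F off x ∈ target A B x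

  -- Only the larger family can be off target: the smaller one starts on target, and stability keeps
  -- it there.
  OffTarget : (A : List F) → Placed n → Set
  OffTarget A (x , w) = big x ≡ true × w -F off x ∉ A

  module _ (k : ℕ) (A B : List F) (φ : F → ℕ)
           (A-stable : Stable k A) (B-stable : Stable k B) (A-attracting : Attracting k A φ) where

    private
      On Off : Placed n → Set
      On  = OnTarget A B
      Off = OffTarget A

      target-stable : (x : Entry n) → Stable k (target A B x)
      target-stable (entry _ true  _) = A-stable
      target-stable (entry _ false _) = B-stable

      on-steps : (q : Placed n) → On q → Steps k
      on-steps (x , w) t = proj₁ (target-stable x _ t)

      off-steps : (q : Placed n) → Off q → Steps k
      off-steps (x , w) (_ , t) = proj₁ (A-attracting _ t)

      choose : {P : Placed n → Set} → (∀ q → P q → Steps k) → ∀ {l} → All P l → List (V n × List F)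
      choose s []                    = []
      choose s (_∷_ {x = x , w} t ts) = (vec x , proj₁ (s (x , w) t)) ∷ choose s ts

      toSteps : ∀ (h : V n) (k : ℕ) ((ds , _) : Steps k) → Pointwise IsMultiple (replicate k h) (multiples h ds)
      toSteps h zero    ([] , _ , _)                = []
      toSteps h (suc k) (d ∷ ds , eq , (_ ∷ nz))    = (d , refl) ∷ toSteps h k (ds , ℕ.suc-injective eq , nz)

      -- Steps are invertible, so h is in turn a multiple of dh. `toSteps` transports the vanishing
      -- of the full product to the chosen multiples, and this direction the nonvanishing of a
      -- subproduct.
      fromSteps : ∀ (h : V n) (k : ℕ) ((ds , _) : Steps k) → Pointwise IsMultiple (multiples h ds) (replicate k h)
      fromSteps h zero    ([] , _ , _)              = []
      fromSteps h (suc k) (d ∷ ds , eq , (d≢0 ∷ nz)) with c , cd≡1 ← *F-inverse d d≢0 =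
        (c , trans (sym (•-identityˡ h)) (trans (cong (_• h) (sym cd≡1)) (•-assoc c d h)))
        ∷ fromSteps h k (ds , ℕ.suc-injective eq , nz)

      toChosen : {P : Placed n → Set} (s : ∀ q → P q → Steps k) → ∀ {l} (ts : All P l) →
                 Pointwise IsMultiple (powers k (map proj₁ l)) (blocks (choose s ts))
      toChosen s []       = []
      toChosen s (_∷_ {x = q} t ts) = PW.++⁺ (toSteps (vec (proj₁ q)) k (s q t)) (toChosen s ts)

      fromChosen : {P : Placed n → Set} (s : ∀ q → P q → Steps k) → ∀ {l} (ts : All P l) →
                   Pointwise IsMultiple (blocks (choose s ts)) (powers k (map proj₁ l))
      fromChosen s []       = []
      fromChosen s (_∷_ {x = q} t ts) = PW.++⁺ (fromSteps (vec (proj₁ q)) k (s q t)) (fromChosen s ts)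

      -- v and v′ are two exponents over the vectors on target. Moving every coefficient by the
      -- difference of its subset sums changes the relation by v′ - v, and stability keeps the
      -- coefficients on target.
      move-on : ∀ {l : List (Placed n)} (ts : All On l) {v v′} →
                Comb (choose on-steps ts) v → Comb (choose on-steps ts) v′ →
                ∃ λ l′ → All On l′ × map proj₁ l′ ≡ map proj₁ l × relation l′ ⊞ v ≡ relation l ⊞ v′
      move-on []       []       []         = [] , [] , refl , refl
      move-on {n} {l = (x , w) ∷ l} (t ∷ ts) {v = .(σ • vec x ⊞ v)} {v′ = .(σ′ • vec x ⊞ v′)}
              (_∷_ {σ = σ} {v = v} s c) (_∷_ {σ = σ′} {v = v′} s′ c′)
        with l′ , ts′ , eq , rel ← move-on ts c c′ =
        (x , w +F (σ′ -F σ)) ∷ l′ ,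
        subst (_∈ target A B x) (solve 3 (λ w o δ → (w :- o) :+ δ := (w :+ δ) :- o) refl w (off x) (σ′ -F σ))
          (proj₂ (target-stable x _ t) σ σ′ s s′) ∷ ts′ ,
        cong (x ∷_) eq ,
        (begin
          (w +F (σ′ -F σ)) • h ⊞ relation l′ ⊞ (σ • h ⊞ v)   ≡⟨ ⊞-interchange ((w +F (σ′ -F σ)) • h) (relation l′) (σ • h) v ⟩
          (w +F (σ′ -F σ)) • h ⊞ σ • h ⊞ (relation l′ ⊞ v)   ≡⟨ cong₂ _⊞_ scalars rel ⟩
          w • h ⊞ σ′ • h ⊞ (relation l ⊞ v′)                 ≡⟨ ⊞-interchange (w • h) (σ′ • h) (relation l) v′ ⟩
          w • h ⊞ relation l ⊞ (σ′ • h ⊞ v′)                 ∎)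
        where
        open ≡-Reasoning
        h : V n
        h = vec x
        scalars : (w +F (σ′ -F σ)) • h ⊞ σ • h ≡ w • h ⊞ σ′ • h
        scalars = trans (sym (•-distribʳ-+F (w +F (σ′ -F σ)) σ h)) (trans
          (cong (_• h) (solve 3 (λ w s t → (w :+ (t :- s)) :+ s := w :+ t) refl w σ σ′))
          (•-distribʳ-+F w σ′ h))

      -- The added 1 makes reaching the target count as progress even when φ is constant.
      measure : List (Placed n) → ℕ
      measure []            = 0
      measure ((x , w) ∷ l) = suc (φ (w -F off x)) + measure l

      -- The comparison of measures is a parameter: ≤ for arbitrary choices, < as soon as one of
      -- them is nonempty.
      Moved : (ℕ → ℕ → Set) → List (Placed n) → V n → Set
      Moved _~_ l v = ∃₂ λ l₁ l₂ → All On l₁ × All Off l₂ ×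
        map proj₁ l₁ ++ map proj₁ l₂ ↭ map proj₁ l ×
        relation l₁ ⊞ relation l₂ ≡ relation l ⊞ v × measure l₂ ~ measure l

      -- A step that promises only a smaller φ may still land in `A`; membership is therefore
      -- decided first, and such a landing counts as an arrival.
      move-one : ∀ {x : Entry n} {w} (t : Off (x , w)) {σ} → Sub⁺ (proj₁ (off-steps (x , w) t)) σ →
                 On (x , w +F σ) ⊎ (Off (x , w +F σ) × φ (w +F σ -F off x) < φ (w -F off x))
      move-one {x = entry h true o} {w} (refl , t) {σ} s = cases ((w +F σ -F o) ∈? A) (proj₂ (A-attracting _ t) σ s)
        where
        eq : (w +F σ) -F o ≡ (w -F o) +F σ
        eq = solve 3 (λ w o σ → (w :+ σ) :- o := (w :- o) :+ σ) refl w o σ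
        cases : Dec (w +F σ -F o ∈ A) → (w -F o +F σ) ∈ A ⊎ φ (w -F o +F σ) < φ (w -F o) →
                On (entry h true o , w +F σ) ⊎
                (Off (entry h true o , w +F σ) × φ (w +F σ -F o) < φ (w -F o))
        cases (yes on)  _         = inj₁ on
        cases (no off)  (inj₁ on) = contradiction (subst (_∈ A) (sym eq) on) off
        cases (no off)  (inj₂ lt) = inj₂ ((refl , off) , subst (λ z → φ z < φ (w -F o)) (sym eq) lt)

      merge : ∀ (w σ : F) (h r₁ r₂ r v : V n) → r₁ ⊞ r₂ ≡ r ⊞ v →
              (w +F σ) • h ⊞ (r₁ ⊞ r₂) ≡ (w • h ⊞ r) ⊞ (σ • h ⊞ v)
      merge w σ h r₁ r₂ r v eq = trans (cong₂ _⊞_ (•-distribʳ-+F w σ h) eq) (⊞-interchange (w • h) (σ • h) r v)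

      move-keep : ∀ {x : Entry n} {w l v σ} → Off (x , w) → σ ≡ 0F → ∀ {_~_ : ℕ → ℕ → Set} →
                  (∀ {a b c} → b ~ c → (suc a + b) ~ (suc a + c)) →
                  Moved _~_ l v → Moved _~_ ((x , w) ∷ l) (σ • vec x ⊞ v)
      move-keep {x = x} {w} {l} {v} {σ} t refl mono (l₁ , l₂ , on , off , ρ , rel , m) =
        l₁ , (x , w) ∷ l₂ , on , t ∷ off ,
        ↭-trans (shift x (map proj₁ l₁) (map proj₁ l₂)) (prep x ρ) ,
        trans (⊞-swap (relation l₁) (w • vec x) (relation l₂))
          (trans (cong (λ z → z • vec x ⊞ (relation l₁ ⊞ relation l₂)) (sym (+F-identityʳ w)))
            (merge w 0F (vec x) (relation l₁) (relation l₂) (relation l) v rel)) ,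
        mono m

      move-step : ∀ {x : Entry n} {w l v σ} (t : Off (x , w)) → Sub⁺ (proj₁ (off-steps (x , w) t)) σ →
                  Moved _≤_ l v → Moved _<_ ((x , w) ∷ l) (σ • vec x ⊞ v)
      move-step {x = x} {w} {l} {v} {σ} t s (l₁ , l₂ , on , off , ρ , rel , m) with move-one {x = x} {w} t s
      ... | inj₁ t′ =
        (x , w +F σ) ∷ l₁ , l₂ , t′ ∷ on , off , prep x ρ ,
        trans (⊞-assoc ((w +F σ) • vec x) (relation l₁) (relation l₂))
          (merge w σ (vec x) (relation l₁) (relation l₂) (relation l) v rel) ,
        s≤s (ℕ.≤-trans m (ℕ.m≤n+m _ _))
      ... | inj₂ (t′ , lt) =
        l₁ , (x , w +F σ) ∷ l₂ , on , t′ ∷ off ,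
        ↭-trans (shift x (map proj₁ l₁) (map proj₁ l₂)) (prep x ρ) ,
        trans (⊞-swap (relation l₁) ((w +F σ) • vec x) (relation l₂))
          (merge w σ (vec x) (relation l₁) (relation l₂) (relation l) v rel) ,
        ℕ.+-mono-<-≤ (s≤s lt) m

      Moved-≤ : ∀ {l : List (Placed n)} {v} → Moved _<_ l v → Moved _≤_ l v
      Moved-≤ (l₁ , l₂ , on , off , ρ , rel , m) = l₁ , l₂ , on , off , ρ , rel , ℕ.<⇒≤ m

      move-off : ∀ {l : List (Placed n)} (ts : All Off l) {v} → Comb (choose off-steps ts) v → Moved _≤_ l v
      move-off []       []      = [] , [] , [] , [] , ↭-refl , refl , z≤n
      move-off (t ∷ ts) (s ∷ c) with Sub-split s
      ... | inj₁ eq = move-keep t eq {_≤_} (λ {a} → ℕ.+-monoʳ-≤ (suc a)) (move-off ts c)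
      ... | inj₂ s⁺ = Moved-≤ (move-step t s⁺ (move-off ts c))

      move-off⁺ : ∀ {l : List (Placed n)} (ts : All Off l) {v} → Comb⁺ (choose off-steps ts) v → Moved _<_ l v
      move-off⁺ (t ∷ ts) (here s c)  = move-step t s (move-off ts c)
      move-off⁺ (t ∷ ts) (there s c) with Sub-split s
      ... | inj₁ eq = move-keep t eq {_<_} (λ {a} → ℕ.+-monoʳ-< (suc a)) (move-off⁺ ts c)
      ... | inj₂ s⁺ = move-step t s⁺ (Moved-≤ (move-off⁺ ts c))

      -- The part of the relation on target loses the v that the part off target gains.
      rebalance : ∀ (r r′ t a v : V n) → r′ ⊞ a ≡ r ⊞ (a ⊟ v) → r′ ⊞ (t ⊞ v) ≡ r ⊞ t
      rebalance []       []        []      []      []      _  = refl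
      rebalance (r ∷ rs) (r′ ∷ rs′) (t ∷ ts) (a ∷ as) (v ∷ vs) eq = cong₂ _∷_
        (trans (solve 4 (λ r t a v → r :+ (t :+ v) := (r :+ a) :+ (t :+ v :- a)) refl r′ t a v)
          (trans (cong (λ z → z +F (t +F v -F a)) (cong Vec.head eq))
            (solve 4 (λ r t a v → (r :+ (a :- v)) :+ (t :+ v :- a) := r :+ t) refl r t a v)))
        (rebalance rs rs′ ts as vs (cong Vec.tail eq))

    module _ (δ : V n → F) (δ-support : ∀ u → δ u ≢ 0F → u ≡ 0V)
             (xs : List (Entry n)) (null : Null (powers k xs) δ)
             (nonnull : ∀ ys z zs → ys ++ z ∷ zs ↭ xs → ¬ Null (powers k ys) δ) where

      -- Induction on the measure of the vectors off target. While one is left, those on target form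
      -- a proper subfamily, and `nonnull` gives a point in the support of their product.
      reach-targets : ∀ l₁ l₂ → All On l₁ → All Off l₂ → map proj₁ l₁ ++ map proj₁ l₂ ↭ xs →
                      relation l₁ ⊞ relation l₂ ≡ 0V → Acc _<_ (measure l₂) →
                      ∃ λ l → All On l × map proj₁ l ↭ xs × relation l ≡ 0V
      reach-targets l₁ [] on [] ρ rel _ =
        l₁ , on , ↭-trans (↭-reflexive (sym (++-identityʳ _))) ρ ,
        trans (sym (trans (⊞-comm (relation l₁) 0V) (⊞-identityˡ (relation l₁)))) rel
      reach-targets l₁ l₂@((z , _) ∷ l₂′) on off ρ rel (acc rs) = conclude
        where
        c₁ c₂ : List (V n × List F)
        c₁ = choose on-steps on
        c₂ = choose off-steps off

        null′ : Null (blocks c₁ ++ blocks c₂) δ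
        null′ = Null-multiples (PW.++⁺ (toChosen on-steps on) (toChosen off-steps off)) δ
          (Null-↭ (↭-trans (powersOf-↭ k (map⁺ vec (↭-sym ρ))) (↭-reflexive (trans
            (cong (powersOf k) (map-++ vec (map proj₁ l₁) (map proj₁ l₂)))
            (concatMap-++ (replicate k) (map vec (map proj₁ l₁)) (map vec (map proj₁ l₂)))))) null)

        conclude : ∃ λ l → All On l × map proj₁ l ↭ xs × relation l ≡ 0V
        conclude =
          let u , ne = ¬Null⇒∃ (blocks c₁) δ
                (nonnull (map proj₁ l₁) z (map proj₁ l₂′) ρ ∘ Null-multiples (fromChosen on-steps on) δ)
              v , comb , ne′ = blocks-cancel c₂ (Δ* (blocks c₁) δ) u ne
                (trans (cong (λ f → f u) (sym (Δ*-++ (blocks c₁) (blocks c₂) δ))) (null′ u))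
              -- Since `δ` is supported at 0, both u and u - v are exponents in the expansion over
              -- the vectors on target.
              a , comb₁ , ne₁ = blocks-support c₁ δ u ne
              a′ , comb₂ , ne₂ = blocks-support c₁ δ (u ⊟ v) ne′
              l₁′ , on₁ , eq₁ , rel₁ = move-on on
                (subst (Comb c₁) (sym (⊟≡0⇒≡ u a (δ-support _ ne₁))) comb₁)
                (subst (Comb c₁) (sym (⊟≡0⇒≡ (u ⊟ v) a′ (δ-support _ ne₂))) comb₂)
              l₃ , l₄ , on₃ , off₄ , ρ′ , rel′ , lt = move-off⁺ off comb
          in reach-targets (l₁′ ++ l₃) l₄ (All.++⁺ on₁ on₃) off₄ (permuted l₁′ l₃ l₄ eq₁ ρ′)
               (trans (cong (_⊞ relation l₄) (relation-++ l₁′ l₃))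
                 (trans (⊞-assoc (relation l₁′) (relation l₃) (relation l₄))
                   (trans (cong (relation l₁′ ⊞_) rel′)
                     (trans (rebalance (relation l₁) (relation l₁′) (relation l₂) u v rel₁) rel))))
               (rs lt)
          where
          open PermutationReasoning
          permuted : ∀ l₁′ l₃ l₄ → map proj₁ l₁′ ≡ map proj₁ l₁ → map proj₁ l₃ ++ map proj₁ l₄ ↭ map proj₁ l₂ →
                     map proj₁ (l₁′ ++ l₃) ++ map proj₁ l₄ ↭ xs
          permuted l₁′ l₃ l₄ eq₁ ρ′ = begin
            map proj₁ (l₁′ ++ l₃) ++ map proj₁ l₄               ≡⟨ cong (_++ map proj₁ l₄) (map-++ proj₁ l₁′ l₃) ⟩
            (map proj₁ l₁′ ++ map proj₁ l₃) ++ map proj₁ l₄     ≡⟨ ++-assoc (map proj₁ l₁′) _ _ ⟩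
            map proj₁ l₁′ ++ (map proj₁ l₃ ++ map proj₁ l₄)     ≡⟨ cong (_++ (map proj₁ l₃ ++ map proj₁ l₄)) eq₁ ⟩
            map proj₁ l₁ ++ (map proj₁ l₃ ++ map proj₁ l₄)      ↭⟨ ++⁺ˡ (map proj₁ l₁) ρ′ ⟩
            map proj₁ l₁ ++ map proj₁ l₂                        ↭⟨ ρ ⟩
            xs                                                  ∎
          relation-++ : ∀ (l m : List (Placed n)) → relation (l ++ m) ≡ relation l ⊞ relation m
          relation-++ []            m = sym (⊞-identityˡ (relation m))
          relation-++ ((x , w) ∷ l) m = trans (cong (w • vec x ⊞_) (relation-++ l m))
            (sym (⊞-assoc (w • vec x) (relation l) (relation m)))

-- Counting relations: nonvanishing for two independent families.

module Products (p : ℕ) (pr : Prime p) where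

  open Fp p pr hiding (_-V_; e; cons)
  open Field p pr
  open Differences p pr
  open Targets p pr
  open import Data.Nat using (zero; suc; _+_; s≤s; z≤n; >-nonZero)
  import Data.Nat.Properties as ℕ
  open import Data.Nat.Induction using (<-wellFounded)
  open import Induction.WellFounded using (Acc; acc)
  open import Data.Bool using (Bool; true; false)
  open import Data.Fin using (combine; remQuot)
  import Data.Fin as Fin
  open import Data.Fin.Properties using (_≟_; combine-remQuot; combine-injective; injective⇒≤)
  open import Data.Vec using (Vec; []; _∷_)
  import Data.Vec as Vec
  open import Data.List using (List; []; _∷_; _++_; map; length; lookup)
  open import Data.List.Properties using (map-++; length-++; length-map; ∷-injective)
  open import Data.List.Relation.Unary.All using (All; []; _∷_)
  import Data.List.Relation.Unary.All.Properties as All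
  open import Data.List.Relation.Unary.Any using (index)
  open import Data.List.Relation.Unary.Any.Properties using (lookup-index)
  open import Data.List.Membership.Propositional using (_∈_)
  open import Data.List.Membership.DecPropositional (_≟_ {p}) using (_∈?_)
  open import Data.List.Relation.Binary.Permutation.Propositional using (_↭_; ↭-refl; ↭-sym; ↭-trans; ↭-reflexive; prep; swap)
  import Data.List.Relation.Binary.Permutation.Propositional as ↭
  open import Data.List.Relation.Binary.Permutation.Propositional.Properties using (shift; ++-comm; ↭-map-inv; All-resp-↭; ↭-length; map⁺)
  open import Data.Product using (Σ; ∃₂; proj₁; proj₂)
  open import Data.Sum using (_⊎_; inj₁; inj₂)
  open import Data.Integer using (+_)
  open import Function using (_∘_)
  open import Relation.Nullary using (yes; no)
  open import Relation.Binary.PropositionalEquality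

  private variable
    n : ℕ

  lin : List (V n × F) → V n
  lin []            = 0V
  lin ((h , w) ∷ l) = w • h ⊞ lin l

  -- Phrased with lists of weighted vectors, so that a permutation of the vectors lifts to the
  -- weights.
  Indep : List (V n) → Set
  Indep hs = ∀ l → map proj₁ l ≡ hs → lin l ≡ 0V → All (λ q → proj₂ q ≡ 0F) l

  lin-↭ : {l m : List (V n × F)} → l ↭ m → lin l ≡ lin m
  lin-↭ ↭.refl                         = refl
  lin-↭ (prep (h , w) ρ)               = cong (w • h ⊞_) (lin-↭ ρ)
  lin-↭ (swap {ys = m} (h , w) (h′ , w′) ρ) =
    trans (cong (λ z → w • h ⊞ (w′ • h′ ⊞ z)) (lin-↭ ρ)) (⊞-swap (w • h) (w′ • h′) (lin m))
  lin-↭ (↭.trans ρ σ)                  = trans (lin-↭ ρ) (lin-↭ σ)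

  Indep-↭ : {hs hs′ : List (V n)} → hs ↭ hs′ → Indep hs → Indep hs′
  Indep-↭ ρ ind l refl eq with l′ , eq′ , ρ′ ← ↭-map-inv proj₁ (↭-sym ρ) =
    All-resp-↭ (↭-sym ρ′) (ind l′ (sym eq′) (trans (sym (lin-↭ ρ′)) eq))

  Indep-++ˡ : ∀ (hs hs′ : List (V n)) → Indep (hs ++ hs′) → Indep hs
  Indep-++ˡ hs hs′ ind l refl eq = All.++⁻ˡ l (ind (l ++ map (_, 0F) hs′)
    (trans (map-++ proj₁ l _) (cong (map proj₁ l ++_) (proj₁-zeros hs′)))
    (trans (lin-++ l hs′) eq))
    where
    proj₁-zeros : ∀ {n} (hs : List (V n)) → map proj₁ (map (_, 0F) hs) ≡ hs
    proj₁-zeros []       = refl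
    proj₁-zeros (h ∷ hs) = cong (h ∷_) (proj₁-zeros hs)
    lin-zeros : ∀ {n} (hs : List (V n)) → lin (map (_, 0F) hs) ≡ 0V
    lin-zeros []       = refl
    lin-zeros (h ∷ hs) = trans (cong₂ _⊞_ (•-zeroˡ h) (lin-zeros hs)) (⊞-identityˡ 0V)
    lin-++ : ∀ {n} (l : List (V n × F)) hs → lin (l ++ map (_, 0F) hs) ≡ lin l
    lin-++ []            hs = lin-zeros hs
    lin-++ ((h , w) ∷ l) hs = cong (w • h ⊞_) (lin-++ l hs)

  ^-distribʳ-* : ∀ r a b → (a * b) ^ r ≡ a ^ r * b ^ r
  ^-distribʳ-* zero    a b = refl
  ^-distribʳ-* (suc r) a b = trans (cong (a * b *_) (^-distribʳ-* r a b)) (ℕ.[m*n]*[o*p]≡[m*o]*[n*p] a b (a ^ r) (b ^ r))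

  encode : ∀ {m r} → Vec (Fin m) r → Fin (m ^ r)
  encode []      = Fin.zero
  encode (x ∷ v) = combine x (encode v)

  encode-injective : ∀ {m r} (u v : Vec (Fin m) r) → encode u ≡ encode v → u ≡ v
  encode-injective []      []      _  = refl
  encode-injective (x ∷ u) (y ∷ v) eq with refl , eq′ ← combine-injective x (encode u) y (encode v) eq =
    cong (x ∷_) (encode-injective u v eq′)

  decode : ∀ {m} r → Fin (m ^ r) → Vec (Fin m) r
  decode         zero    i = []
  decode {m = m} (suc r) i = proj₁ (remQuot {m} (m ^ r) i) ∷ decode r (proj₂ (remQuot {m} (m ^ r) i))

  encode-decode : ∀ {m} r (i : Fin (m ^ r)) → encode (decode {m} r i) ≡ i
  encode-decode         zero    Fin.zero = refl
  encode-decode {m = m} (suc r) i =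
    trans (cong (combine (proj₁ (remQuot {m} (m ^ r) i))) (encode-decode r (proj₂ (remQuot {m} (m ^ r) i))))
      (combine-remQuot {m} (m ^ r) i)

  Vec-injection⇒≤ : ∀ {m a b r s} (f : Vec (Fin m) r → Vec (Fin a) r × Vec (Fin b) s) →
                    Injective _≡_ _≡_ f → m ^ r ≤ a ^ r * b ^ s
  Vec-injection⇒≤ {m} {a} {b} {r} {s} f f-inj = injective⇒≤ {f = g} g-inj
    where
    g : Fin (m ^ r) → Fin (a ^ r * b ^ s)
    g i = combine (encode (proj₁ (f (decode r i)))) (encode (proj₂ (f (decode r i))))
    g-inj : Injective _≡_ _≡_ g
    g-inj {i} {j} eq with eq₁ , eq₂ ← combine-injective (encode (proj₁ (f (decode r i)))) _ (encode (proj₁ (f (decode r j)))) _ eq =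
      trans (sym (encode-decode r i)) (trans (cong encode (f-inj
        (cong₂ _,_ (encode-injective _ _ eq₁) (encode-injective _ _ eq₂)))) (encode-decode r j))

  pairs : (hs : List (V n)) → Vec F (length hs) → List (V n × F)
  pairs []       []       = []
  pairs (h ∷ hs) (w ∷ ws) = (h , w) ∷ pairs hs ws

  lin-difference : (hs : List (V n)) (us ws : Vec F (length hs)) →
                   lin (pairs hs us) ⊟ lin (pairs hs ws) ≡ lin (pairs hs (us ⊟ ws))
  lin-difference []       []       []       = ⊟-inverse 0V
  lin-difference (h ∷ hs) (u ∷ us) (w ∷ ws) = trans
    (distribute u w h (lin (pairs hs us)) (lin (pairs hs ws)))
    (cong ((u -F w) • h ⊞_) (lin-difference hs us ws))
    where
    distribute : ∀ {n} u w (h x y : V n) → (u • h ⊞ x) ⊟ (w • h ⊞ y) ≡ (u -F w) • h ⊞ (x ⊟ y)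
    distribute u w []      []      []      = refl
    distribute u w (h ∷ v) (x ∷ a) (y ∷ b) = cong₂ _∷_
      (solve 5 (λ u w h x y → (u :* h :+ x) :- (w :* h :+ y) := (u :- w) :* h :+ (x :- y)) refl u w h x y)
      (distribute u w v a b)

  Indep⇒injective : (hs : List (V n)) → Indep hs → (us ws : Vec F (length hs)) →
                    lin (pairs hs us) ≡ lin (pairs hs ws) → us ≡ ws
  Indep⇒injective hs ind us ws eq = ⊟≡0⇒≡ us ws (zeros hs (us ⊟ ws) (ind (pairs hs (us ⊟ ws))
    (proj₁-pairs hs (us ⊟ ws)) (trans (sym (lin-difference hs us ws))
      (trans (cong (_⊟ lin (pairs hs ws)) eq) (⊟-inverse (lin (pairs hs ws)))))))
    where
    proj₁-pairs : ∀ {n} (hs : List (V n)) ws → map proj₁ (pairs hs ws) ≡ hs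
    proj₁-pairs []       []       = refl
    proj₁-pairs (h ∷ hs) (w ∷ ws) = cong (h ∷_) (proj₁-pairs hs ws)
    zeros : ∀ {n} (hs : List (V n)) ws → All (λ q → proj₂ q ≡ 0F) (pairs hs ws) → ws ≡ 0V
    zeros []       []       []         = refl
    zeros (h ∷ hs) (w ∷ ws) (eq ∷ eqs) = cong₂ _∷_ eq (zeros hs ws eqs)

  bigs smalls : List (Entry n) → List (V n)
  bigs []                     = []
  bigs (entry h true  _ ∷ xs) = h ∷ bigs xs
  bigs (entry h false _ ∷ xs) = bigs xs
  smalls []                     = []
  smalls (entry h true  _ ∷ xs) = smalls xs
  smalls (entry h false _ ∷ xs) = h ∷ smalls xs

  bigs-++ : ∀ (xs ys : List (Entry n)) → bigs (xs ++ ys) ≡ bigs xs ++ bigs ys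
  bigs-++ []                     ys = refl
  bigs-++ (entry h true  _ ∷ xs) ys = cong (h ∷_) (bigs-++ xs ys)
  bigs-++ (entry h false _ ∷ xs) ys = bigs-++ xs ys

  smalls-++ : ∀ (xs ys : List (Entry n)) → smalls (xs ++ ys) ≡ smalls xs ++ smalls ys
  smalls-++ []                     ys = refl
  smalls-++ (entry h true  _ ∷ xs) ys = smalls-++ xs ys
  smalls-++ (entry h false _ ∷ xs) ys = cong (h ∷_) (smalls-++ xs ys)

  bigs-↭ : {xs ys : List (Entry n)} → xs ↭ ys → bigs xs ↭ bigs ys
  bigs-↭ ↭.refl                                      = ↭-refl
  bigs-↭ (prep (entry h true  _) ρ)                  = prep h (bigs-↭ ρ)
  bigs-↭ (prep (entry h false _) ρ)                  = bigs-↭ ρ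
  bigs-↭ (swap (entry g true  _) (entry h true  _) ρ) = swap g h (bigs-↭ ρ)
  bigs-↭ (swap (entry g true  _) (entry h false _) ρ) = prep g (bigs-↭ ρ)
  bigs-↭ (swap (entry g false _) (entry h true  _) ρ) = prep h (bigs-↭ ρ)
  bigs-↭ (swap (entry g false _) (entry h false _) ρ) = bigs-↭ ρ
  bigs-↭ (↭.trans ρ σ)                               = ↭-trans (bigs-↭ ρ) (bigs-↭ σ)

  smalls-↭ : {xs ys : List (Entry n)} → xs ↭ ys → smalls xs ↭ smalls ys
  smalls-↭ ↭.refl                                      = ↭-refl
  smalls-↭ (prep (entry h true  _) ρ)                  = smalls-↭ ρ
  smalls-↭ (prep (entry h false _) ρ)                  = prep h (smalls-↭ ρ)
  smalls-↭ (swap (entry g true  _) (entry h true  _) ρ) = smalls-↭ ρ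
  smalls-↭ (swap (entry g true  _) (entry h false _) ρ) = prep h (smalls-↭ ρ)
  smalls-↭ (swap (entry g false _) (entry h true  _) ρ) = prep g (smalls-↭ ρ)
  smalls-↭ (swap (entry g false _) (entry h false _) ρ) = swap g h (smalls-↭ ρ)
  smalls-↭ (↭.trans ρ σ)                               = ↭-trans (smalls-↭ ρ) (smalls-↭ σ)

  vecs-↭ : (xs : List (Entry n)) → map Entry.vec xs ↭ bigs xs ++ smalls xs
  vecs-↭ []                     = ↭-refl
  vecs-↭ (entry h true  _ ∷ xs) = prep h (vecs-↭ xs)
  vecs-↭ (entry h false _ ∷ xs) = ↭-trans (prep h (vecs-↭ xs)) (↭-sym (shift h (bigs xs) (smalls xs)))

  length-bigs-smalls : (xs : List (Entry n)) → length (bigs xs) + length (smalls xs) ≡ length xs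
  length-bigs-smalls xs = trans (sym (length-++ (bigs xs)))
    (trans (sym (↭-length (vecs-↭ xs))) (length-map Entry.vec xs))

  module _ (k : ℕ) (A B : List F) (φ : F → ℕ)
           (A-stable : Stable k A) (B-stable : Stable k B) (A-attracting : Attracting k A φ)
           (AB<p : length A * length B < p) (b₀ : F) (b₀∈B : b₀ ∈ B)
           {n : ℕ} (δ : V n → F) (δ-support : ∀ u → δ u ≢ 0F → u ≡ 0V) (δ0≢0 : δ 0V ≢ 0F) where

    private
      On Off : Placed n → Set
      On  = OnTarget A B
      Off = OffTarget A

      bigEntries : (hs : List (V n)) → Vec F (length hs) → List (Entry n)
      bigEntries []       []       = []
      bigEntries (h ∷ hs) (τ ∷ τs) = entry h true τ ∷ bigEntries hs τs

      -- The translate of `B` by -b₀ contains 0, so these vectors are on target with coefficient 0.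
      smallEntries : List (V n) → List (Entry n)
      smallEntries = map (λ h → entry h false (-F b₀))

      entries : (hs hs′ : List (V n)) → Vec F (length hs) → List (Entry n)
      entries hs hs′ τs = bigEntries hs τs ++ smallEntries hs′

      bigs-entries : ∀ hs hs′ τs → bigs (entries hs hs′ τs) ≡ hs
      bigs-entries []       []         []       = refl
      bigs-entries []       (h ∷ hs′)  []       = bigs-entries [] hs′ []
      bigs-entries (h ∷ hs) hs′        (τ ∷ τs) = cong (h ∷_) (bigs-entries hs hs′ τs)

      smalls-entries : ∀ hs hs′ τs → smalls (entries hs hs′ τs) ≡ hs′
      smalls-entries []       []         []       = refl
      smalls-entries []       (h ∷ hs′)  []       = cong (h ∷_) (smalls-entries [] hs′ [])
      smalls-entries (h ∷ hs) hs′        (τ ∷ τs) = smalls-entries hs hs′ τs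

      Startable : Entry n → Set
      Startable x = Entry.big x ≡ true ⊎ On (x , 0F)

      entries-startable : ∀ hs hs′ τs → All Startable (entries hs hs′ τs)
      entries-startable []       []        []       = []
      entries-startable []       (h ∷ hs′) []       =
        inj₂ (subst (_∈ B) (solve 1 (λ b → b := con (+ 0) :- (:- b)) refl b₀) b₀∈B) ∷ entries-startable [] hs′ []
      entries-startable (h ∷ hs) hs′       (τ ∷ τs) = inj₁ refl ∷ entries-startable hs hs′ τs

      Start : List (Entry n) → Set
      Start xs = ∃₂ λ l₁ l₂ → All On l₁ × All Off l₂ × map proj₁ l₁ ++ map proj₁ l₂ ↭ xs ×
                 relation l₁ ⊞ relation l₂ ≡ 0V

      add0 : ∀ (h v : V n) → v ≡ 0V → 0F • h ⊞ v ≡ 0V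
      add0 h v refl = trans (cong (_⊞ 0V) (•-zeroˡ h)) (⊞-identityˡ 0V)

      start-on : ∀ {xs x} → On (x , 0F) → Start xs → Start (x ∷ xs)
      start-on {x = x} t (l₁ , l₂ , on , off , ρ , rel) = (x , 0F) ∷ l₁ , l₂ , t ∷ on , off , prep x ρ ,
        trans (⊞-assoc (0F • Entry.vec x) (relation l₁) (relation l₂)) (add0 (Entry.vec x) _ rel)

      start-off : ∀ {xs x} → Off (x , 0F) → Start xs → Start (x ∷ xs)
      start-off {x = x} t (l₁ , l₂ , on , off , ρ , rel) = l₁ , (x , 0F) ∷ l₂ , on , t ∷ off ,
        ↭-trans (shift x (map proj₁ l₁) (map proj₁ l₂)) (prep x ρ) ,
        trans (⊞-swap (relation l₁) (0F • Entry.vec x) (relation l₂)) (add0 (Entry.vec x) _ rel)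

      -- The trivial relation: with all coefficients 0, the vectors are only sorted into those on
      -- and those off target.
      start : ∀ xs → All Startable xs → Start xs
      start []                        []            = [] , [] , [] , [] , ↭-refl , ⊞-identityˡ 0V
      start (x ∷ xs)                  (inj₂ t ∷ ss) = start-on t (start xs ss)
      start (entry h true τ ∷ xs)     (inj₁ _ ∷ ss) with (0F -F τ) ∈? A
      ... | yes t = start-on t (start xs ss)
      ... | no t  = start-off (refl , t) (start xs ss)

      relation-lin : (l : List (Placed n)) → relation l ≡ lin (map (λ (x , w) → Entry.vec x , w) l)
      relation-lin []            = refl
      relation-lin ((x , w) ∷ l) = cong (w • Entry.vec x ⊞_) (relation-lin l)

      relation-↭ : {l m : List (Placed n)} → l ↭ m → relation l ≡ relation m
      relation-↭ {l} {m} ρ = trans (relation-lin l) (trans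
        (lin-↭ (map⁺ _ ρ)) (sym (relation-lin m)))

      bigValues : ∀ {r} → Vec F r → Vec (Fin (length A)) r → Vec F r
      bigValues = Vec.zipWith (λ τ i → τ +F lookup A i)

      smallValues : ∀ {s} → Vec (Fin (length B)) s → Vec F s
      smallValues = Vec.map (λ j → (-F b₀) +F lookup B j)

      value : ∀ {C : List F} {w o} (t : w -F o ∈ C) → w ≡ o +F lookup C (index t)
      value {w = w} {o} t = trans (solve 2 (λ w o → w := o :+ (w :- o)) refl w o) (cong (o +F_) (lookup-index t))

      -- The record of a final relation consists of the positions of its coefficients within `A` and
      -- `B`; `τs` enters only the equation.
      Code : (hs hs′ : List (V n)) → Vec F (length hs) → V n → Set
      Code hs hs′ τs v = Σ (Vec (Fin (length A)) (length hs) × Vec (Fin (length B)) (length hs′))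
        λ (is , js) → v ≡ lin (pairs hs (bigValues τs is)) ⊞ lin (pairs hs′ (smallValues js))

      code : ∀ hs hs′ τs l → map proj₁ l ≡ entries hs hs′ τs → All On l → Code hs hs′ τs (relation l)
      code []       []        []       []            refl []       = ([] , []) , sym (⊞-identityˡ 0V)
      code []       (h ∷ hs′) []       ((_ , w) ∷ l) eq   (t ∷ ts)
        with refl , eq′ ← ∷-injective eq
        with ([] , js) , rel ← code [] hs′ [] l eq′ ts =
        ([] , index t ∷ js) , trans (cong₂ (λ z v → z • h ⊞ v) (value {B} t) rel) (⊞-swap _ 0V _)
      code (h ∷ hs) hs′       (τ ∷ τs) ((_ , w) ∷ l) eq   (t ∷ ts)
        with refl , eq′ ← ∷-injective eq
        with (is , js) , rel ← code hs hs′ τs l eq′ ts =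
        (index t ∷ is , js) , trans (cong₂ (λ z v → z • h ⊞ v) (value {A} t) rel) (sym (⊞-assoc _ _ _))

      cancelˡ : ∀ (x y z : V n) → x ⊞ z ≡ 0V → y ⊞ z ≡ 0V → x ≡ y
      cancelˡ x y z eq eq′ = trans (sym (⊞-⊟ x z)) (trans (cong (_⊟ z) (trans eq (sym eq′))) (⊞-⊟ y z))

      bigValues-injective : ∀ {r} (τs τs′ : Vec F r) is → bigValues τs is ≡ bigValues τs′ is → τs ≡ τs′
      bigValues-injective []       []        []       _  = refl
      bigValues-injective (τ ∷ τs) (τ′ ∷ τs′) (i ∷ is) eq = cong₂ _∷_
        (trans (solve 2 (λ x y → x := (x :+ y) :- y) refl τ a)
          (trans (cong (_-F a) (cong Vec.head eq)) (solve 2 (λ x y → (x :+ y) :- y := x) refl τ′ a)))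
        (bigValues-injective τs τs′ is (cong Vec.tail eq))
        where
        a : F
        a = lookup A i

      -- As `B` is nonempty, s ≤ r allows |B|^s to be raised to |B|^r; r > 0 makes the inequality
      -- strict.
      ^-bound : ∀ {r s} → s ≤ r → 0 < r → length A ^ r * length B ^ s < p ^ r
      ^-bound {r} {s} s≤r 0<r = begin-strict
        length A ^ r * length B ^ s   ≤⟨ ℕ.*-monoʳ-≤ (length A ^ r) (ℕ.^-monoʳ-≤ (length B) {{>-nonZero (∈⇒0< b₀∈B)}} s≤r) ⟩
        length A ^ r * length B ^ r   ≡⟨ ^-distribʳ-* r (length A) (length B) ⟨
        (length A * length B) ^ r     <⟨ ℕ.^-monoˡ-< r {{>-nonZero 0<r}} AB<p ⟩
        p ^ r                         ∎
        where
        open ℕ.≤-Reasoning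
        ∈⇒0< : ∀ {b} {C : List F} → b ∈ C → 0 < length C
        ∈⇒0< {C = _ ∷ _} _ = s≤s z≤n

      Nonvanishing : ℕ → Set
      Nonvanishing m = ∀ hs hs′ → length hs + length hs′ ≡ m → Indep hs → Indep hs′ → ¬ Null (powersOf k (hs ++ hs′)) δ

      -- Each of the p^r choices of `τs` ends in a relation, and there are fewer than p^r records.
      step : ∀ h hs hs′ → (∀ {m} → m < length (h ∷ hs) + length hs′ → Nonvanishing m) → length hs′ ≤ length (h ∷ hs) →
             Indep (h ∷ hs) → Indep hs′ → ¬ Null (powersOf k (h ∷ hs ++ hs′)) δ
      step h₀ hs₀ hs′ ih s≤r ind ind′ null =
        ℕ.<⇒≱ (^-bound s≤r (s≤s z≤n)) (Vec-injection⇒≤ (proj₁ ∘ coded) coded-injective)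
        where
        hs : List (V n)
        hs = h₀ ∷ hs₀

        null′ : ∀ τs → Null (powers k (entries hs hs′ τs)) δ
        null′ τs = Null-↭ (powersOf-↭ k (↭-sym (↭-trans (vecs-↭ (entries hs hs′ τs))
            (↭-reflexive (cong₂ _++_ (bigs-entries hs hs′ τs) (smalls-entries hs hs′ τs)))))) null

        -- A proper subfamily again splits into two independent families with fewer vectors in all.
        nonnull : ∀ τs ys z zs → ys ++ z ∷ zs ↭ entries hs hs′ τs → ¬ Null (powers k ys) δ
        nonnull τs ys z zs ρ null-ys = ih smaller (bigs ys) (smalls ys) refl
          (Indep-++ˡ (bigs ys) (bigs (z ∷ zs)) (Indep-↭ (↭-sym (↭-trans
            (↭-reflexive (sym (bigs-++ ys (z ∷ zs)))) (↭-trans (bigs-↭ ρ) (↭-reflexive (bigs-entries hs hs′ τs))))) ind))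
          (Indep-++ˡ (smalls ys) (smalls (z ∷ zs)) (Indep-↭ (↭-sym (↭-trans
            (↭-reflexive (sym (smalls-++ ys (z ∷ zs)))) (↭-trans (smalls-↭ ρ) (↭-reflexive (smalls-entries hs hs′ τs))))) ind′))
          (Null-↭ (powersOf-↭ k (vecs-↭ ys)) null-ys)
          where
          open ℕ.≤-Reasoning
          smaller : length (bigs ys) + length (smalls ys) < length hs + length hs′
          smaller = begin-strict
            length (bigs ys) + length (smalls ys)          ≡⟨ length-bigs-smalls ys ⟩
            length ys                                      <⟨ ℕ.m<m+n (length ys) (s≤s z≤n) ⟩
            length ys + length (z ∷ zs)                    ≡⟨ length-++ ys ⟨
            length (ys ++ z ∷ zs)                          ≡⟨ ↭-length ρ ⟩
            length (entries hs hs′ τs)                     ≡⟨ length-bigs-smalls (entries hs hs′ τs) ⟨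
            length (bigs (entries hs hs′ τs)) + length (smalls (entries hs hs′ τs))
              ≡⟨ cong₂ (λ x y → length x + length y) (bigs-entries hs hs′ τs) (smalls-entries hs hs′ τs) ⟩
            length hs + length hs′                         ∎

        coded : ∀ τs → Code hs hs′ τs 0V
        coded τs =
          let l₁ , l₂ , on , off , ρ , rel = start (entries hs hs′ τs) (entries-startable hs hs′ τs)
              l , onₗ , ρ′ , relₗ = reach-targets k A B φ A-stable B-stable A-attracting δ δ-support
                (entries hs hs′ τs) (null′ τs) (nonnull τs) l₁ l₂ on off ρ rel (<-wellFounded _)
              m , eq , ρ″ = ↭-map-inv proj₁ ρ′
          in subst (Code hs hs′ τs) (trans (sym (relation-↭ ρ″)) relₗ)
               (code hs hs′ τs m (sym eq) (All-resp-↭ ρ″ onₗ))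

        -- Equal records give equal contributions of the smaller family, so those of the larger
        -- family agree as well. Independence compares their coefficients, and subtracting the same
        -- elements of `A` leaves the translates.
        coded-injective : Injective _≡_ _≡_ (proj₁ ∘ coded)
        coded-injective {τs} {τs′} eq = bigValues-injective τs τs′ is (Indep⇒injective hs ind _ _
          (cancelˡ _ _ (lin (pairs hs′ (smallValues js)))
            (sym (proj₂ (coded τs)))
            (trans (cong₂ (λ a b → lin (pairs hs (bigValues τs′ a)) ⊞ lin (pairs hs′ (smallValues b)))
                     (cong proj₁ eq) (cong proj₂ eq)) (sym (proj₂ (coded τs′))))))
          where
          is = proj₁ (proj₁ (coded τs))
          js = proj₂ (proj₁ (coded τs))

      -- The longer family has to be the one that is attracted, so the two exchange roles when the
      -- second is longer.
      nonvanishing-acc : ∀ m → Acc _<_ m → Nonvanishing m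
      nonvanishing-acc m (acc rs) hs hs′ refl ind ind′ null with ℕ.≤-total (length hs′) (length hs)
      nonvanishing-acc m (acc rs) [] [] refl ind ind′ null | inj₁ _ = δ0≢0 (null 0V)
      nonvanishing-acc m (acc rs) (h ∷ hs) hs′ refl ind ind′ null | inj₁ le =
        step h hs hs′ (λ lt → nonvanishing-acc _ (rs lt)) le ind ind′ null
      nonvanishing-acc m (acc rs) [] [] refl ind ind′ null | inj₂ _ = δ0≢0 (null 0V)
      nonvanishing-acc m (acc rs) hs (h ∷ hs′) refl ind ind′ null | inj₂ le =
        step h hs′ hs (λ {m′} lt → nonvanishing-acc m′ (rs (subst (m′ <_) (ℕ.+-comm (length (h ∷ hs′)) (length hs)) lt))) le ind′ ind
          (Null-↭ (powersOf-↭ k (++-comm hs (h ∷ hs′))) null)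

    nonvanishing : ∀ hs hs′ → Indep hs → Indep hs′ → ¬ Null (powersOf k (hs ++ hs′)) δ
    nonvanishing hs hs′ = nonvanishing-acc _ (<-wellFounded _) hs hs′ refl

-- Sums over residues and vectors, with values in an abelian group.

module Sums (p : ℕ) (pr : Prime p) (G : AbelianGroup 0ℓ 0ℓ) where

  open Fp p pr hiding (_-V_; e; cons)
  open Field p pr
  open Differences p pr using (V; _⊟_)
  open import Data.Nat using (zero; suc)
  open import Data.Fin using (zero; suc)
  open import Data.Fin.Properties using (suc-injective)
  open import Data.Fin.Permutation using (permutation)
  open import Data.Vec using (Vec; []; _∷_)
  open import Function using (_∘_)
  open import Relation.Binary.PropositionalEquality as ≡ using (_≡_; _≢_)

  open AbelianGroup G renaming (Carrier to C; _∙_ to _+_; ε to 0#; _⁻¹ to -_)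
  open import Algebra.Properties.AbelianGroup G using (⁻¹-∙-comm; ε⁻¹≈ε)
  open import Algebra.Properties.CommutativeMonoid.Sum commutativeMonoid using (sum; sum-cong-≋; sum-replicate-zero; ∑-distrib-+; ∑-comm; sum-permute) public
  open import Relation.Binary.Reasoning.Setoid setoid

  sum-cong : ∀ {m} {f g : Fin m → C} → (∀ i → f i ≈ g i) → sum f ≈ sum g
  sum-cong = sum-cong-≋

  sum-0 : ∀ {m} {f : Fin m → C} → (∀ i → f i ≈ 0#) → sum f ≈ 0#
  sum-0 {m} f≈0 = trans (sum-cong f≈0) (sum-replicate-zero m)

  sum-neg : ∀ {m} (f : Fin m → C) → sum (λ i → - f i) ≈ - sum f
  sum-neg {zero}  f = sym ε⁻¹≈ε
  sum-neg {suc m} f = trans (∙-congˡ (sum-neg (f ∘ suc))) (⁻¹-∙-comm (f zero) (sum (f ∘ suc)))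

  sum-- : ∀ {m} (f g : Fin m → C) → sum (λ i → f i - g i) ≈ sum f - sum g
  sum-- f g = trans (∑-distrib-+ f (λ i → - g i)) (∙-congˡ (sum-neg g))

  sum-single : ∀ {m} (f : Fin m → C) i → (∀ j → j ≢ i → f j ≈ 0#) → sum f ≈ f i
  sum-single f zero    f≈0 = trans (∙-congˡ (sum-0 (λ j → f≈0 (suc j) (λ ())))) (identityʳ (f zero))
  sum-single f (suc i) f≈0 = trans (∙-congʳ (f≈0 zero (λ ())))
    (trans (identityˡ _) (sum-single (f ∘ suc) i (λ j j≢i → f≈0 (suc j) (j≢i ∘ suc-injective))))

  sum-reindex : (g g⁻¹ : F → F) → (∀ a → g (g⁻¹ a) ≡ a) → (∀ a → g⁻¹ (g a) ≡ a) →
                (f : F → C) → sum (f ∘ g) ≈ sum f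
  sum-reindex g g⁻¹ inv inv′ f = sym (sum-permute f (permutation g g⁻¹ inv inv′))

  sum-shift : (f : F → C) (c : F) → sum (λ a → f (a -F c)) ≈ sum f
  sum-shift f c = sum-reindex (_-F c) (_+F c)
    (λ a → solve 2 (λ a c → (a :+ c) :- c := a) ≡.refl a c)
    (λ a → solve 2 (λ a c → (a :- c) :+ c := a) ≡.refl a c) f

  sumV : ∀ {n} → (V n → C) → C
  sumV {zero}  φ = φ []
  sumV {suc n} φ = sum (λ a → sumV (λ u → φ (a ∷ u)))

  sumV-cong : ∀ {n} {φ ψ : V n → C} → (∀ u → φ u ≈ ψ u) → sumV φ ≈ sumV ψ
  sumV-cong {zero}  eq = eq []
  sumV-cong {suc n} eq = sum-cong (λ a → sumV-cong (λ u → eq (a ∷ u)))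

  sumV-0 : ∀ {n} {φ : V n → C} → (∀ u → φ u ≈ 0#) → sumV φ ≈ 0#
  sumV-0 {zero}  eq = eq []
  sumV-0 {suc n} eq = sum-0 (λ a → sumV-0 (λ u → eq (a ∷ u)))

  sumV-- : ∀ {n} (φ ψ : V n → C) → sumV (λ u → φ u - ψ u) ≈ sumV φ - sumV ψ
  sumV-- {zero}  φ ψ = refl
  sumV-- {suc n} φ ψ = trans (sum-cong (λ a → sumV-- (λ u → φ (a ∷ u)) (λ u → ψ (a ∷ u))))
    (sum-- {p} (λ a → sumV (λ u → φ (a ∷ u))) (λ a → sumV (λ u → ψ (a ∷ u))))

  sumV-single : ∀ {n} (φ : V n → C) v → (∀ u → u ≢ v → φ u ≈ 0#) → sumV φ ≈ φ v
  sumV-single φ []      φ≈0 = refl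
  sumV-single φ (a ∷ v) φ≈0 = trans
    (sum-single _ a (λ b b≢a → sumV-0 (λ u → φ≈0 (b ∷ u) (λ { ≡.refl → b≢a ≡.refl }))))
    (sumV-single (λ u → φ (a ∷ u)) v (λ u u≢v → φ≈0 (a ∷ u) (λ { ≡.refl → u≢v ≡.refl })))

  sumV-shift : ∀ {n} (φ : V n → C) b → sumV (λ u → φ (u ⊟ b)) ≈ sumV φ
  sumV-shift φ []      = refl
  sumV-shift φ (c ∷ b) = trans
    (sum-cong (λ a → sumV-shift (λ u → φ ((a -F c) ∷ u)) b))
    (sum-shift (λ a → sumV (λ u → φ (a ∷ u))) c)

  sumV-sum-comm : ∀ {n m} (f : Fin m → V n → C) → sumV (λ u → sum (λ i → f i u)) ≈ sum (λ i → sumV (f i))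
  sumV-sum-comm {zero}  f = refl
  sumV-sum-comm {suc n} f = trans
    (sum-cong (λ a → sumV-sum-comm (λ i u → f i (a ∷ u))))
    (∑-comm (λ a i → sumV (λ u → f i (a ∷ u))))

-- The group ring in terms of coefficient functions on `V`.

module GroupRing (p : ℕ) (pr : Prime p) where

  open Fp p pr
  open Field p pr
  open Differences p pr
  open Targets p pr using (powersOf)
  open Products p pr using (Indep; lin)
  open Sums p pr +-abelianGroup
  open import Data.Nat using (zero; suc)
  open import Data.Bool using (true; if_then_else_; _∧_)
  open import Data.Fin using (zero; suc)
  open import Data.Fin.Properties using (_≟_)
  open import Data.Vec using (Vec; []; _∷_; tabulate)
  import Data.Vec as Vec
  open import Data.Vec.Properties using (≡-dec; tabulate∘lookup; lookup∘tabulate)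
  open import Data.List using (List; []; _∷_; _++_; map; foldr; allFin; concatMap; replicate)
  import Data.List as List
  open import Data.List.Properties using (map-tabulate; map-++; map-∘; map-cong; concatMap-++; ∷-injective)
  open import Data.List.Relation.Unary.All using (All; []; _∷_)
  import Data.List.Relation.Unary.All.Properties as All
  open import Data.List.Relation.Binary.Permutation.Propositional using (_↭_; ↭-refl; ↭-trans)
  open import Data.List.Relation.Binary.Permutation.Propositional.Properties using (++⁺; ++-comm)
  open import Data.Product using (proj₁)
  open import Function using (_∘_; id)
  open import Algebra using (CommutativeRing)
  open import Algebra.Properties.Semiring.Sum (CommutativeRing.semiring F-ring) using (*-distribˡ-sum; *-distribʳ-sum)
  open import Relation.Nullary using (does; yes; no; contradiction)
  open import Relation.Nullary.Decidable using (dec-true; dec-false)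
  open import Relation.Binary.PropositionalEquality
  open ≡-Reasoning

  sumL-tabulate : ∀ {m} (f : Fin m → F) → sumL (List.tabulate f) ≡ sum f
  sumL-tabulate {zero}  f = refl
  sumL-tabulate {suc m} f = cong (f zero +F_) (sumL-tabulate (f ∘ suc))

  sumL-allFin : ∀ {m} (f : Fin m → F) → sumL (map f (allFin m)) ≡ sum f
  sumL-allFin f = trans (cong sumL (map-tabulate id f)) (sumL-tabulate f)

  sumL-++ : ∀ xs ys → sumL (xs ++ ys) ≡ sumL xs +F sumL ys
  sumL-++ []       ys = sym (+F-identityˡ (sumL ys))
  sumL-++ (x ∷ xs) ys = trans (cong (x +F_) (sumL-++ xs ys)) (sym (+F-assoc x (sumL xs) (sumL ys)))

  sumL-concatMap : ∀ {X Y : Set} (f : Y → F) (g : X → List Y) xs →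
                   sumL (map f (concatMap g xs)) ≡ sumL (map (λ x → sumL (map f (g x))) xs)
  sumL-concatMap f g []       = refl
  sumL-concatMap f g (x ∷ xs) = trans (cong sumL (map-++ f (g x) (concatMap g xs)))
    (trans (sumL-++ (map f (g x)) _) (cong (sumL (map f (g x)) +F_) (sumL-concatMap f g xs)))

  sumL-allVecs : ∀ n (ψ : V n → F) → sumL (map (λ v → ψ (tabulate v)) (allVecs n)) ≡ sumV ψ
  sumL-allVecs zero    ψ = +F-identityʳ (ψ [])
  sumL-allVecs (suc n) ψ = begin
    sumL (map (λ v → ψ (tabulate v)) (concatMap (λ a → map (cons a) (allVecs n)) (allFin p)))
      ≡⟨ sumL-concatMap (λ v → ψ (tabulate v)) (λ a → map (cons a) (allVecs n)) (allFin p) ⟩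
    sumL (map (λ a → sumL (map (λ v → ψ (tabulate v)) (map (cons a) (allVecs n)))) (allFin p))
      ≡⟨ sumL-allFin (λ a → sumL (map (λ v → ψ (tabulate v)) (map (cons a) (allVecs n)))) ⟩
    sum (λ a → sumL (map (λ v → ψ (tabulate v)) (map (cons a) (allVecs n))))
      ≡⟨ sum-cong {p} (λ a → trans (cong sumL (sym (map-∘ (allVecs n)))) (sumL-allVecs n (λ u → ψ (a ∷ u)))) ⟩
    sum (λ a → sumV (λ u → ψ (a ∷ u)))
      ∎

  δ[_] : ∀ {n} → V n → V n → F
  δ[ b ] w = if does (≡-dec _≟_ w b) then 1F else 0F

  δ[]-self : ∀ {n} (b : V n) → δ[ b ] b ≡ 1F
  δ[]-self b = cong (if_then 1F else 0F) (dec-true (≡-dec _≟_ b b) refl)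

  δ[]-other : ∀ {n} (b w : V n) → w ≢ b → δ[ b ] w ≡ 0F
  δ[]-other b w w≢b = cong (if_then 1F else 0F) (dec-false (≡-dec _≟_ w b) w≢b)

  eqV-≡ : ∀ {n} (u v : Vecp n) → eqV u v ≡ does (≡-dec _≟_ (tabulate u) (tabulate v))
  eqV-≡ {zero}  u v = refl
  eqV-≡ {suc n} u v = cong (does (u zero ≟ v zero) ∧_) (trans
    (cong (foldr _∧_ true) (trans (map-tabulate suc (λ i → does (u i ≟ v i))) (sym (map-tabulate id (λ i → does (u (suc i) ≟ v (suc i)))))))
    (eqV-≡ (u ∘ suc) (v ∘ suc)))

  infixl 7 _⊛_
  _⊛_ : ∀ {n} → (V n → F) → (V n → F) → V n → F
  (f ⊛ h) u = sumV (λ w → f w *F h (u ⊟ w))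

  ⊛-δ : ∀ {n} b (h : V n → F) u → (δ[ b ] ⊛ h) u ≡ h (u ⊟ b)
  ⊛-δ b h u = trans
    (sumV-single (λ w → δ[ b ] w *F h (u ⊟ w)) b
      (λ w w≢b → trans (cong (_*F h (u ⊟ w)) (δ[]-other b w w≢b)) (*F-zeroˡ (h (u ⊟ w)))))
    (trans (cong (_*F h (u ⊟ b)) (δ[]-self b)) (*F-identityˡ (h (u ⊟ b))))

  private
    *F-distribʳ--F : ∀ x y z → (x -F y) *F z ≡ x *F z -F y *F z
    *F-distribʳ--F = solve 3 (λ x y z → (x :- y) :* z := x :* z :- y :* z) refl

    ⊟-cancel : ∀ {n} (u b w : V n) → u ⊟ b ⊟ (w ⊟ b) ≡ u ⊟ w
    ⊟-cancel []      []      []      = refl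
    ⊟-cancel (x ∷ u) (y ∷ b) (z ∷ w) =
      cong₂ _∷_ (solve 3 (λ x y z → x :- y :- (z :- y) := x :- z) refl x y z) (⊟-cancel u b w)

  ⊛-- : ∀ {n} (f f′ h : V n → F) u → ((λ w → f w -F f′ w) ⊛ h) u ≡ (f ⊛ h) u -F (f′ ⊛ h) u
  ⊛-- f f′ h u = trans (sumV-cong (λ w → *F-distribʳ--F (f w) (f′ w) (h (u ⊟ w))))
    (sumV-- (λ w → f w *F h (u ⊟ w)) (λ w → f′ w *F h (u ⊟ w)))

  -- Shifting the summation variable by b turns the translation of f into one of the product.
  Δ-⊛ : ∀ {n} b (f h : V n → F) u → (Δ b f ⊛ h) u ≡ Δ b (f ⊛ h) u
  Δ-⊛ b f h u = trans (⊛-- f (λ w → f (w ⊟ b)) h u) (cong (λ z → (f ⊛ h) u -F z) (trans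
    (sumV-cong (λ w → cong (λ z → f (w ⊟ b) *F h z) (sym (⊟-cancel u b w))))
    (sumV-shift (λ w → f w *F h (u ⊟ b ⊟ w)) b)))

  Δ*-⊛ : ∀ {n} bs (f h : V n → F) u → (Δ* bs f ⊛ h) u ≡ Δ* bs (f ⊛ h) u
  Δ*-⊛ []       f h u = refl
  Δ*-⊛ (b ∷ bs) f h u = trans (Δ*-⊛ bs (Δ b f) h u) (Δ*-cong bs (Δ-⊛ b f h) u)

  infix 4 _~_
  -- An element of `GR` takes functions as arguments and need not respect their pointwise equality;
  -- being represented on `V` supplies this.
  _~_ : ∀ {n} → GR n → (V n → F) → Set
  f ~ f̂ = ∀ v → f v ≡ f̂ (tabulate v)

  ⋆-~ : ∀ {n} {f h : GR n} f̂ ĥ → f ~ f̂ → h ~ ĥ → f ⋆ h ~ f̂ ⊛ ĥ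
  ⋆-~ {n} f̂ ĥ f~ h~ v = trans
    (cong sumL (map-cong (λ w → cong₂ _*F_ (f~ w) (trans (h~ (v -V w)) (cong ĥ (tabulate-- v w)))) (allVecs n)))
    (sumL-allVecs n (λ w → f̂ w *F ĥ (tabulate v ⊟ w)))
    where
    tabulate-- : ∀ {n} (v w : Vecp n) → tabulate (v -V w) ≡ tabulate v ⊟ tabulate w
    tabulate-- {zero}  v w = refl
    tabulate-- {suc n} v w = cong ((v zero -F w zero) ∷_) (tabulate-- (v ∘ suc) (w ∘ suc))

  g^-~ : ∀ {n} (b : Vecp n) → g^ b ~ δ[ tabulate b ]
  g^-~ b v = cong (if_then 1F else 0F) (eqV-≡ v b)

  one-~ : ∀ {n} → oneGR {n} ~ δ[ 0V ]
  one-~ {n} v = trans (g^-~ (λ _ → 0F) v) (cong (λ z → δ[ z ] (tabulate v)) (tabulate-0 n))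
    where
    tabulate-0 : ∀ n → tabulate {n = n} (λ _ → 0F) ≡ 0V
    tabulate-0 zero    = refl
    tabulate-0 (suc n) = cong (0F ∷_) (tabulate-0 n)

  factor-⊛ : ∀ {n} b (h : V n → F) u → ((λ w → δ[ 0V ] w -F δ[ b ] w) ⊛ h) u ≡ Δ b h u
  factor-⊛ b h u = trans (⊛-- δ[ 0V ] δ[ b ] h u)
    (cong₂ _-F_ (trans (⊛-δ 0V h u) (cong h (⊟-identityʳ u))) (⊛-δ b h u))

  pow-~ : ∀ {n} (b : Vecp n) k → powGR (oneGR -GR g^ b) k ~ Δ* (replicate k (tabulate b)) δ[ 0V ]
  pow-~ b zero    = one-~
  pow-~ b (suc k) v = trans
    (⋆-~ (λ w → δ[ 0V ] w -F δ[ b̂ ] w) (Δ* (replicate k b̂) δ[ 0V ]) (λ w → cong₂ _-F_ (one-~ w) (g^-~ b w)) (pow-~ b k) v)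
    (trans (factor-⊛ b̂ (Δ* (replicate k b̂) δ[ 0V ]) (tabulate v))
      (sym (Δ*-Δ (replicate k b̂) b̂ δ[ 0V ] (tabulate v))))
    where
    b̂ = tabulate b

  -- The operators of the left factor pass outside the convolution, and the unit they leave behind
  -- disappears; hence `cs` comes before `bs`.
  Δ*-~-⋆ : ∀ {n} {f h : GR n} bs cs → f ~ Δ* bs δ[ 0V ] → h ~ Δ* cs δ[ 0V ] → f ⋆ h ~ Δ* (cs ++ bs) δ[ 0V ]
  Δ*-~-⋆ bs cs f~ h~ v = trans (⋆-~ (Δ* bs δ[ 0V ]) (Δ* cs δ[ 0V ]) f~ h~ v) (trans
    (Δ*-⊛ bs δ[ 0V ] (Δ* cs δ[ 0V ]) (tabulate v)) (trans
    (Δ*-cong bs (λ u → trans (⊛-δ 0V (Δ* cs δ[ 0V ]) u) (cong (Δ* cs δ[ 0V ]) (⊟-identityʳ u))) (tabulate v))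
    (cong (λ f → f (tabulate v)) (sym (Δ*-++ cs bs δ[ 0V ])))))

  rows : ∀ {n} → Mat n → List (V n)
  rows M = List.tabulate (λ i → tabulate (M i))

  -- The blocks come out in reverse order, so the list is pinned down only up to permutation.
  prod-~ : ∀ {n} (M : Mat n) k → ∃ λ bs → bs ↭ powersOf k (rows M) ×
           prodGR (λ i → powGR (oneGR -GR g^ (M i)) k) ~ Δ* bs δ[ 0V ]
  prod-~ {n} M k = subst (λ hs → ∃ λ bs → bs ↭ powersOf k hs ×
      prodGR (λ i → powGR (oneGR -GR g^ (M i)) k) ~ Δ* bs δ[ 0V ]) (map-tabulate id (λ i → tabulate (M i))) (go (allFin n))
    where
    go : ∀ is → ∃ λ bs → bs ↭ powersOf k (map (λ i → tabulate (M i)) is) ×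
         foldr _⋆_ oneGR (map (λ i → powGR (oneGR -GR g^ (M i)) k) is) ~ Δ* bs δ[ 0V ]
    go []       = [] , ↭-refl , one-~
    go (i ∷ is) with bs , ρ , rep ← go is =
      bs ++ replicate k (tabulate (M i)) ,
      ↭-trans (++-comm bs _) (++⁺ ↭-refl ρ) ,
      Δ*-~-⋆ (replicate k (tabulate (M i))) bs (pow-~ (M i) k) rep

  product-null : ∀ {n} (M N : Mat n) k →
    (∀ v → (prodGR (λ i → powGR (oneGR -GR g^ (M i)) k) ⋆ prodGR (λ i → powGR (oneGR -GR g^ (N i)) k)) v ≡ zeroGR v) →
    Null (powersOf k (rows M ++ rows N)) δ[ 0V ]
  product-null M N k vanish with bs , ρ , rep ← prod-~ M k | cs , σ , rep′ ← prod-~ N k =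
    subst (λ ds → Null ds δ[ 0V ]) (sym (concatMap-++ (replicate k) (rows M) (rows N)))
      (Null-↭ (↭-trans (++-comm cs bs) (++⁺ ρ σ)) (λ u → begin
        Δ* (cs ++ bs) δ[ 0V ] u                          ≡⟨ cong (Δ* (cs ++ bs) δ[ 0V ]) (tabulate∘lookup u) ⟨
        Δ* (cs ++ bs) δ[ 0V ] (tabulate (Vec.lookup u))  ≡⟨ Δ*-~-⋆ bs cs rep rep′ (Vec.lookup u) ⟨
        _                                                ≡⟨ vanish (Vec.lookup u) ⟩
        0F                                               ∎))

  δ[]-support : ∀ {n} (u : V n) → δ[ 0V ] u ≢ 0F → u ≡ 0V
  δ[]-support u ne with ≡-dec _≟_ u 0V
  ... | yes eq = eq
  ... | no u≢0 = contradiction refl ne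

  δ[]-nonzero : ∀ {n} → δ[ 0V {n} ] 0V ≢ 0F
  δ[]-nonzero {n} eq = 1F≢0F (trans (sym (δ[]-self (0V {n}))) eq)

  private
    weights : ∀ {n m} (l : List (V n × F)) (r : Fin m → V n) → map proj₁ l ≡ List.tabulate r →
              ∃ λ (w : Fin m → F) → l ≡ List.tabulate (λ i → r i , w i)
    weights {m = zero}  []            r eq = (λ ()) , refl
    weights {m = suc m} ((h , a) ∷ l) r eq with refl , eq′ ← ∷-injective eq
      with w , refl ← weights l (r ∘ suc) eq′ = (λ { zero → a ; (suc i) → w i }) , refl
    lookup-⊞• : ∀ {n} a (h v : V n) j → Vec.lookup (a • h ⊞ v) j ≡ a *F Vec.lookup h j +F Vec.lookup v j
    lookup-⊞• a (x ∷ h) (y ∷ v) zero    = refl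
    lookup-⊞• a (x ∷ h) (y ∷ v) (suc j) = lookup-⊞• a h v j
    lookup-0 : ∀ {n} (j : Fin n) → Vec.lookup 0V j ≡ 0F
    lookup-0 zero    = refl
    lookup-0 (suc j) = lookup-0 j
    lookup-lin : ∀ {n m} (r : Fin m → V n) (w : Fin m → F) j →
                 Vec.lookup (lin (List.tabulate (λ i → r i , w i))) j ≡ sum (λ i → w i *F Vec.lookup (r i) j)
    lookup-lin {m = zero}  r w j = lookup-0 j
    lookup-lin {m = suc m} r w j = trans (lookup-⊞• (w zero) (r zero) _ j)
      (cong (w zero *F Vec.lookup (r zero) j +F_) (lookup-lin (r ∘ suc) (w ∘ suc) j))

  -- Multiplying a linear combination of the rows of M by N on the right recovers its coefficients.
  Indep-rows : ∀ {n} (M N : Mat n) → (∀ i j → mulMM M N i j ≡ idMat i j) → Indep (rows M)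
  Indep-rows {n} M N MN≡1 l eq lin≡0 with w , refl ← weights l (λ i → tabulate (M i)) eq =
    All.tabulate⁺ (λ i → begin
      w i                                              ≡⟨ *F-identityʳ′ (w i) ⟨
      w i *F 1F                                        ≡⟨ cong (λ z → w i *F (if z then 1F else 0F)) (dec-true (i ≟ i) refl) ⟨
      w i *F idMat i i                                 ≡⟨ sum-single (λ l → w l *F idMat l i) i
                                                            (λ j j≢i → trans (cong (λ z → w j *F (if z then 1F else 0F)) (dec-false (j ≟ i) j≢i)) (*F-zeroʳ (w j))) ⟨
      sum (λ l → w l *F idMat l i)                     ≡⟨ sum-cong {n} (λ l → cong (w l *F_) (trans (sym (MN≡1 l i)) (sumL-allFin (λ j → M l j *F N j i)))) ⟩
      sum (λ l → w l *F sum (λ j → M l j *F N j i))    ≡⟨ sum-cong {n} (λ l → *-distribˡ-sum (w l) (λ j → M l j *F N j i)) ⟩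
      sum (λ l → sum (λ j → w l *F (M l j *F N j i)))  ≡⟨ ∑-comm (λ l j → w l *F (M l j *F N j i)) ⟩
      sum (λ j → sum (λ l → w l *F (M l j *F N j i)))  ≡⟨ sum-cong {n} (λ j → trans (sum-cong {n} (λ l → sym (*F-assoc (w l) (M l j) (N j i))))
                                                            (sym (*-distribʳ-sum (N j i) (λ l → w l *F M l j)))) ⟩
      sum (λ j → sum (λ l → w l *F M l j) *F N j i)    ≡⟨ sum-0 (λ j → trans (cong (_*F N j i) (column j)) (*F-zeroˡ (N j i))) ⟩
      0F                                               ∎)
    where
    *F-identityʳ′ : ∀ a → a *F 1F ≡ a
    *F-identityʳ′ a = trans (*F-comm a 1F) (*F-identityˡ a)
    column : ∀ j → sum (λ i → w i *F M i j) ≡ 0F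
    column j = trans (sum-cong {n} (λ i → cong (w i *F_) (sym (lookup∘tabulate (M i) j))))
      (trans (sym (lookup-lin (λ i → tabulate (M i)) w j)) (trans (cong (λ v → Vec.lookup v j) lin≡0) (lookup-0 j)))

  mulMM-idMat : ∀ {n} (i j : Fin n) → mulMM idMat idMat i j ≡ idMat i j
  mulMM-idMat {n} i j = begin
    mulMM idMat idMat i j                   ≡⟨ sumL-allFin (λ l → idMat i l *F idMat l j) ⟩
    sum (λ l → idMat i l *F idMat l j)      ≡⟨ sum-single (λ l → idMat i l *F idMat l j) i
                                                 (λ l l≢i → trans (cong (λ z → (if z then 1F else 0F) *F idMat l j) (dec-false (i ≟ l) (l≢i ∘ sym)))
                                                                  (*F-zeroˡ (idMat l j))) ⟩
    idMat i i *F idMat i j                  ≡⟨ cong (λ z → (if z then 1F else 0F) *F idMat i j) (dec-true (i ≟ i) refl) ⟩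
    1F *F idMat i j                         ≡⟨ *F-identityˡ (idMat i j) ⟩
    idMat i j                               ∎

-- A covering by hyperplanes makes the product vanish.

module Radon (p : ℕ) (pr : Prime p) where

  open Fp p pr hiding (_-V_; cons)
  open Field p pr
  open Differences p pr
  open Targets p pr using (∃?-V; powersOf)
  open GroupRing p pr using (δ[_]; rows; sumL-allFin)
  open import Data.Integer using (ℤ; +_)
  import Data.Integer as ℤ
  import Data.Integer.Properties as ℤ
  open import Data.Nat using (zero; suc)
  open import Data.Bool using (true; false; if_then_else_)
  open import Data.Fin using (zero; suc)
  open import Data.Fin.Properties using (_≟_)
  open import Data.Vec using (Vec; []; _∷_; tabulate)
  import Data.Vec as Vec
  open import Data.Vec.Properties using (≡-dec)
  open import Data.List using (List; []; _∷_; _++_; map; allFin; concatMap; replicate; length)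
  import Data.List as List
  open import Data.List.Properties using (map-tabulate; map-++; map-∘; length-tabulate; concatMap-++)
  open import Data.List.Relation.Unary.Any using (Any; here; there; any?)
  open import Data.List.Relation.Unary.Any.Properties using (++⁺ˡ; ++⁺ʳ; concatMap⁺; map⁺)
  open import Data.List.Membership.Propositional using (lose)
  open import Data.List.Membership.Propositional.Properties using (∈-allFin)
  open import Data.Product using (proj₁)
  open import Function using (_∘_; id; const)
  open import Relation.Nullary using (does; yes; no; contradiction; ¬?)
  open import Relation.Nullary.Decidable using (dec-true; dec-false)
  open import Relation.Binary.PropositionalEquality
  open ≡-Reasoning

  private
    module Z = Sums p pr ℤ.+-0-abelianGroup
    module S = Sums p pr +-abelianGroup

  dot : ∀ {n} → V n → V n → F
  dot []       []       = 0F
  dot (x ∷ xs) (y ∷ ys) = x *F y +F dot xs ys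

  dot-⊟ : ∀ {n} (x u v : V n) → dot x (u ⊟ v) ≡ dot x u -F dot x v
  dot-⊟ []       []       []       = sym (-F-inverseʳ 0F)
  dot-⊟ (x ∷ xs) (y ∷ ys) (z ∷ zs) = trans (cong (x *F (y -F z) +F_) (dot-⊟ xs ys zs))
    (solve 5 (λ x y z a b → x :* (y :- z) :+ (a :- b) := (x :* y :+ a) :- (x :* z :+ b)) refl x y z (dot xs ys) (dot xs zs))

  -- Integer coefficient functions on F_p^n × F_p; the second coordinate records the exponent of a p-th root of unity.
  Δᶻ : ∀ {n} → V n × F → (V n → F → ℤ) → V n → F → ℤ
  Δᶻ (h , c) f v s = f v s ℤ.- f (v ⊟ h) (s -F c)

  Δᶻ* : ∀ {n} → List (V n × F) → (V n → F → ℤ) → V n → F → ℤ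
  Δᶻ* []      f = f
  Δᶻ* (q ∷ L) f = Δᶻ* L (Δᶻ q f)

  -- The coefficients, with respect to the powers of ζ, of the value of f at the character that
  -- sends g^v to ζ^(-x·v).
  radon : ∀ {n} → (V n → F → ℤ) → V n → F → ℤ
  radon f x s = Z.sumV (λ v → f v (s +F dot x v))

  -- At this character the factor 1 - ζ^c g^h becomes 1 - ζ^(c - x·h), again a difference operator,
  -- now in s alone.
  radon-Δᶻ : ∀ {n} h c (f : V n → F → ℤ) x s →
             radon (Δᶻ (h , c) f) x s ≡ radon f x s ℤ.- radon f x (s -F c +F dot x h)
  radon-Δᶻ h c f x s = trans (Z.sumV-- (λ v → f v (s +F dot x v)) (λ v → f (v ⊟ h) (s +F dot x v -F c)))
    (cong (λ z → radon f x s ℤ.- z) (trans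
      (Z.sumV-cong (λ v → cong (f (v ⊟ h)) (trans
        (solve 4 (λ s a b c → (s :+ a) :- c := (s :- c :+ b) :+ (a :- b)) refl s (dot x v) (dot x h) c)
        (cong (s -F c +F dot x h +F_) (sym (dot-⊟ x v h))))))
      (Z.sumV-shift (λ v → f v (s -F c +F dot x h +F dot x v)) h)))

  -- If x lies on the hyperplane of (h , c), that factor becomes 1 - 1 = 0, and all later factors
  -- act on the zero function.
  radon-vanishes : ∀ {n} (L : List (V n × F)) x → Any (λ (h , c) → dot x h ≡ c) L →
                   ∀ f s → radon (Δᶻ* L f) x s ≡ + 0
  radon-vanishes ((h , c) ∷ L) x (there q)   f s = radon-vanishes L x q (Δᶻ (h , c) f) s
  radon-vanishes ((h , c) ∷ L) x (here refl) f s = preserve L (Δᶻ (h , c) f) hit s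
    where
    hit : ∀ s → radon (Δᶻ (h , c) f) x s ≡ + 0
    hit s = trans (radon-Δᶻ h c f x s) (trans
      (cong (λ z → radon f x s ℤ.- radon f x z) (solve 2 (λ s c → s :- c :+ c := s) refl s c))
      (ℤ.+-inverseʳ (radon f x s)))
    preserve : ∀ L f → (∀ s → radon f x s ≡ + 0) → ∀ s → radon (Δᶻ* L f) x s ≡ + 0
    preserve []            f f≡0 = f≡0
    preserve ((h , c) ∷ L) f f≡0 = preserve L (Δᶻ (h , c) f) (λ s → trans (radon-Δᶻ h c f x s)
      (cong₂ ℤ._-_ (f≡0 s) (f≡0 (s -F c +F dot x h))))

  sum-const : ∀ m z → Z.sum {m} (λ _ → z) ≡ + m ℤ.* z
  sum-const zero    z = sym (ℤ.*-zeroˡ z)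
  sum-const (suc m) z = trans (cong (λ y → z ℤ.+ y) (sum-const m z)) (sym (ℤ.suc-* (+ m) z))

  -- Summing over the lines through (a₀ , s) meets every other point of the plane with a ≠ a₀ once.
  line-inversion : (Q : F → F → ℤ) →
    (∀ x s s′ → Z.sum (λ a → Q a (s +F x *F a)) ≡ Z.sum (λ a → Q a (s′ +F x *F a))) →
    ∀ a s s′ → Q a s ≡ Q a s′
  -- The centre lies on all p lines, and p is cancelled in ℤ; in F this would be a division by 0.
  line-inversion Q const-sums a₀ s s′ = ℤ.*-cancelˡ-≡ (+ p) (Q a₀ s) (Q a₀ s′)
    (trans (sym (centre s)) (trans (ℤ.i-j≡0⇒i≡j (T a₀ s) (T a₀ s′) difference) (centre s′)))
    where
    T : F → F → ℤ
    T a s = Z.sum (λ x → Q a (s -F x *F a₀ +F x *F a))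

    centre : ∀ s → T a₀ s ≡ + p ℤ.* Q a₀ s
    centre s = trans (Z.sum-cong {p} (λ x → cong (Q a₀) (solve 2 (λ s y → s :- y :+ y := s) refl s (x *F a₀))))
      (sum-const p (Q a₀ s))

    off-centre : ∀ a → a ≢ a₀ → ∀ s → T a s ≡ Z.sum (Q a)
    off-centre a a≢a₀ s with b , b*≡1 ← *F-inverse (a -F a₀) (a≢a₀ ∘ x-y≡0⇒x≡y) =
      Z.sum-reindex (λ x → s -F x *F a₀ +F x *F a) (λ y → (y -F s) *F b)
        (λ y → trans (solve 5 (λ s y a a₀ b → s :- (y :- s) :* b :* a₀ :+ (y :- s) :* b :* a := s :+ (y :- s) :* (b :* (a :- a₀))) refl s y a a₀ b)
          (trans (cong (λ z → s +F (y -F s) *F z) b*≡1) (solve 2 (λ s y → s :+ (y :- s) :* con (+ 1) := y) refl s y)))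
        (λ x → trans (solve 5 (λ s x a a₀ b → (s :- x :* a₀ :+ x :* a :- s) :* b := x :* (b :* (a :- a₀))) refl s x a a₀ b)
          (trans (cong (x *F_) b*≡1) (solve 1 (λ x → x :* con (+ 1) := x) refl x)))
        (Q a)

    sum-T : ∀ s → Z.sum (λ a → T a s) ≡ Z.sum (λ x → Z.sum (λ a → Q a (s -F x *F a₀ +F x *F a)))
    sum-T s = Z.∑-comm (λ a x → Q a (s -F x *F a₀ +F x *F a))

    difference : T a₀ s ℤ.- T a₀ s′ ≡ + 0
    difference = begin
      T a₀ s ℤ.- T a₀ s′                                      ≡⟨ Z.sum-single (λ a → T a s ℤ.- T a s′) a₀ (λ a a≢a₀ →
                                                                   ℤ.i≡j⇒i-j≡0 (trans (off-centre a a≢a₀ s) (sym (off-centre a a≢a₀ s′)))) ⟨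
      Z.sum (λ a → T a s ℤ.- T a s′)                          ≡⟨ Z.sum-- (λ a → T a s) (λ a → T a s′) ⟩
      Z.sum (λ a → T a s) ℤ.- Z.sum (λ a → T a s′)            ≡⟨ ℤ.i≡j⇒i-j≡0 (trans (sum-T s) (trans
                                                                   (Z.sum-cong {p} (λ x → const-sums x (s -F x *F a₀) (s′ -F x *F a₀))) (sym (sum-T s′)))) ⟩
      + 0                                                     ∎

  -- Induction on n. Summing out the first coordinate along slope x gives a function whose transform
  -- is part of that of f, so it is constant in s; its values are the line sums in the plane of (a ,
  -- s).
  radon-inversion : ∀ {n} (f : V n → F → ℤ) → (∀ x s s′ → radon f x s ≡ radon f x s′) → ∀ v s s′ → f v s ≡ f v s′
  radon-inversion {zero}  f const-radon [] s s′ = begin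
    f [] s                    ≡⟨ cong (f []) (+F-0 s) ⟨
    f [] (s +F 0F)            ≡⟨ const-radon [] s s′ ⟩
    f [] (s′ +F 0F)           ≡⟨ cong (f []) (+F-0 s′) ⟩
    f [] s′                   ∎
    where
    +F-0 : ∀ s → s +F 0F ≡ s
    +F-0 = +F-identityʳ
  radon-inversion {suc n} f const-radon (a ∷ v) = line-inversion (λ a s → f (a ∷ v) s)
    (λ x → radon-inversion (slice x) (λ y s s′ → trans (slice-radon x y s) (trans (const-radon (x ∷ y) s s′) (sym (slice-radon x y s′)))) v) a
    where
    slice : F → V n → F → ℤ
    slice x v s = Z.sum (λ a → f (a ∷ v) (s +F x *F a))
    slice-radon : ∀ x y s → radon (slice x) y s ≡ radon f (x ∷ y) s
    slice-radon x y s = trans (Z.sumV-sum-comm (λ a v → f (a ∷ v) (s +F dot y v +F x *F a)))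
      (Z.sum-cong {p} (λ a → Z.sumV-cong (λ v → cong (f (a ∷ v))
        (solve 3 (λ s d e → s :+ d :+ e := s :+ (e :+ d)) refl s (dot y v) (x *F a)))))

  -- Setting ζ = 1 and reducing modulo p, that is, reduction modulo 1 - ζ.
  collapse : ∀ {n} → (V n → F → ℤ) → V n → F
  collapse f v = red (Z.sum (f v))

  red-- : ∀ x y → red (x ℤ.- y) ≡ red x -F red y
  red-- x y = trans (red-+ x (ℤ.- y)) (cong (red x +F_) (red-neg y))

  collapse-Δᶻ* : ∀ {n} (L : List (V n × F)) f u → collapse (Δᶻ* L f) u ≡ Δ* (map proj₁ L) (collapse f) u
  collapse-Δᶻ* []            f u = refl
  collapse-Δᶻ* ((h , c) ∷ L) f u = trans (collapse-Δᶻ* L (Δᶻ (h , c) f) u) (Δ*-cong (map proj₁ L) collapse-Δᶻ u)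
    where
    collapse-Δᶻ : ∀ v → collapse (Δᶻ (h , c) f) v ≡ Δ h (collapse f) v
    collapse-Δᶻ v = trans (cong red (trans (Z.sum-- (f v) (λ s → f (v ⊟ h) (s -F c)))
      (cong (λ z → Z.sum (f v) ℤ.- z) (Z.sum-shift (f (v ⊟ h)) c)))) (red-- (Z.sum (f v)) (Z.sum (f (v ⊟ h))))

  δᶻ : ∀ {n} → V n → F → ℤ
  δᶻ v s = if does (≡-dec _≟_ v 0V) then (if does (s ≟ 0F) then + 1 else + 0) else + 0

  collapse-δᶻ : ∀ {n} (v : V n) → collapse δᶻ v ≡ δ[ 0V ] v
  collapse-δᶻ v with does (≡-dec _≟_ v 0V)
  ... | false = cong red (Z.sum-0 {p} (λ _ → refl))
  ... | true  = cong red (trans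
    (Z.sum-single (λ s → if does (s ≟ 0F) then + 1 else + 0) 0F (λ s s≢0 → cong (if_then + 1 else + 0) (dec-false (s ≟ 0F) s≢0)))
    (cong (if_then + 1 else + 0) (dec-true (0F ≟ 0F) refl)))

  -- All transforms vanish, so the coefficients of the product are constant in s, and collapsing
  -- multiplies that constant by p.
  covering-null : ∀ {n} (L : List (V n × F)) → (∀ x → Any (λ (h , c) → dot x h ≡ c) L) → Null (map proj₁ L) δ[ 0V ]
  covering-null L covers u = begin
    Δ* (map proj₁ L) δ[ 0V ] u              ≡⟨ Δ*-cong (map proj₁ L) collapse-δᶻ u ⟨
    Δ* (map proj₁ L) (collapse δᶻ) u        ≡⟨ collapse-Δᶻ* L δᶻ u ⟨
    red (Z.sum (Δᶻ* L δᶻ u))                ≡⟨ cong red (Z.sum-cong {p} (λ s → constant u s 0F)) ⟩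
    red (Z.sum {p} (λ _ → Δᶻ* L δᶻ u 0F))   ≡⟨ cong red (sum-const p (Δᶻ* L δᶻ u 0F)) ⟩
    red (+ p ℤ.* Δᶻ* L δᶻ u 0F)             ≡⟨ red-* (+ p) (Δᶻ* L δᶻ u 0F) ⟩
    ⟦ p ⟧ *F red (Δᶻ* L δᶻ u 0F)            ≡⟨ cong (_*F red (Δᶻ* L δᶻ u 0F)) ⟦p⟧ ⟩
    0F *F red (Δᶻ* L δᶻ u 0F)               ≡⟨ *F-zeroˡ (red (Δᶻ* L δᶻ u 0F)) ⟩
    0F                                      ∎
    where
    constant : ∀ v s s′ → Δᶻ* L δᶻ v s ≡ Δᶻ* L δᶻ v s′
    constant = radon-inversion (Δᶻ* L δᶻ) (λ x s s′ →
      trans (radon-vanishes L x (covers x) δᶻ s) (sym (radon-vanishes L x (covers x) δᶻ s′)))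

  dot-tabulate : ∀ {n} (x : V n) (h : Vecp n) → dot x (tabulate h) ≡ S.sum (λ j → h j *F Vec.lookup x j)
  dot-tabulate []       h = refl
  dot-tabulate (x ∷ xs) h = cong₂ _+F_ (*F-comm x (h zero)) (dot-tabulate xs (h ∘ suc))

  dot-row : ∀ {n} (M : Mat n) x i → dot x (tabulate (M i)) ≡ mulMV M (Vec.lookup x) i
  dot-row M x i = trans (dot-tabulate x (M i)) (sym (sumL-allFin (λ j → M i j *F Vec.lookup x j)))

  mulMV-idMat : ∀ {n} (x : Vecp n) i → mulMV idMat x i ≡ x i
  mulMV-idMat x i = begin
    mulMV idMat x i                     ≡⟨ sumL-allFin (λ j → idMat i j *F x j) ⟩
    S.sum (λ j → idMat i j *F x j)      ≡⟨ S.sum-single (λ j → idMat i j *F x j) i (λ j j≢i → trans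
                                             (cong (λ z → (if z then 1F else 0F) *F x j) (dec-false (i ≟ j) (j≢i ∘ sym))) (*F-zeroˡ (x j))) ⟩
    idMat i i *F x i                    ≡⟨ cong (λ z → (if z then 1F else 0F) *F x i) (dec-true (i ≟ i) refl) ⟩
    1F *F x i                           ≡⟨ *F-identityˡ (x i) ⟩
    x i                                 ∎

  hyperplanes : ∀ {n k} → Mat n → (Fin n → Fin k → F) → List (V n × F)
  hyperplanes {n} {k} M c = concatMap (λ i → map (λ l → tabulate (M i) , c i l) (allFin k)) (allFin n)

  -- Each row occurs once for each of its k forbidden values; this is where the exponent k of the
  -- product comes from.
  hyperplanes-normals : ∀ {n k} (M : Mat n) (c : Fin n → Fin k → F) → map proj₁ (hyperplanes M c) ≡ powersOf k (rows M)
  hyperplanes-normals {n} {k} M c = trans (go (allFin n)) (cong (powersOf k) (map-tabulate id (λ i → tabulate (M i))))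
    where
    map-constant : ∀ {X Y : Set} {y : Y} (xs : List X) → map (const y) xs ≡ replicate (length xs) y
    map-constant []       = refl
    map-constant (x ∷ xs) = cong (_ ∷_) (map-constant xs)
    block : ∀ i → map proj₁ (map (λ l → tabulate (M i) , c i l) (allFin k)) ≡ replicate k (tabulate (M i))
    block i = trans (sym (map-∘ (allFin k))) (trans (map-constant (allFin k))
      (cong (λ m → replicate m (tabulate (M i))) (length-tabulate {n = k} id)))
    go : ∀ is → map proj₁ (concatMap (λ i → map (λ l → tabulate (M i) , c i l) (allFin k)) is) ≡ powersOf k (map (λ i → tabulate (M i)) is)
    go []       = refl
    go (i ∷ is) = trans (map-++ proj₁ (map (λ l → tabulate (M i) , c i l) (allFin k)) _) (cong₂ _++_ (block i) (go is))

  ∈-hyperplanes : ∀ {n k} (M : Mat n) (c : Fin n → Fin k → F) i l {P : V n × F → Set} →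
                  P (tabulate (M i) , c i l) → Any P (hyperplanes M c)
  ∈-hyperplanes M c i l Pq =
    concatMap⁺ (λ i → map (λ l → tabulate (M i) , c i l) (allFin _)) (lose (∈-allFin i) (map⁺ (lose (∈-allFin l) Pq)))

  avoiding-vector : ∀ {n k} (M : Mat n) → ¬ Null (powersOf k (rows idMat ++ rows M)) δ[ 0V ] →
    (c d : Fin n → Fin k → F) → ∃ λ (x : Vecp n) → ∀ i l → x i ≢ c i l × mulMV M x i ≢ d i l
  avoiding-vector {n} {k} M nonnull c d
    with ∃?-V (λ x → ¬ Any (λ (h , c) → dot x h ≡ c) L) (λ x → ¬? (any? (λ (h , c) → dot x h ≟ c) L))
    where
    L : List (V n × F)
    L = hyperplanes idMat c ++ hyperplanes M d
  ... | yes (x , avoids) = Vec.lookup x , λ i l →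
    (λ eq → avoids (++⁺ˡ (∈-hyperplanes idMat c i l (trans (dot-row idMat x i) (trans (mulMV-idMat (Vec.lookup x) i) eq))))) ,
    (λ eq → avoids (++⁺ʳ (hyperplanes idMat c) (∈-hyperplanes M d i l (trans (dot-row M x i) eq))))
  ... | no all-hit = contradiction (subst (λ bs → Null bs δ[ 0V ]) normals (covering-null L covers)) nonnull
    where
    L : List (V n × F)
    L = hyperplanes idMat c ++ hyperplanes M d
    covers : ∀ x → Any (λ (h , c) → dot x h ≡ c) L
    covers x with any? (λ (h , c) → dot x h ≟ c) L
    ... | yes q = q
    ... | no ¬q = contradiction (x , ¬q) all-hit
    normals : map proj₁ L ≡ powersOf k (rows idMat ++ rows M)
    normals = trans (map-++ proj₁ (hyperplanes idMat c) (hyperplanes M d))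
      (trans (cong₂ _++_ (hyperplanes-normals idMat c) (hyperplanes-normals M d))
        (sym (concatMap-++ (replicate k) (rows idMat) (rows M))))

-- Stable and attracting sets.

module StableSets (p : ℕ) (pr : Prime p) where

  open Fp p pr hiding (_-V_; e; cons)
  open Field p pr
  open Differences p pr
  open Targets p pr using (Steps; Stable; Attracting; powersOf)
  open Products p pr using (Indep; nonvanishing)
  open GroupRing p pr using (δ[_]; δ[]-support; δ[]-nonzero)
  open import Data.Integer using (+_)
  open import Data.Nat using (zero; suc; _+_; s≤s; z≤n; ⌊_/2⌋; ⌈_/2⌉; _<?_)
  import Data.Nat.Properties as ℕ
  open import Data.Nat.DivMod using (m<n⇒m%n≡m; _%_)
  open import Data.Fin using (toℕ; zero; suc)
  open import Data.Fin.Properties using (toℕ<n; _≟_)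
  open import Data.Fin.Subset using (Subset; inside; outside; ∣_∣)
  import Data.Fin.Subset as Subset
  open import Data.Vec using ([]; _∷_; here; there)
  open import Data.List using (List; []; _∷_; _++_; map; length; replicate; concatMap)
  open import Data.List.Properties using (length-map; length-++; length-replicate)
  open import Data.List.Relation.Unary.All using (All; []; _∷_)
  import Data.List.Relation.Unary.All as All
  import Data.List.Relation.Unary.All.Properties as All
  open import Data.List.Relation.Unary.Any using (here; there)
  open import Data.List.Membership.Propositional using (_∈_; find; lose)
  open import Data.List.Membership.Propositional.Properties using (∈-map⁺; ∈-map⁻; ∈-concatMap⁺; ∈-concatMap⁻)
  open import Data.Product using (∃₂; proj₁; proj₂)
  open import Data.Sum using (_⊎_; inj₁; inj₂)
  open import Function using (_∘_; const)
  open import Relation.Nullary using (yes; no; contradiction)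
  open import Relation.Binary.PropositionalEquality
  open ≡-Reasoning

  -- Arithmetic progressions

  ·F-* : ∀ i d → i ·F d ≡ ⟦ i ⟧ *F d
  ·F-* i d = trans (sym (⟦⟧-* i (toℕ d))) (cong (⟦ i ⟧ *F_) (⟦toℕ⟧ d))

  ·F-+ : ∀ i j d → (i + j) ·F d ≡ i ·F d +F j ·F d
  ·F-+ i j d = begin
    (i + j) ·F d                 ≡⟨ ·F-* (i + j) d ⟩
    ⟦ i + j ⟧ *F d               ≡⟨ cong (_*F d) (⟦⟧-+ i j) ⟨
    (⟦ i ⟧ +F ⟦ j ⟧) *F d        ≡⟨ solve 3 (λ x y d → (x :+ y) :* d := x :* d :+ y :* d) refl ⟦ i ⟧ ⟦ j ⟧ d ⟩
    ⟦ i ⟧ *F d +F ⟦ j ⟧ *F d     ≡⟨ cong₂ _+F_ (·F-* i d) (·F-* j d) ⟨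
    i ·F d +F j ·F d             ∎

  1·F : ∀ d → 1 ·F d ≡ d
  1·F d = trans (·F-* 1 d) (*F-identityˡ d)

  Sub-replicate : ∀ k d {σ} → Sub (replicate k d) σ → ∃ λ i → i ≤ k × σ ≡ i ·F d
  Sub-replicate zero    d []       = 0 , z≤n , refl
  Sub-replicate (suc k) d (skip s) with i , i≤k , eq ← Sub-replicate k d s = i , ℕ.m≤n⇒m≤1+n i≤k , eq
  Sub-replicate (suc k) d (take s) with i , i≤k , eq ← Sub-replicate k d s =
    suc i , s≤s i≤k , trans (cong₂ _+F_ (sym (1·F d)) eq) (sym (·F-+ 1 i d))

  Sub⁺-replicate : ∀ k d {σ} → Sub⁺ (replicate k d) σ → ∃ λ i → 1 ≤ i × i ≤ k × σ ≡ i ·F d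
  Sub⁺-replicate (suc k) d (skip s) with i , 1≤i , i≤k , eq ← Sub⁺-replicate k d s = i , 1≤i , ℕ.m≤n⇒m≤1+n i≤k , eq
  Sub⁺-replicate (suc k) d (take s) with i , i≤k , eq ← Sub-replicate k d s =
    suc i , s≤s z≤n , s≤s i≤k , trans (cong₂ _+F_ (sym (1·F d)) eq) (sym (·F-+ 1 i d))

  constant-steps : ∀ k d → d ≢ 0F → Steps k
  constant-steps k d d≢0 = replicate k d , length-replicate k , All.replicate⁺ k d≢0

  elements : ∀ {m} → Subset m → List (Fin m)
  elements []            = []
  elements (inside  ∷ S) = zero ∷ map suc (elements S)
  elements (outside ∷ S) = map suc (elements S)

  length-elements : ∀ {m} (S : Subset m) → length (elements S) ≡ ∣ S ∣
  length-elements []            = refl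
  length-elements (inside  ∷ S) = cong suc (trans (length-map suc (elements S)) (length-elements S))
  length-elements (outside ∷ S) = trans (length-map suc (elements S)) (length-elements S)

  ∈-elements⁺ : ∀ {m} {S : Subset m} {i} → i Subset.∈ S → i ∈ elements S
  ∈-elements⁺ {S = inside  ∷ S} here      = here refl
  ∈-elements⁺ {S = inside  ∷ S} (there q) = there (∈-map⁺ suc (∈-elements⁺ q))
  ∈-elements⁺ {S = outside ∷ S} (there q) = ∈-map⁺ suc (∈-elements⁺ q)

  ∈-elements⁻ : ∀ {m} {S : Subset m} {i} → i ∈ elements S → i Subset.∈ S
  ∈-elements⁻ {S = inside  ∷ S} (here refl) = here
  ∈-elements⁻ {S = inside  ∷ S} (there q) with _ , q′ , refl ← ∈-map⁻ suc q = there (∈-elements⁻ q′)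
  ∈-elements⁻ {S = outside ∷ S} q with _ , q′ , refl ← ∈-map⁻ suc q = there (∈-elements⁻ q′)

  -- The multiples i·d are taken with natural i, so the sign of a difference decides which half of
  -- the progression is used.
  Sk-stable : ∀ {k S} → SkType k S → Stable k (elements S)
  Sk-stable {k} {S} (_ , sk) a a∈S with d , d≢0 , ap ← sk a (∈-elements⁻ a∈S) = constant-steps k d d≢0 , moves
    where
    moves : ∀ σ σ′ → Sub (replicate k d) σ → Sub (replicate k d) σ′ → a +F (σ′ -F σ) ∈ elements S
    moves σ σ′ s s′ with i , i≤k , refl ← Sub-replicate k d s | j , j≤k , refl ← Sub-replicate k d s′ with ℕ.≤-total i j
    ... | inj₁ i≤j = subst (_∈ elements S) (cong (a +F_) (begin
        (j ∸ i) ·F d                          ≡⟨ solve 2 (λ x y → y := (x :+ y) :- x) refl (i ·F d) ((j ∸ i) ·F d) ⟩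
        i ·F d +F (j ∸ i) ·F d -F i ·F d      ≡⟨ cong (_-F i ·F d) (·F-+ i (j ∸ i) d) ⟨
        (i + (j ∸ i)) ·F d -F i ·F d          ≡⟨ cong (λ m → m ·F d -F i ·F d) (ℕ.m+[n∸m]≡n i≤j) ⟩
        j ·F d -F i ·F d                      ∎))
      (∈-elements⁺ (proj₁ (ap (j ∸ i) (ℕ.≤-trans (ℕ.m∸n≤m j i) j≤k))))
    ... | inj₂ j≤i = subst (_∈ elements S) (cong (a +F_) (begin
        -F ((i ∸ j) ·F d)                         ≡⟨ solve 2 (λ x y → :- y := x :- (x :+ y)) refl (j ·F d) ((i ∸ j) ·F d) ⟩
        j ·F d -F (j ·F d +F (i ∸ j) ·F d)        ≡⟨ cong (λ z → j ·F d -F z) (·F-+ j (i ∸ j) d) ⟨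
        j ·F d -F (j + (i ∸ j)) ·F d              ≡⟨ cong (λ m → j ·F d -F m ·F d) (ℕ.m+[n∸m]≡n j≤i) ⟩
        j ·F d -F i ·F d                          ∎))
      (∈-elements⁺ (proj₂ (ap (i ∸ j) (ℕ.≤-trans (ℕ.m∸n≤m i j) i≤k))))

  Nk-attracting : ∀ {k S} → NkType k S → Attracting k (elements S) (const 0)
  Nk-attracting {k} {S} (_ , nk) a a∉S with d , d≢0 , ap ← nk a (a∉S ∘ ∈-elements⁺) =
    constant-steps k d d≢0 , λ σ s → inj₁ (moves σ s)
    where
    moves : ∀ σ → Sub⁺ (replicate k d) σ → a +F σ ∈ elements S
    moves σ s with i , 1≤i , i≤k , refl ← Sub⁺-replicate k d s = ∈-elements⁺ (ap i 1≤i i≤k)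

  -- Sumsets of balanced sets

  Balanced : List F → Set
  Balanced C = ∀ a → a ∈ C → ∃ λ d → d ≢ 0F × a +F d ∈ C × a -F d ∈ C

  -- Repeated sums are kept, which makes the length exactly |C|^k, an upper bound for the size.
  sumset : ℕ → List F → List F
  sumset zero    C = 0F ∷ []
  sumset (suc k) C = concatMap (λ b → map (b +F_) (sumset k C)) C

  length-sumset : ∀ k C → length (sumset k C) ≡ length C ^ k
  length-sumset zero    C = refl
  length-sumset (suc k) C = go C
    where
    go : ∀ D → length (concatMap (λ b → map (b +F_) (sumset k C)) D) ≡ length D * length C ^ k
    go []      = refl
    go (b ∷ D) = trans (length-++ (map (b +F_) (sumset k C)))
      (cong₂ _+_ (trans (length-map (b +F_) (sumset k C)) (length-sumset k C)) (go D))

  ∈-sumset⁺ : ∀ k {C b a} → b ∈ C → a ∈ sumset k C → b +F a ∈ sumset (suc k) C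
  ∈-sumset⁺ k {C} b∈C a∈ = ∈-concatMap⁺ (λ b → map (b +F_) (sumset k C)) (lose b∈C (∈-map⁺ _ a∈))

  ∈-sumset⁻ : ∀ k {C x} → x ∈ sumset (suc k) C → ∃₂ λ b a → b ∈ C × a ∈ sumset k C × x ≡ b +F a
  ∈-sumset⁻ k {C} x∈ with b , b∈C , q ← find (∈-concatMap⁻ (λ b → map (b +F_) (sumset k C)) x∈)
    with a , a∈ , eq ← ∈-map⁻ (b +F_) q = b , a , b∈C , a∈ , eq

  -- In x = b₁ + ... + b_k each summand brings the step d_i that balances it. A difference of subset
  -- sums moves b_i by d_i, -d_i or 0, hence within `C`.
  sumset-stable : ∀ {C} → Balanced C → ∀ k → Stable k (sumset k C)
  sumset-stable bal zero    a (here refl) = ([] , refl , []) , λ { _ _ [] [] → here (trans (+F-identityˡ _) (-F-inverseʳ 0F)) }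
  sumset-stable {C} bal (suc k) x x∈ with b , a , b∈C , a∈ , refl ← ∈-sumset⁻ k x∈
    with d , d≢0 , b+d∈C , b-d∈C ← bal b b∈C
    with (ds , len , ds≢0) , moves ← sumset-stable bal k a a∈ =
    (d ∷ ds , cong suc len , d≢0 ∷ ds≢0) , moves′
    where
    regroup : ∀ b η a ζ {y} → (b +F η) +F (a +F ζ) ≡ y → b +F η ∈ C → a +F ζ ∈ sumset k C → y ∈ sumset (suc k) C
    regroup b η a ζ refl = ∈-sumset⁺ k
    b+0∈C : b +F 0F ∈ C
    b+0∈C = subst (_∈ C) (sym (+F-identityʳ b)) b∈C
    moves′ : ∀ σ σ′ → Sub (d ∷ ds) σ → Sub (d ∷ ds) σ′ → (b +F a) +F (σ′ -F σ) ∈ sumset (suc k) C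
    moves′ σ σ′ (skip s) (skip s′) = regroup b 0F a (σ′ -F σ)
      (solve 3 (λ b a z → (b :+ con (+ 0)) :+ (a :+ z) := (b :+ a) :+ z) refl b a (σ′ -F σ))
      b+0∈C (moves σ σ′ s s′)
    moves′ σ _ (skip s) (take {σ = σ′} s′) = regroup b d a (σ′ -F σ)
      (solve 5 (λ b a d x y → (b :+ d) :+ (a :+ (y :- x)) := (b :+ a) :+ ((d :+ y) :- x)) refl b a d σ σ′)
      b+d∈C (moves σ σ′ s s′)
    moves′ _ σ′ (take {σ = σ} s) (skip s′) = regroup b (-F d) a (σ′ -F σ)
      (solve 5 (λ b a d x y → (b :+ (:- d)) :+ (a :+ (y :- x)) := (b :+ a) :+ (y :- (d :+ x))) refl b a d σ σ′)
      b-d∈C (moves σ σ′ s s′)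
    moves′ _ _ (take {σ = σ} s) (take {σ = σ′} s′) = regroup b 0F a (σ′ -F σ)
      (solve 5 (λ b a d x y → (b :+ con (+ 0)) :+ (a :+ (y :- x)) := (b :+ a) :+ ((d :+ y) :- (d :+ x))) refl b a d σ σ′)
      b+0∈C (moves σ σ′ s s′)

  -- m summands 1 and k - m summands 0.
  ⟦⟧∈sumset : ∀ {C} → 0F ∈ C → 1F ∈ C → ∀ k m → m ≤ k → ⟦ m ⟧ ∈ sumset k C
  ⟦⟧∈sumset 0∈C 1∈C zero    zero    z≤n       = here refl
  ⟦⟧∈sumset {C} 0∈C 1∈C (suc k) zero    z≤n       =
    subst (_∈ sumset (suc k) C) (+F-identityˡ 0F) (∈-sumset⁺ k 0∈C (⟦⟧∈sumset 0∈C 1∈C k 0 z≤n))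
  ⟦⟧∈sumset {C} 0∈C 1∈C (suc k) (suc m) (s≤s m≤k) =
    subst (_∈ sumset (suc k) C) (⟦⟧-+ 1 m) (∈-sumset⁺ k 1∈C (⟦⟧∈sumset 0∈C 1∈C k m m≤k))

  ⟦⟧-∸ : ∀ {m i} → i ≤ m → ⟦ m ⟧ -F ⟦ i ⟧ ≡ ⟦ m ∸ i ⟧
  ⟦⟧-∸ {m} {i} i≤m = begin
    ⟦ m ⟧ -F ⟦ i ⟧                    ≡⟨ cong (λ x → ⟦ x ⟧ -F ⟦ i ⟧) (ℕ.m+[n∸m]≡n i≤m) ⟨
    ⟦ i + (m ∸ i) ⟧ -F ⟦ i ⟧          ≡⟨ cong (_-F ⟦ i ⟧) (⟦⟧-+ i (m ∸ i)) ⟨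
    ⟦ i ⟧ +F ⟦ m ∸ i ⟧ -F ⟦ i ⟧       ≡⟨ solve 2 (λ x y → (x :+ y) :- x := y) refl ⟦ i ⟧ ⟦ m ∸ i ⟧ ⟩
    ⟦ m ∸ i ⟧                         ∎

  -- Residues outside a set containing 0, …, k-1 descend in steps of -1.
  initial-attracting : ∀ k {C} → (∀ m → m < k → ⟦ m ⟧ ∈ C) → Attracting k C toℕ
  initial-attracting k {C} initial a a∉C with toℕ a <? k
  ... | yes a<k = contradiction (subst (_∈ C) (⟦toℕ⟧ a) (initial (toℕ a) a<k)) a∉C
  ... | no a≮k  = constant-steps k (-F 1F) (-F≢0F 1F≢0F) , λ σ s → inj₂ (descend σ s)
    where
    descend : ∀ σ → Sub⁺ (replicate k (-F 1F)) σ → toℕ (a +F σ) < toℕ a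
    descend σ s with i , 1≤i , i≤k , refl ← Sub⁺-replicate k (-F 1F) s =
      subst (_< toℕ a) (sym value) (ℕ.∸-monoʳ-< 1≤i i≤a)
      where
      -- At most k steps start from a residue that is at least k, so none of them wraps around 0.
      i≤a : i ≤ toℕ a
      i≤a = ℕ.≤-trans i≤k (ℕ.≮⇒≥ a≮k)
      value : toℕ (a +F i ·F (-F 1F)) ≡ toℕ a ∸ i
      value = begin
        toℕ (a +F i ·F (-F 1F))           ≡⟨ cong (λ z → toℕ (a +F z)) (·F-* i (-F 1F)) ⟩
        toℕ (a +F ⟦ i ⟧ *F (-F 1F))       ≡⟨ cong toℕ (solve 2 (λ a x → a :+ x :* (:- con (+ 1)) := a :- x) refl a ⟦ i ⟧) ⟩
        toℕ (a -F ⟦ i ⟧)                  ≡⟨ cong (λ z → toℕ (z -F ⟦ i ⟧)) (⟦toℕ⟧ a) ⟨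
        toℕ (⟦ toℕ a ⟧ -F ⟦ i ⟧)          ≡⟨ cong toℕ (⟦⟧-∸ i≤a) ⟩
        toℕ ⟦ toℕ a ∸ i ⟧                 ≡⟨ toℕ-⟦⟧ (toℕ a ∸ i) ⟩
        (toℕ a ∸ i) % p   ≡⟨ m<n⇒m%n≡m (ℕ.≤-<-trans (ℕ.m∸n≤m (toℕ a) i) (toℕ<n a)) ⟩
        toℕ a ∸ i                         ∎

  balanced⇒nonvanishing : ∀ {C} → Balanced C → 0F ∈ C → 1F ∈ C → ∀ k → length C ^ k * length C ^ k < p →
    ∀ {n} (hs hs′ : List (V n)) → Indep hs → Indep hs′ → ¬ Null (powersOf k (hs ++ hs′)) δ[ 0V ]
  balanced⇒nonvanishing {C} bal 0∈C 1∈C k small {n} =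
    nonvanishing k (sumset k C) (sumset k C) toℕ (sumset-stable bal k) (sumset-stable bal k)
      (initial-attracting k (λ m m<k → ⟦⟧∈sumset 0∈C 1∈C k m (ℕ.<⇒≤ m<k)))
      (subst (λ m → m * m < p) (sym (length-sumset k C)) small)
      0F (⟦⟧∈sumset 0∈C 1∈C k 0 z≤n) δ[ 0V ] δ[]-support (δ[]-nonzero {n})

  -- The balanced set {0} ∪ {± ⌊p/2^i⌋}

  halves : ℕ → ℕ → List ℕ
  halves zero    n = []
  halves (suc f) n = ⌊ n /2⌋ ∷ halves f ⌊ n /2⌋

  length-halves : ∀ f n → length (halves f n) ≡ f
  length-halves zero    n = refl
  length-halves (suc f) n = cong suc (length-halves f ⌊ n /2⌋)

  -- Each entry will be balanced by means of the one before it; the chain begins at p, which stands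
  -- for the residue 0.
  halves-parent : ∀ f n {m} → m ∈ halves f n → ∃ λ m′ → m′ ∈ n ∷ halves f n × m ≡ ⌊ m′ /2⌋
  halves-parent (suc f) n (here refl) = n , here refl , refl
  halves-parent (suc f) n (there q) with m′ , q′ , eq ← halves-parent f ⌊ n /2⌋ q = m′ , there q′ , eq

  halves-≤ : ∀ f n {m} → m ∈ n ∷ halves f n → m ≤ n
  halves-≤ f       n (here refl) = ℕ.≤-refl
  halves-≤ (suc f) n (there q)   = ℕ.≤-trans (halves-≤ f ⌊ n /2⌋ q) (ℕ.⌊n/2⌋≤n n)

  -- Halving a number that is at least 2 leaves at least 1, and f halvings bring a number below 2^(f
  -- + 1) under 2, so the sequence passes through 1.
  1∈halves : ∀ f n → 2 ≤ n → n < 2 ^ suc f → 1 ∈ halves f n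
  1∈halves zero    n 2≤n n<2 = contradiction n<2 (ℕ.≤⇒≯ 2≤n)
  1∈halves (suc f) n 2≤n n<  with ⌊ n /2⌋ ℕ.≟ 1
  ... | yes eq = here (sym eq)
  ... | no ≢1  = there (1∈halves f ⌊ n /2⌋ (ℕ.≤∧≢⇒< (ℕ.⌊n/2⌋-mono 2≤n) (≢1 ∘ sym)) (half< n (2 ^ suc f) n<))
    where
    half< : ∀ n m → n < 2 * m → ⌊ n /2⌋ < m
    half< n m n<2m = ℕ.*-cancelˡ-< 2 ⌊ n /2⌋ m (ℕ.≤-<-trans (2⌊n/2⌋≤n n) n<2m)
      where
      2⌊n/2⌋≤n : ∀ n → 2 * ⌊ n /2⌋ ≤ n
      2⌊n/2⌋≤n n = subst (2 * ⌊ n /2⌋ ≤_) (ℕ.⌊n/2⌋+⌈n/2⌉≡n n)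
        (ℕ.+-monoʳ-≤ ⌊ n /2⌋ (subst (_≤ ⌈ n /2⌉) (sym (ℕ.+-identityʳ ⌊ n /2⌋)) (ℕ.⌊n/2⌋≤⌈n/2⌉ n)))

  ⌈n/2⌉-cases : ∀ n → ⌈ n /2⌉ ≡ ⌊ n /2⌋ ⊎ ⌈ n /2⌉ ≡ suc ⌊ n /2⌋
  ⌈n/2⌉-cases zero          = inj₁ refl
  ⌈n/2⌉-cases (suc zero)    = inj₂ refl
  ⌈n/2⌉-cases (suc (suc n)) with ⌈n/2⌉-cases n
  ... | inj₁ eq = inj₁ (cong suc eq)
  ... | inj₂ eq = inj₂ (cong suc eq)

  ±_ : List ℕ → List F
  ± ns = 0F ∷ concatMap (λ m → ⟦ m ⟧ ∷ (-F ⟦ m ⟧) ∷ []) ns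

  length-± : ∀ ns → length (± ns) ≡ suc (2 * length ns)
  length-± ns = cong suc (go ns)
    where
    go : ∀ ns → length (concatMap (λ m → ⟦ m ⟧ ∷ (-F ⟦ m ⟧) ∷ []) ns) ≡ 2 * length ns
    go []       = refl
    go (m ∷ ns) = trans (cong (λ x → 2 + x) (go ns)) (sym (ℕ.*-suc 2 (length ns)))

  +∈± : ∀ ns {m} → m ∈ ns → ⟦ m ⟧ ∈ ± ns
  +∈± ns q = there (∈-concatMap⁺ (λ m → ⟦ m ⟧ ∷ (-F ⟦ m ⟧) ∷ []) (lose q (here refl)))

  -∈± : ∀ ns {m} → m ∈ ns → -F ⟦ m ⟧ ∈ ± ns
  -∈± ns q = there (∈-concatMap⁺ (λ m → ⟦ m ⟧ ∷ (-F ⟦ m ⟧) ∷ []) (lose q (there (here refl))))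

  ∈±⁻ : ∀ ns {a} → a ∈ ± ns → a ≡ 0F ⊎ ∃ λ m → m ∈ ns × (a ≡ ⟦ m ⟧ ⊎ a ≡ -F ⟦ m ⟧)
  ∈±⁻ ns (here eq) = inj₁ eq
  ∈±⁻ ns (there q) with m , m∈ , q′ ← find (∈-concatMap⁻ (λ m → ⟦ m ⟧ ∷ (-F ⟦ m ⟧) ∷ []) {xs = ns} q) with q′
  ... | here eq         = inj₂ (m , m∈ , inj₁ eq)
  ... | there (here eq) = inj₂ (m , m∈ , inj₂ eq)

  neg∈± : ∀ ns {a} → a ∈ ± ns → -F a ∈ ± ns
  neg∈± ns q with ∈±⁻ ns q
  ... | inj₁ refl                 = here (solve 0 (:- con (+ 0) := con (+ 0)) refl)
  ... | inj₂ (m , m∈ , inj₁ refl) = -∈± ns m∈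
  ... | inj₂ (m , m∈ , inj₂ refl) = subst (_∈ ± ns) (solve 1 (λ x → x := :- (:- x)) refl ⟦ m ⟧) (+∈± ns m∈)

  module _ (f : ℕ) (p<2^1+f : p < 2 ^ suc f) where

    private
      ns : List ℕ
      ns = halves f p

      1∈ns : 1 ∈ ns
      1∈ns = 1∈halves f p 1<p p<2^1+f

      Centre : F → Set
      Centre a = ∃ λ d → d ≢ 0F × a +F d ∈ ± ns × a -F d ∈ ± ns

      centre-0 : Centre 0F
      centre-0 = 1F , 1F≢0F , subst (_∈ ± ns) (sym (+F-identityˡ 1F)) (+∈± ns 1∈ns) ,
        subst (_∈ ± ns) (sym (+F-identityˡ (-F 1F))) (-∈± ns 1∈ns)

      centre-neg : ∀ {a} → Centre a → Centre (-F a)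
      centre-neg {a} (d , d≢0 , a+d∈ , a-d∈) = d , d≢0 ,
        subst (_∈ ± ns) (solve 2 (λ a d → :- (a :- d) := :- a :+ d) refl a d) (neg∈± ns a-d∈) ,
        subst (_∈ ± ns) (solve 2 (λ a d → :- (a :+ d) := :- a :- d) refl a d) (neg∈± ns a+d∈)

      -- 2⌊m/2⌋ is m or m - 1, so ⌊m/2⌋ is the midpoint of m and 0 or -1.
      centre-half : ∀ m → m ∈ p ∷ ns → 0 < ⌊ m /2⌋ → Centre ⟦ ⌊ m /2⌋ ⟧
      centre-half m m∈ 0<h = ⟦ c ⟧ , ⟦⟧≢0 c 0<c c<p , subst (_∈ ± ns) (sym up) (parent∈ m∈) , down (⌈n/2⌉-cases m)
        where
        h c : ℕ
        h = ⌊ m /2⌋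
        c = ⌈ m /2⌉
        0<c : 0 < c
        0<c = ℕ.<-≤-trans 0<h (ℕ.⌊n/2⌋≤⌈n/2⌉ m)
        c<p : c < p
        c<p = ℕ.<-≤-trans (subst (c <_) (ℕ.⌊n/2⌋+⌈n/2⌉≡n m) (ℕ.m<n+m c 0<h)) (halves-≤ f p m∈)
        up : ⟦ h ⟧ +F ⟦ c ⟧ ≡ ⟦ m ⟧
        up = trans (⟦⟧-+ h c) (cong ⟦_⟧ (ℕ.⌊n/2⌋+⌈n/2⌉≡n m))
        parent∈ : ∀ {m} → m ∈ p ∷ ns → ⟦ m ⟧ ∈ ± ns
        parent∈ (here refl) = here ⟦p⟧
        parent∈ (there q)   = +∈± ns q
        down : c ≡ h ⊎ c ≡ suc h → ⟦ h ⟧ -F ⟦ c ⟧ ∈ ± ns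
        down (inj₁ eq) = here (trans (cong (λ z → ⟦ h ⟧ -F ⟦ z ⟧) eq) (-F-inverseʳ ⟦ h ⟧))
        down (inj₂ eq) = subst (_∈ ± ns) (sym (trans (cong (λ z → ⟦ h ⟧ -F z) (trans (cong ⟦_⟧ eq) (sym (⟦⟧-+ 1 h))))
          (solve 1 (λ x → x :- (con (+ 1) :+ x) := :- con (+ 1)) refl ⟦ h ⟧))) (-∈± ns 1∈ns)

      centre-ns : ∀ m → m ∈ ns → Centre ⟦ m ⟧
      -- Halving may go on after 1 is reached, and then 0 occurs in the list.
      centre-ns zero    m∈ = centre-0
      centre-ns (suc m) m∈ with m′ , m′∈ , eq ← halves-parent f p m∈ =
        subst (λ z → Centre ⟦ z ⟧) (sym eq) (centre-half m′ m′∈ (subst (0 <_) eq (s≤s z≤n)))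

    ±halves-balanced : Balanced (± halves f p)
    ±halves-balanced a a∈ with ∈±⁻ (halves f p) a∈
    ... | inj₁ refl                  = centre-0
    ... | inj₂ (m , m∈ , inj₁ refl) = centre-ns m m∈
    ... | inj₂ (m , m∈ , inj₂ refl) = centre-neg (centre-ns m m∈)

    ±halves-nonvanishing : ∀ k → suc (2 * f) ^ k * suc (2 * f) ^ k < p →
      ∀ {n} (hs hs′ : List (V n)) → Indep hs → Indep hs′ → ¬ Null (powersOf k (hs ++ hs′)) δ[ 0V ]
    ±halves-nonvanishing k small = balanced⇒nonvanishing ±halves-balanced (here refl) (+∈± ns 1∈ns) k
      (subst (λ m → m ^ k * m ^ k < p) (sym (trans (length-± ns) (cong (λ l → suc (2 * l)) (length-halves f p)))) small)

-- From stable sets to the three assertions.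

module Conclusions (p : ℕ) (pr : Prime p) where

  open import Data.Nat using (zero; suc; _≤?_; _+_)
  import Data.Nat.Properties as ℕ
  open import Data.Nat.DivMod using (_%_; m%n%n≡m%n)
  import Data.Fin as Fin
  open import Data.List using (List; map; _++_)
  open import Data.List.Properties using (length-map)
  open import Data.List.Membership.Propositional using (_∈_)
  open import Data.List.Membership.Propositional.Properties using (∈-map⁺; ∈-map⁻)
  import Data.List.Relation.Unary.All as All
  open import Data.Product using (proj₁; proj₂)
  open import Function using (const)
  open import Relation.Nullary using (Dec; yes; no)
  open import Relation.Binary.PropositionalEquality using (refl; sym; trans; cong; cong₂; subst)
  open Numeric
  open SmallPrimes
  open Fp p pr hiding (cons; _-V_)
  open Field p pr
  open Differences p pr
  open Targets p pr using (powersOf)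
  open Products p pr
  open GroupRing p pr
  open Radon p pr
  open StableSets p pr

  certificate-balanced : ∀ {cs} → NonZeroValid (p , cs) → Balanced (map ⟦_⟧ (support cs))
  certificate-balanced {cs} (_ , valid , _) a a∈
    with m , m∈ , refl ← ∈-map⁻ ⟦_⟧ a∈ with (m , d) , q , refl ← ∈-map⁻ proj₁ m∈ =
    let 0<d , d<p , up , down = All.lookup valid q
    in ⟦ d ⟧ , ⟦⟧≢0 d 0<d d<p , reduced m d up (⟦⟧-+ m d) , reduced m (p ∸ d) down (minus m d (ℕ.<⇒≤ d<p))
    where
    reduced : ∀ m d → (m + d) % p ∈ support cs → ∀ {b} → b ≡ ⟦ m + d ⟧ → b ∈ map ⟦_⟧ (support cs)
    reduced m d q eq = subst (_∈ map ⟦_⟧ (support cs))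
      (trans (⟦⟧-cong _ _ (m%n%n≡m%n (m + d) p)) (sym eq)) (∈-map⁺ ⟦_⟧ q)
    minus : ∀ m d → d ≤ p → ⟦ m ⟧ -F ⟦ d ⟧ ≡ ⟦ m + (p ∸ d) ⟧
    minus m d d≤p = trans (cong (⟦ m ⟧ +F_) (trans (sym (+F-identityˡ (-F ⟦ d ⟧)))
      (trans (cong (_-F ⟦ d ⟧) (sym ⟦p⟧)) (⟦⟧-∸ d≤p)))) (⟦⟧-+ m (p ∸ d))

  Nonvanishing : ℕ → Set
  Nonvanishing k = ∀ {n} (hs hs′ : List (V n)) → Indep hs → Indep hs′ → ¬ Null (powersOf k (hs ++ hs′)) δ[ 0V ]

  bracket : ∃ λ f → 2 ^ f ≤ p × p < 2 ^ suc f
  bracket = subst (λ m → ∃ λ f → 2 ^ f ≤ m × m < 2 ^ suc f) (ℕ.m+[n∸m]≡n (ℕ.<⇒≤ 1<p)) (log₂-bracket (p ∸ 1))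

  nonvanishing-certified : (∃ λ cs → NonZeroValid (p , cs)) → Nonvanishing 1
  nonvanishing-certified (cs , valid@(_ , _ , 0∈ , 1∈ , small)) =
    balanced⇒nonvanishing (certificate-balanced {cs} valid) (∈-map⁺ ⟦_⟧ 0∈) (∈-map⁺ ⟦_⟧ 1∈) 1
      (subst (λ b → b * b < p) (sym (trans (ℕ.^-identityʳ _) (trans (length-map ⟦_⟧ (support cs)) (length-map proj₁ cs)))) small)

  nonvanishing-1 : 61 < p → p ≢ 79 → Nonvanishing 1
  nonvanishing-1 61<p p≢79 = cases (290 ≤? p) bracket
    where
    cases : Dec (290 ≤ p) → (∃ λ f → 2 ^ f ≤ p × p < 2 ^ suc f) → Nonvanishing 1
    cases (yes 290≤p) (f , lo , hi) =
      ±halves-nonvanishing f hi 1 (subst (λ b → b * b < p) (sym (ℕ.^-identityʳ (suc (2 * f)))) (halves-small f p 290≤p lo hi))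
    cases (no 290≰p)  _ = nonvanishing-certified (small-prime-certificate p pr 61<p (ℕ.≰⇒> 290≰p) p≢79)

  nonvanishing-k : ∀ k → 2 ≤ k → k ^ (20 * k) < p → Nonvanishing k
  nonvanishing-k k 2≤k k^20k<p = let f , lo , hi = bracket in
    ±halves-nonvanishing f hi k (sumset-small k f p 2≤k k^20k<p lo hi)

  avoiding : ∀ {k} → Nonvanishing k → ∀ {n} (M : Mat n) → Nonsingular M → (c d : Fin n → Fin k → F) →
             ∃ λ (x : Vecp n) → ∀ i l → x i ≢ c i l × mulMV M x i ≢ d i l
  avoiding nonv M (N , MN≡1 , _) =
    avoiding-vector M (nonv (rows idMat) (rows M) (Indep-rows idMat idMat mulMM-idMat) (Indep-rows M N MN≡1))

  avoiding-1 : Nonvanishing 1 → ∀ {n} (M : Mat n) → Nonsingular M → (c d : Vecp n) →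
               ∃ λ (x : Vecp n) → (∀ i → x i ≢ c i) × (∀ i → mulMV M x i ≢ d i)
  avoiding-1 nonv M M-nonsingular c d =
    let x , avoids = avoiding nonv M M-nonsingular (λ i _ → c i) (λ i _ → d i)
    in x , (λ i → proj₁ (avoids i Fin.zero)) , (λ i → proj₂ (avoids i Fin.zero))

  product-nonzero : ∀ {n} (M : Mat n) → Nonsingular M → ∀ k →
    (∃ λ s → ∃ λ t → IsMinSize (SkType k) s × IsMinSize (NkType k) t × t * s < p ∸ 1) →
    ¬ (∀ v → (prodGR (λ i → powGR (oneGR -GR g^ (e i)) k) ⋆ prodGR (λ i → powGR (oneGR -GR g^ (M i)) k)) v ≡ zeroGR v)
  product-nonzero {n} M (N , MN≡1 , _) k (_ , _ , ((S , S-type@((b , b∈S) , _) , refl) , _) , ((A , A-type , refl) , _) , ts<p-1) vanish =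
    -- The N_k-type set is the attracting one: a single move brings every outside residue in, so the
    -- potential is constant. The S_k-type set confines the smaller family.
    nonvanishing k (elements A) (elements S) (const 0) (Sk-stable (proj₁ A-type)) (Sk-stable S-type) (Nk-attracting A-type)
      (subst (_< p) (sym (cong₂ _*_ (length-elements A) (length-elements S))) (ℕ.<-≤-trans ts<p-1 (ℕ.m∸n≤m p 1)))
      b (∈-elements⁺ b∈S) δ[ 0V ] δ[]-support (δ[]-nonzero {n})
      (rows idMat) (rows M) (Indep-rows idMat idMat mulMM-idMat) (Indep-rows M N MN≡1) (product-null idMat M k vanish)

theorem1 : (∀ (n : ℕ) → 1 ≤ n → (p : ℕ) → (pr : Prime p) → let open Fp p pr in
    (M : Mat n) → Nonsingular M → (k : ℕ) → 1 ≤ k → k < p →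
    (∃ λ s → ∃ λ t → IsMinSize (SkType k) s × IsMinSize (NkType k) t × t * s < p ∸ 1) →
    ¬ (∀ v → (prodGR (λ i → powGR (oneGR -GR g^ (e i)) k)
    ⋆ prodGR (λ i → powGR (oneGR -GR g^ (M i)) k)) v ≡ zeroGR v))
    ×
    (∀ (n : ℕ) → 1 ≤ n → (p : ℕ) → (pr : Prime p) → let open Fp p pr in
    61 < p → p ≢ 79 → (M : Mat n) → Nonsingular M → (c d : Vecp n) →
    ∃ λ (x : Vecp n) → (∀ i → x i ≢ c i) × (∀ i → mulMV M x i ≢ d i))
    ×
    (∃ λ (K : ℕ) → ∀ (n : ℕ) → 1 ≤ n → (k : ℕ) → 2 ≤ k → (p : ℕ) → (pr : Prime p) →
    let open Fp p pr in
    k ^ (K * k) < p → (M : Mat n) → Nonsingular M →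
    (c d : Fin n → Fin k → F) →
    (∀ i → Injective _≡_ _≡_ (c i)) → (∀ i → Injective _≡_ _≡_ (d i)) →
    ∃ λ (x : Vecp n) → ∀ i l → x i ≢ c i l × mulMV M x i ≢ d i l)
theorem1 =
  (λ n _ p pr M M-nonsingular k _ _ → Conclusions.product-nonzero p pr M M-nonsingular k) ,
  (λ n _ p pr 61<p p≢79 → Conclusions.avoiding-1 p pr (Conclusions.nonvanishing-1 p pr 61<p p≢79)) ,
  -- 20 = 2 * 10: two sumsets of length (2f + 1)^k, f = ⌊log₂ p⌋, require (2f + 1)^(2k) < p, and
  -- taking 2k-th roots turns k^(20k) into the k^10 of `8kh<2^h`.
  20 , λ n _ k 2≤k p pr k^20k<p M M-nonsingular c d _ _ →
    Conclusions.avoiding p pr (Conclusions.nonvanishing-k p pr k 2≤k k^20k<p) M M-nonsingular c d
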